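{- Let $n \ge 2$ and let $1\le i<j\le n$. Then $$c_{i,j}(n)=\begin{cases} \dfrac{n}{\binom{n+j}{2}}, & \text{if } i+1 < j \leq n, \\[2ex] \dfrac{n}{\binom{n+j}{2}}+\dfrac{ni}{\binom{n+i}{2}}, & \text{if } i+1 = j \leq n. \end{cases}$$
   Context: Continuous multiline queues. Let $m=(m_1,\ldots,m_n)$ be a tuple of nonnegative integers, $S_i=m_1+\cdots+m_i$ and $N=S_1+\cdots+S_n$. A continuous multiline queue (identified with its placement) of type $m$ is an array $M$ with $n$ rows in which row $i$ is a strictly increasing sequence $M_{i,1}<\cdots<M_{i,S_i}$ of integers and the $N$ entries of $M$ are exactly the integers $1,\ldots,N$, each used once. Bully path procedure. Initially all entries are available. For $r=1,\ldots,n-1$ in turn: every entry of row $r$ that is still available starts a bully path. An entry $x$ of row $r'$ on the path bullies (written $x\to y$) the entry $y$ of row $r'+1$ which is the smallest available entry of row $r'+1$ larger than $x$; if no available entry of row $r'+1$ is larger than $x$, it bullies the smallest available entry of row $r'+1$ (a wrapping). Bullied entries become unavailable, the path continues from $y$ down to row $n$, and its endpoint in row $n$ receives label $r$ (entries on the path, including the starting one, become unavailable). The labels do not depend on the order in which paths starting in a given row are constructed. Finally, the entries of row $n$ still available receive label $n$. The projected word is $\omega=\mathbf{B}(M)=(\omega_1,\ldots,\omega_{S_n})$, where $\omega_k$ is the label of $M_{n,k}$; it is read cyclically. Correlations. For the type $(1,1,\ldots,1)$ ($n$ ones), each label $1,\ldots,n$ appears exactly once in the projected word (of length $n$). Choose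 a continuous multiline queue $M$ of type $(1,\ldots,1)$ uniformly at random and let $\omega=\mathbf{B}(M)$. Define $c_{i,j}(n)$ as the probability that in the cyclic word $\omega$ the letter $i$ is immediately followed by the letter $j$, i.e. $\omega_a=i$ and $\omega_{a+1}=j$ for some $a\in[n]$ (indices mod $n$). (This is the two-point correlation of adjacent particles $i$, $j$ in the continuous multispecies TASEP on a ring of type $(1,\ldots,1)$, whose distribution equals the law of the projected word of a uniformly random continuous multiline queue.) -}

module Defs where

open import Data.Nat using (ℕ; zero; suc; _+_; _*_; _∸_; _≡ᵇ_; _<ᵇ_)
open import Data.Bool using (Bool; true; false; if_then_else_; not; _∧_)
open import Data.List using (List; []; _∷_; [_]; map; concatMap; upTo; length; zip; drop; take; _++_; foldr)
open import Data.Bool.ListAction using (any; all)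
open import Data.Maybe using (Maybe; just; nothing; _<∣>_; maybe)
open import Data.Product using (_×_; _,_; proj₁; proj₂)
open import Data.Integer using (+_)
open import Data.Rational using (ℚ; 0ℚ; _/_)

bfilter : {A : Set} → (A → Bool) → List A → List A
bfilter p [] = []
bfilter p (x ∷ xs) = if p x then x ∷ bfilter p xs else bfilter p xs

oneTo : ℕ → List ℕ
oneTo n = map suc (upTo n)

-- a / b as a rational number (a / 0 := 0; only used with b ≠ 0)
frac : ℕ → ℕ → ℚ
frac a zero = 0ℚ
frac a (suc b) = (+ a) / suc b

-- N = S_1 + ... + S_n for type (1,...,1): S_i = i
tri : ℕ → ℕ
tri zero = 0
tri (suc n) = suc n + tri n

words : ℕ → ℕ → List (List ℕ)
words n zero = [ [] ]
words n (suc L) = concatMap (λ w → map (λ r → r ∷ w) (oneTo n)) (words n L)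

countOcc : ℕ → List ℕ → ℕ
countOcc r w = length (bfilter (λ x → x ≡ᵇ r) w)

-- A continuous multiline queue of type (1,...,1) (n rows) is identified
-- with the word w of length N whose k-th letter is the row containing the
-- integer k; row r must contain exactly S_r = r integers.
isMLQ : ℕ → List ℕ → Bool
isMLQ n w = all (λ r → countOcc r w ≡ᵇ r) (oneTo n)

MLQs : ℕ → List (List ℕ)
MLQs n = bfilter (isMLQ n) (words n (tri n))

rowOf : List ℕ → ℕ → List ℕ
rowOf w r = map proj₁ (bfilter (λ p → proj₂ p ≡ᵇ r) (zip (oneTo (length w)) w))

-- available entries of each row (sorted increasingly)
Avail : Set
Avail = ℕ → List ℕ

upd : Avail → ℕ → List ℕ → Avail
upd av r l r' = if r' ≡ᵇ r then l else av r'

remove : ℕ → List ℕ → List ℕ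
remove y = bfilter (λ z → not (z ≡ᵇ y))

member : ℕ → List ℕ → Bool
member y = any (λ z → z ≡ᵇ y)

firstGt : ℕ → List ℕ → Maybe ℕ
firstGt x [] = nothing
firstGt x (y ∷ ys) = if x <ᵇ y then just y else firstGt x ys

headM : List ℕ → Maybe ℕ
headM [] = nothing
headM (y ∷ _) = just y

bully : ℕ → List ℕ → Maybe ℕ
bully x av = firstGt x av <∣> headM av

path : ℕ → ℕ → ℕ → Avail → Maybe ℕ × Avail
path zero r x av = just x , av
path (suc k) r x av with bully x (av (suc r))
... | nothing = nothing , av
... | just y = path k (suc r) y (upd av (suc r) (remove y (av (suc r))))

-- endpoint labels: list of (entry of row n, label)
Labels : Set
Labels = List (ℕ × ℕ)

startAll : ℕ → ℕ → List ℕ → Labels × Avail → Labels × Avail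
startAll n r [] st = st
startAll n r (x ∷ xs) (lab , av) with member x (av r)
... | false = startAll n r xs (lab , av)
... | true with path (n ∸ r) r x (upd av r (remove x (av r)))
...   | nothing , av' = startAll n r xs (lab , av')
...   | just e , av' = startAll n r xs ((e , r) ∷ lab , av')

phases : ℕ → List ℕ → Labels × Avail → Labels × Avail
phases n [] st = st
phases n (r ∷ rs) (lab , av) = phases n rs (startAll n r (av r) (lab , av))

lookupLab : ℕ → Labels → Maybe ℕ
lookupLab e [] = nothing
lookupLab e ((e' , l) ∷ ls) = if e ≡ᵇ e' then just l else lookupLab e ls

projWord : ℕ → List ℕ → List ℕ
projWord n w =
  let st = phases n (oneTo (n ∸ 1)) ([] , rowOf w)
      lab = proj₁ st
      av = proj₂ st
      labelOf : ℕ → ℕ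
      labelOf e = maybe (λ l → l) (if member e (av n) then n else 0) (lookupLab e lab)
  in map labelOf (rowOf w n)

cycAdj : ℕ → ℕ → List ℕ → Bool
cycAdj i j ω = any (λ p → (proj₁ p ≡ᵇ i) ∧ (proj₂ p ≡ᵇ j)) (zip ω (drop 1 ω ++ take 1 ω))

c : ℕ → ℕ → ℕ → ℚ
c i j n = frac (length (bfilter (λ w → cycAdj i j (projWord n w)) (MLQs n))) (length (MLQs n))

{-# OPTIONS --safe #-}

-- Regard row r as the arrivals and row r + 1 as the services of a queue on a cycle: bullied entries are the services that are
-- used.  The letters ≤ k of the projected word are then the departures of row k through the queues r → r + 1, k ≤ r < n.
-- Let g(i, j) be the number of adjacent letters a, b with a ≤ i and b > j.  Since the letter i occurs once,
-- [i followed by j] = g(i, j-1) + g(i-1, j) - g(i-1, j-1) - g(i, j), so it suffices to know the mean of g(i, j) for i ≤ j, namely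
-- i(n-j)/(n+j) if i < j and j(n-j+1)/(n+j-1) if i = j < n.
--
-- Turning the unused services of a queue into arrivals is a bijection that exchanges the sizes of two rows (Burke's theorem), and
-- queues in series can be interchanged.  Hence all rows but three, of sizes i, j, n, may be discarded.  By rotation one may cut the
-- cycle before the letter b > j, where the second queue is empty; as i < j the first queue may then be started empty as well, and
-- what remains is to count linear words X^i Y^j Z^(n-1) by the final state of two queues in series.  These counts are alternating
-- sums of four trinomial coefficients, as in the reflection principle, and follow by induction on the last letter.

module Submission where

open import Defs
open import Data.Bool using (Bool; true; false; if_then_else_; not; _∧_; _∨_) renaming (T to IsTrue)
open import Data.Bool.ListAction using (any; all)
open import Data.Bool.Properties using (∧-zeroʳ; ∧-identityʳ; ∨-zeroʳ)
open import Data.Empty using (⊥; ⊥-elim)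
import Data.Integer as ℤ
import Data.Integer.Properties as ℤ
import Data.Integer.Solver as ℤ
open import Data.List using (List; []; _∷_; _++_; [_]; map; length; reverse; concatMap; cartesianProductWith; applyUpTo; zip; drop; take; replicate)
open import Data.List.Membership.Propositional using (_∈_; _∉_)
open import Data.List.Membership.Propositional.Properties using (∈-∃++; ∈-++⁺ʳ; ∈-map⁺; ∈-map⁻; ∈-upTo⁺; ∈-upTo⁻; ∈-cartesianProductWith⁺; ∈-cartesianProductWith⁻)
open import Data.List.Properties using (unfold-reverse; map-cong; map-∘; map-++; length-map; length-++; length-replicate; ++-assoc; ++-identityʳ; ∷-injectiveˡ; ∷-injectiveʳ)
open import Data.List.Relation.Binary.Pointwise using (Pointwise; []; _∷_)
open import Data.List.Relation.Unary.All as All using (All; []; _∷_)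
import Data.List.Relation.Unary.All.Properties as All
open import Data.List.Relation.Unary.AllPairs using ([]; _∷_)
open import Data.List.Relation.Unary.Any using (here; there)
open import Data.List.Relation.Unary.Unique.Propositional using (Unique)
import Data.List.Relation.Unary.Unique.Propositional.Properties as Unique
open import Data.Maybe using (Maybe; just; nothing; _<∣>_; is-just; maybe)
open import Data.Maybe.Properties using (just-injective)
open import Data.Nat using (ℕ; zero; suc; pred; _+_; _*_; _∸_; _⊔_; _⊓_; _≤_; _<_; z≤n; s≤s; s≤s⁻¹; _≡ᵇ_; _<ᵇ_; _≤ᵇ_; _!)
open import Data.Nat.Combinatorics using (_C_; nCk+nC[k+1]≡[n+1]C[k+1]; nC1≡n)
open import Data.Nat.ListAction using (sum)
open import Data.Nat.ListAction.Properties using (sum-++)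
open import Data.Nat.Properties
open import Data.Nat.Solver using (module +-*-Solver)
open import Data.Product using (_×_; _,_; proj₁; proj₂; ∃; ∃₂)
open import Data.Rational using (fromℚᵘ; toℚᵘ) renaming (_+_ to _+ℚ_)
open import Data.Rational.Properties using (fromℚᵘ-cong; toℚᵘ-injective; toℚᵘ-homo-+; toℚᵘ-fromℚᵘ)
open import Data.Rational.Unnormalised using (mkℚᵘ; *≡*) renaming (_+_ to _+ᵘ_)
import Data.Rational.Unnormalised.Properties as ℚᵘ
open import Data.Sum using (_⊎_; inj₁; inj₂)
open import Function using (_∘_; id)
open import Relation.Binary using (tri<; tri≈; tri>)
open import Relation.Binary.PropositionalEquality using (_≡_; _≢_; ≢-sym; refl; sym; trans; cong; cong₂; subst; subst₂; module ≡-Reasoning)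
open import Relation.Nullary using (yes; no)

-- Queues

-- A queue on a cycle has no initial state. Its state has to reproduce itself after one turn, and
-- this determines it only if arrivals are strictly fewer than services. Every exchange of row sizes
-- is therefore made where the smaller row feeds the larger one, which dictates the order in which
-- rows are moved. A row moves towards the last one by Burke exchanges alone as long as no other
-- relevant departures run through the services involved. The departures of row i do run through the
-- services of row j, and there interchangeability takes over. The bully paths are compared with
-- queues through sets of used entries: which customer takes a service does not affect which
-- services are taken. The case i = j is not a specialisation of i < j: both conditions on the
-- letters then refer to one queue. The mean of g(i, i) exceeds i(n-i)/(n+i) by 2ni/((n+i)(n+i-1)),
-- and this excess is precisely the additional term for j = i + 1.

data Kind : Set where
  arr srv oth : Kind

next : Kind → ℕ → ℕ
next arr q = suc q
next srv q = pred q
next oth q = q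

positive : ℕ → Bool
positive zero    = false
positive (suc _) = true

serves : Kind → ℕ → Bool
serves srv q = positive q
serves arr q = false
serves oth q = false

final : ℕ → List Kind → ℕ
final q []      = q
final q (k ∷ K) = final (next k q) K

served : ℕ → List Kind → List Bool
served q []      = []
served q (k ∷ K) = serves k q ∷ served (next k q) K

arrivals services : List Kind → ℕ
arrivals []        = 0
arrivals (arr ∷ K) = suc (arrivals K)
arrivals (srv ∷ K) = arrivals K
arrivals (oth ∷ K) = arrivals K
services []        = 0
services (arr ∷ K) = services K
services (srv ∷ K) = suc (services K)
services (oth ∷ K) = services K

trues : List Bool → ℕ
trues []          = 0
trues (true ∷ B)  = suc (trues B)
trues (false ∷ B) = trues B

final-++ : ∀ q K K′ → final q (K ++ K′) ≡ final (final q K) K′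
final-++ q []      K′ = refl
final-++ q (k ∷ K) K′ = final-++ (next k q) K K′

private
  ⊔-absorb : ∀ a {b c} → b ≤ c → (a ⊔ b) ⊔ c ≡ a ⊔ c
  ⊔-absorb a {b} {c} b≤c = trans (⊔-assoc a b c) (cong (a ⊔_) (m≤n⇒m⊔n≡n b≤c))

-- If some service finds the queue started from `q` empty, then the queue started from 0 is empty
-- too, and the runs agree from there on. Otherwise no service is wasted, and the length is `q` plus
-- arrivals minus services.
lindley : ∀ q K → final q K ≡ final 0 K ⊔ ((q + arrivals K) ∸ services K)
excess≤final : ∀ K → arrivals K ∸ services K ≤ final 0 K

lindley q [] = sym (+-identityʳ q)
lindley q (arr ∷ K) = begin
  final (suc q) K                                     ≡⟨ lindley (suc q) K ⟩
  final 0 K ⊔ ((suc q + A) ∸ S)                       ≡⟨ sym (⊔-absorb (final 0 K) (∸-monoˡ-≤ S (s≤s (m≤n+m A q)))) ⟩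
  (final 0 K ⊔ ((1 + A) ∸ S)) ⊔ ((suc q + A) ∸ S)     ≡⟨ cong₂ _⊔_ (sym (lindley 1 K)) (cong (_∸ S) (sym (+-suc q A))) ⟩
  final 1 K ⊔ ((q + suc A) ∸ S)                       ∎
  where
  open ≡-Reasoning
  A = arrivals K
  S = services K
-- The service is wasted. Counting it makes the second argument of the maximum smaller, and the
-- excess bound for the rest of the word absorbs it.
lindley zero (srv ∷ K) = sym (m≥n⇒m⊔n≡m (≤-trans (∸-monoʳ-≤ (arrivals K) (n≤1+n (services K))) (excess≤final K)))
lindley (suc q) (srv ∷ K) = lindley q K
lindley q (oth ∷ K) = lindley q K

excess≤final K = subst (arrivals K ∸ services K ≤_) (sym (lindley 0 K)) (m≤n⊔m (final 0 K) _)

-- One turn from the empty queue already reaches a length that the next turn reproduces: the second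
-- argument in `lindley` cannot exceed the length at the start.
stationary : ∀ K → arrivals K ≤ services K → final (final 0 K) K ≡ final 0 K
stationary K A≤S = trans (lindley q K) (m≥n⇒m⊔n≡m
  (≤-trans (∸-monoʳ-≤ (q + arrivals K) A≤S) (≤-reflexive (m+n∸n≡m q (arrivals K)))))
  where q = final 0 K

-- With fewer arrivals than services a positive length cannot return to itself unless a service is
-- wasted, and then the start is forgotten.
stationary-unique : ∀ q K → arrivals K < services K → final q K ≡ q → q ≡ final 0 K
stationary-unique zero K A<S eq = sym eq
stationary-unique (suc q) K A<S eq with ⊔-sel (final 0 K) ((suc q + arrivals K) ∸ services K)
... | inj₁ p = trans (sym eq) (trans (lindley (suc q) K) p)
... | inj₂ p = ⊥-elim (<-irrefl refl (begin-strict
  suc q                                     ≡⟨ trans (sym eq) (trans (lindley (suc q) K) p) ⟩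
  (suc q + arrivals K) ∸ services K         ≤⟨ ∸-monoʳ-≤ (suc q + arrivals K) A<S ⟩
  (suc q + arrivals K) ∸ suc (arrivals K)   ≡⟨ m+n∸n≡m q (arrivals K) ⟩
  q                                         <⟨ n<1+n q ⟩
  suc q                                     ∎))
  where open ≤-Reasoning

served-count : ∀ q K → trues (served q K) + final q K ≡ q + arrivals K
served-count q []              = sym (+-identityʳ q)
served-count q (arr ∷ K)       = trans (served-count (suc q) K) (sym (+-suc q (arrivals K)))
served-count zero (srv ∷ K)    = served-count zero K
served-count (suc q) (srv ∷ K) = cong suc (served-count q K)
served-count q (oth ∷ K)       = served-count q K

served-count-stationary : ∀ q K → final q K ≡ q → trues (served q K) ≡ arrivals K
served-count-stationary q K eq = +-cancelʳ-≡ q _ _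
  (trans (cong (trues (served q K) +_) (sym eq)) (trans (served-count q K) (+-comm q (arrivals K))))

-- Time runs from right to left here, because the inverse of an exchange of rows is a queue in
-- reversed time.
finalʳ : ℕ → List Kind → ℕ
finalʳ q []      = q
finalʳ q (k ∷ K) = next k (finalʳ q K)

arrivals-++ : ∀ K K′ → arrivals (K ++ K′) ≡ arrivals K + arrivals K′
arrivals-++ []        K′ = refl
arrivals-++ (arr ∷ K) K′ = cong suc (arrivals-++ K K′)
arrivals-++ (srv ∷ K) K′ = arrivals-++ K K′
arrivals-++ (oth ∷ K) K′ = arrivals-++ K K′

services-++ : ∀ K K′ → services (K ++ K′) ≡ services K + services K′
services-++ []        K′ = refl
services-++ (arr ∷ K) K′ = services-++ K K′
services-++ (srv ∷ K) K′ = cong suc (services-++ K K′)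
services-++ (oth ∷ K) K′ = services-++ K K′

arrivals-∷ : ∀ k K → arrivals (k ∷ K) ≡ arrivals K + arrivals [ k ]
arrivals-∷ k K = trans (arrivals-++ [ k ] K) (+-comm (arrivals [ k ]) (arrivals K))

services-∷ : ∀ k K → services (k ∷ K) ≡ services K + services [ k ]
services-∷ k K = trans (services-++ [ k ] K) (+-comm (services [ k ]) (services K))

arrivals-reverse : ∀ K → arrivals (reverse K) ≡ arrivals K
arrivals-reverse [] = refl
arrivals-reverse (k ∷ K) = begin
  arrivals (reverse (k ∷ K))             ≡⟨ cong arrivals (unfold-reverse k K) ⟩
  arrivals (reverse K ++ [ k ])          ≡⟨ arrivals-++ (reverse K) [ k ] ⟩
  arrivals (reverse K) + arrivals [ k ]  ≡⟨ cong (_+ arrivals [ k ]) (arrivals-reverse K) ⟩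
  arrivals K + arrivals [ k ]            ≡⟨ sym (arrivals-∷ k K) ⟩
  arrivals (k ∷ K)                       ∎
  where open ≡-Reasoning

services-reverse : ∀ K → services (reverse K) ≡ services K
services-reverse [] = refl
services-reverse (k ∷ K) = begin
  services (reverse (k ∷ K))             ≡⟨ cong services (unfold-reverse k K) ⟩
  services (reverse K ++ [ k ])          ≡⟨ services-++ (reverse K) [ k ] ⟩
  services (reverse K) + services [ k ]  ≡⟨ cong (_+ services [ k ]) (services-reverse K) ⟩
  services K + services [ k ]            ≡⟨ sym (services-∷ k K) ⟩
  services (k ∷ K)                       ∎
  where open ≡-Reasoning

finalʳ-reverse : ∀ q K → finalʳ q K ≡ final q (reverse K)
finalʳ-reverse q [] = refl
finalʳ-reverse q (k ∷ K) = begin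
  next k (finalʳ q K)                ≡⟨ cong (next k) (finalʳ-reverse q K) ⟩
  final (final q (reverse K)) [ k ]  ≡⟨ sym (final-++ q (reverse K) [ k ]) ⟩
  final q (reverse K ++ [ k ])       ≡⟨ cong (final q) (sym (unfold-reverse k K)) ⟩
  final q (reverse (k ∷ K))          ∎
  where open ≡-Reasoning

stationaryʳ : ∀ K → arrivals K ≤ services K → finalʳ (finalʳ 0 K) K ≡ finalʳ 0 K
stationaryʳ K A≤S rewrite finalʳ-reverse (finalʳ 0 K) K | finalʳ-reverse 0 K =
  stationary (reverse K) (subst₂ _≤_ (sym (arrivals-reverse K)) (sym (services-reverse K)) A≤S)

stationaryʳ-unique : ∀ q K → arrivals K < services K → finalʳ q K ≡ q → q ≡ finalʳ 0 K
stationaryʳ-unique q K A<S eq = trans (stationary-unique q (reverse K)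
    (subst₂ _<_ (sym (arrivals-reverse K)) (sym (services-reverse K)) A<S)
    (trans (sym (finalʳ-reverse q K)) eq)) (sym (finalʳ-reverse 0 K))

-- Swapping two rows of a word

≡ᵇ-refl : ∀ n → (n ≡ᵇ n) ≡ true
≡ᵇ-refl zero    = refl
≡ᵇ-refl (suc n) = ≡ᵇ-refl n

≢⇒≡ᵇ-false : ∀ {m n} → m ≢ n → (m ≡ᵇ n) ≡ false
≢⇒≡ᵇ-false {m} {n} m≢n with m ≡ᵇ n in eq
... | false = refl
... | true  = ⊥-elim (m≢n (≡ᵇ⇒≡ m n (subst IsTrue (sym eq) _)))

≡ᵇ-true⇒≡ : ∀ m n → (m ≡ᵇ n) ≡ true → m ≡ n
≡ᵇ-true⇒≡ m n eq = ≡ᵇ⇒≡ m n (subst IsTrue (sym eq) _)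

kind : ℕ → ℕ → ℕ → Kind
kind a s c = if c ≡ᵇ a then arr else (if c ≡ᵇ s then srv else oth)

emit : ℕ → ℕ → ℕ → ℕ → ℕ
emit a s q c = if (c ≡ᵇ s) ∧ not (positive q) then a else c

-- Unserved services become arrivals.  This is the cyclic analogue of a crystal reflection: matched pairs are kept, so running
-- the queue backwards with the two letters exchanged undoes it.
relabel : ℕ → ℕ → ℕ → List ℕ → List ℕ
relabel a s q []      = []
relabel a s q (c ∷ w) = emit a s q c ∷ relabel a s (next (kind a s c) q) w

relabelʳ : ℕ → ℕ → ℕ → List ℕ → List ℕ
relabelʳ a s q []      = []
relabelʳ a s q (c ∷ w) = emit a s (finalʳ q (map (kind a s) w)) c ∷ relabelʳ a s q w

mask : ℕ → List ℕ → List Bool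
mask r = map (_≡ᵇ r)

data View (a s : ℕ) : ℕ → Set where
  isArr : View a s a
  isSrv : View a s s
  isOth : ∀ {c} → c ≢ a → c ≢ s → View a s c

view : ∀ a s c → View a s c
view a s c with c ≟ a | c ≟ s
... | yes refl | _        = isArr
... | no _     | yes refl = isSrv
... | no p     | no q     = isOth p q

-- In reversed time with the roles exchanged, an arrival becomes a served service, a served service
-- becomes an arrival, and an unserved service becomes a service that again meets an empty queue.
undo : ∀ {a s} → a ≢ s → ∀ q c →
  next (kind s a (emit a s q c)) (next (kind a s c) q) ≡ q × emit s a (next (kind a s c) q) (emit a s q c) ≡ c
undo {a} {s} a≢s q c with view a s c
undo {a} {s} a≢s q .a | isArr
  rewrite ≡ᵇ-refl a | ≢⇒≡ᵇ-false a≢s | ≡ᵇ-refl a | ≢⇒≡ᵇ-false a≢s = refl , refl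
undo {a} {s} a≢s zero .s | isSrv
  rewrite ≡ᵇ-refl s | ≢⇒≡ᵇ-false (≢-sym a≢s) | ≡ᵇ-refl a | ≢⇒≡ᵇ-false a≢s = refl , refl
undo {a} {s} a≢s (suc q) .s | isSrv
  rewrite ≡ᵇ-refl s | ≢⇒≡ᵇ-false (≢-sym a≢s) | ≡ᵇ-refl s = refl , refl
undo {a} {s} a≢s q c | isOth c≢a c≢s
  rewrite ≢⇒≡ᵇ-false c≢s | ≢⇒≡ᵇ-false c≢a | ≢⇒≡ᵇ-false c≢s = refl , refl

undo-left : ∀ {a s} → a ≢ s → ∀ q w →
  let q′ = final q (map (kind a s) w); w′ = relabel a s q w in
  finalʳ q′ (map (kind s a) w′) ≡ q × relabelʳ s a q′ w′ ≡ w
undo-left a≢s q [] = refl , refl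
undo-left {a} {s} a≢s q (c ∷ w) with undo-left a≢s (next (kind a s c) q) w | undo a≢s q c
... | ih₁ , ih₂ | u₁ , u₂ rewrite ih₁ = u₁ , cong₂ _∷_ u₂ ih₂

undo-right : ∀ {a s} → a ≢ s → ∀ q w →
  let q′ = finalʳ q (map (kind a s) w); w′ = relabelʳ a s q w in
  final q′ (map (kind s a) w′) ≡ q × relabel s a q′ w′ ≡ w
undo-right a≢s q [] = refl , refl
undo-right {a} {s} a≢s q (c ∷ w) with undo-right a≢s q w | undo a≢s (finalʳ q (map (kind a s) w)) c
... | ih₁ , ih₂ | u₁ , u₂ rewrite u₁ = ih₁ , cong₂ _∷_ u₂ ih₂

count-∷ : ∀ r c w → countOcc r (c ∷ w) ≡ (if c ≡ᵇ r then 1 else 0) + countOcc r w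
count-∷ r c w with c ≡ᵇ r
... | true  = refl
... | false = refl

count-mask : ∀ r w → countOcc r w ≡ trues (mask r w)
count-mask r [] = refl
count-mask r (c ∷ w) with c ≡ᵇ r
... | true  = cong suc (count-mask r w)
... | false = count-mask r w

arrivals-kind : ∀ {a s} → a ≢ s → ∀ w → arrivals (map (kind a s) w) ≡ countOcc a w
arrivals-kind a≢s [] = refl
arrivals-kind {a} {s} a≢s (c ∷ w) with c ≡ᵇ a | c ≡ᵇ s
... | true  | _     = cong suc (arrivals-kind a≢s w)
... | false | true  = arrivals-kind a≢s w
... | false | false = arrivals-kind a≢s w

services-kind : ∀ {a s} → a ≢ s → ∀ w → services (map (kind a s) w) ≡ countOcc s w
services-kind a≢s [] = refl
services-kind {a} {s} a≢s (c ∷ w) with c ≡ᵇ a in p | c ≡ᵇ s in q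
... | true  | true  = ⊥-elim (a≢s (trans (sym (≡ᵇ-true⇒≡ c a p)) (≡ᵇ-true⇒≡ c s q)))
... | true  | false = services-kind a≢s w
... | false | true  = cong suc (services-kind a≢s w)
... | false | false = services-kind a≢s w

mask-relabel : ∀ {a s} → a ≢ s → ∀ q w → mask s (relabel a s q w) ≡ served q (map (kind a s) w)
mask-relabel a≢s q [] = refl
mask-relabel {a} {s} a≢s q (c ∷ w) = cong₂ _∷_ (letter q) (mask-relabel a≢s _ w)
  where
  letter : ∀ q → (emit a s q c ≡ᵇ s) ≡ serves (kind a s c) q
  letter q with view a s c
  letter q       | isArr rewrite ≡ᵇ-refl a | ≢⇒≡ᵇ-false a≢s = ≢⇒≡ᵇ-false a≢s
  letter zero    | isSrv rewrite ≡ᵇ-refl s | ≢⇒≡ᵇ-false (≢-sym a≢s) = ≢⇒≡ᵇ-false a≢s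
  letter (suc q) | isSrv rewrite ≡ᵇ-refl s | ≢⇒≡ᵇ-false (≢-sym a≢s) = ≡ᵇ-refl s
  letter q       | isOth p r rewrite ≢⇒≡ᵇ-false p | ≢⇒≡ᵇ-false r = ≢⇒≡ᵇ-false r

count-emit : ∀ {a s} → a ≢ s → ∀ q c w w′ → countOcc a w + countOcc s w ≡ countOcc a w′ + countOcc s w′ →
  countOcc a (emit a s q c ∷ w) + countOcc s (emit a s q c ∷ w) ≡ countOcc a (c ∷ w′) + countOcc s (c ∷ w′)
count-emit {a} {s} a≢s q c w w′ eq with view a s c
count-emit {a} {s} a≢s q .a w w′ eq | isArr
  rewrite ≢⇒≡ᵇ-false a≢s | ≡ᵇ-refl a | ≢⇒≡ᵇ-false a≢s = cong suc eq
count-emit {a} {s} a≢s zero .s w w′ eq | isSrv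
  rewrite ≡ᵇ-refl s | ≡ᵇ-refl a | ≢⇒≡ᵇ-false (≢-sym a≢s) | ≢⇒≡ᵇ-false a≢s
  = trans (cong suc eq) (sym (+-suc (countOcc a w′) (countOcc s w′)))
count-emit {a} {s} a≢s (suc q) .s w w′ eq | isSrv
  rewrite ≡ᵇ-refl s | ≢⇒≡ᵇ-false (≢-sym a≢s) | ≡ᵇ-refl s
  = trans (+-suc (countOcc a w) (countOcc s w)) (trans (cong suc eq) (sym (+-suc (countOcc a w′) (countOcc s w′))))
count-emit {a} {s} a≢s q c w w′ eq | isOth p r
  rewrite ≢⇒≡ᵇ-false r | ≢⇒≡ᵇ-false p | ≢⇒≡ᵇ-false r = eq

count-emit-other : ∀ {a s r} → r ≢ a → r ≢ s → ∀ q c w w′ → countOcc r w ≡ countOcc r w′ →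
  countOcc r (emit a s q c ∷ w) ≡ countOcc r (c ∷ w′)
count-emit-other {a} {s} {r} r≢a r≢s q c w w′ eq
  rewrite count-∷ r (emit a s q c) w | count-∷ r c w′ with c ≡ᵇ s in p
... | false = cong ((if c ≡ᵇ r then 1 else 0) +_) eq
... | true rewrite ≡ᵇ-true⇒≡ c s p with q
...   | zero  rewrite ≢⇒≡ᵇ-false (≢-sym r≢a) | ≢⇒≡ᵇ-false (≢-sym r≢s) = eq
...   | suc _ rewrite ≢⇒≡ᵇ-false (≢-sym r≢s) = eq

count-relabel : ∀ {a s} → a ≢ s → ∀ q w →
  countOcc a (relabel a s q w) + countOcc s (relabel a s q w) ≡ countOcc a w + countOcc s w
count-relabel a≢s q [] = refl
count-relabel {a} {s} a≢s q (c ∷ w) = count-emit a≢s q c (relabel a s _ w) w (count-relabel a≢s _ w)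

count-relabel-other : ∀ {a s r} → r ≢ a → r ≢ s → ∀ q w → countOcc r (relabel a s q w) ≡ countOcc r w
count-relabel-other r≢a r≢s q [] = refl
count-relabel-other {a} {s} r≢a r≢s q (c ∷ w) = count-emit-other r≢a r≢s q c (relabel a s _ w) w (count-relabel-other r≢a r≢s _ w)

-- In a stationary turn as many customers leave as arrive, and after relabelling the letter `s`
-- marks the services that were used.
count-relabel-srv : ∀ {a s} → a ≢ s → ∀ q w → final q (map (kind a s) w) ≡ q →
  countOcc s (relabel a s q w) ≡ countOcc a w
count-relabel-srv {a} {s} a≢s q w eq = begin
  countOcc s (relabel a s q w)          ≡⟨ count-mask s (relabel a s q w) ⟩
  trues (mask s (relabel a s q w))      ≡⟨ cong trues (mask-relabel a≢s q w) ⟩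
  trues (served q (map (kind a s) w))   ≡⟨ served-count-stationary q (map (kind a s) w) eq ⟩
  arrivals (map (kind a s) w)           ≡⟨ arrivals-kind a≢s w ⟩
  countOcc a w                          ∎
  where open ≡-Reasoning

count-relabel-arr : ∀ {a s} → a ≢ s → ∀ q w → final q (map (kind a s) w) ≡ q →
  countOcc a (relabel a s q w) ≡ countOcc s w
count-relabel-arr {a} {s} a≢s q w eq = +-cancelʳ-≡ (countOcc a w) _ _
  (trans (cong (countOcc a (relabel a s q w) +_) (sym (count-relabel-srv a≢s q w eq)))
  (trans (count-relabel a≢s q w) (+-comm (countOcc a w) (countOcc s w))))

k≢1+k : ∀ {k} → k ≢ suc k
k≢1+k {k} ()

kinds : ℕ → List ℕ → List Kind
kinds k = map (kind k (suc k))

-- The start `final 0` is the stationary length, so this is the exchange on the cycle although the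
-- word is linear.
swap : ℕ → List ℕ → List ℕ
swap k w = relabel k (suc k) (final 0 (kinds k w)) w

swapʳ : ℕ → List ℕ → List ℕ
swapʳ k w = relabelʳ (suc k) k (finalʳ 0 (map (kind (suc k) k) w)) w

record Word (n L : ℕ) (c : ℕ → ℕ) (w : List ℕ) : Set where
  constructor word
  field
    len     : length w ≡ L
    letters : All (λ x → 1 ≤ x × x ≤ n) w
    content : ∀ r → 1 ≤ r → r ≤ n → countOcc r w ≡ c r
open Word

transpose : ℕ → (ℕ → ℕ) → ℕ → ℕ
transpose k c r = if r ≡ᵇ k then c (suc k) else (if r ≡ᵇ suc k then c k else c r)

transpose-low : ∀ k c → transpose k c k ≡ c (suc k)
transpose-low k c rewrite ≡ᵇ-refl k = refl

transpose-high : ∀ k c → transpose k c (suc k) ≡ c k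
transpose-high k c rewrite ≢⇒≡ᵇ-false (≢-sym (k≢1+k {k})) | ≡ᵇ-refl k = refl

transpose-other : ∀ k c r → r ≢ k → r ≢ suc k → transpose k c r ≡ c r
transpose-other k c r p q rewrite ≢⇒≡ᵇ-false p | ≢⇒≡ᵇ-false q = refl

length-relabel : ∀ a s q w → length (relabel a s q w) ≡ length w
length-relabel a s q []      = refl
length-relabel a s q (c ∷ w) = cong suc (length-relabel a s _ w)

length-relabelʳ : ∀ a s q w → length (relabelʳ a s q w) ≡ length w
length-relabelʳ a s q []      = refl
length-relabelʳ a s q (c ∷ w) = cong suc (length-relabelʳ a s q w)

emit-preserves : ∀ (P : ℕ → Set) {a s} q c → P a → P c → P (emit a s q c)
emit-preserves P {a} {s} q c Pa Pc with (c ≡ᵇ s) ∧ not (positive q)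
... | true  = Pa
... | false = Pc

relabel-preserves : ∀ {P : ℕ → Set} {a s} q {w} → P a → All P w → All P (relabel a s q w)
relabel-preserves q Pa []            = []
relabel-preserves {P} {a} {s} q Pa (_∷_ {c} p ps) = emit-preserves P q c Pa p ∷ relabel-preserves _ Pa ps

relabelʳ-preserves : ∀ {P : ℕ → Set} {a s} q {w} → P a → All P w → All P (relabelʳ a s q w)
relabelʳ-preserves q Pa []            = []
relabelʳ-preserves {P} {a} {s} q Pa (_∷_ {c} p ps) = emit-preserves P _ c Pa p ∷ relabelʳ-preserves q Pa ps

swap-stationary : ∀ {k} w → countOcc k w < countOcc (suc k) w →
  final (final 0 (kinds k w)) (kinds k w) ≡ final 0 (kinds k w)
swap-stationary {k} w lt = stationary (kinds k w)
  (subst₂ _≤_ (sym (arrivals-kind k≢1+k w)) (sym (services-kind k≢1+k w)) (<⇒≤ lt))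

swap-unique : ∀ {k} w q → countOcc k w < countOcc (suc k) w → final q (kinds k w) ≡ q → q ≡ final 0 (kinds k w)
swap-unique {k} w q lt = stationary-unique q (kinds k w)
  (subst₂ _<_ (sym (arrivals-kind k≢1+k w)) (sym (services-kind k≢1+k w)) lt)

module _ {n L k : ℕ} {c : ℕ → ℕ} (1≤k : 1 ≤ k) (k<n : k < n) (lt : c k < c (suc k)) where

  private
    1≤1+k : 1 ≤ suc k
    1≤1+k = s≤s z≤n
    k≤n : k ≤ n
    k≤n = <⇒≤ k<n

  word-lt : ∀ {w} → Word n L c w → countOcc k w < countOcc (suc k) w
  word-lt W = subst₂ _<_ (sym (content W k 1≤k k≤n)) (sym (content W (suc k) 1≤1+k k<n)) lt

  swap-word : ∀ {w} → Word n L c w → Word n L (transpose k c) (swap k w)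
  swap-word {w} W = word (trans (length-relabel k (suc k) _ w) (len W))
    (relabel-preserves _ (1≤k , k≤n) (letters W)) cont
    where
    cont : ∀ r → 1 ≤ r → r ≤ n → countOcc r (swap k w) ≡ transpose k c r
    cont r 1≤r r≤n with view k (suc k) r
    ... | isArr = trans (count-relabel-arr k≢1+k _ w (swap-stationary w (word-lt W)))
                    (trans (content W (suc k) 1≤1+k k<n) (sym (transpose-low k c)))
    ... | isSrv = trans (count-relabel-srv k≢1+k _ w (swap-stationary w (word-lt W)))
                    (trans (content W k 1≤k k≤n) (sym (transpose-high k c)))
    ... | isOth p p′ = trans (count-relabel-other p p′ _ w) (trans (content W r 1≤r r≤n) (sym (transpose-other k c r p p′)))

  -- `undo-left` needs the reversed queue to start from the length at which the forward run ended.
  -- By stationarity this is `q`; the arrivals of the reversed queue are again the rarer letter, so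
  -- uniqueness identifies `q` with the length that `swapʳ` computes.
  swapʳ-swap : ∀ {w} → Word n L c w → swapʳ k (swap k w) ≡ w
  swapʳ-swap {w} W = trans (cong (λ q′ → relabelʳ (suc k) k q′ (swap k w)) (sym q≡)) (proj₂ (undo-left′))
    where
    q = final 0 (kinds k w)
    st = swap-stationary w (word-lt W)
    undo-left′ : finalʳ q (map (kind (suc k) k) (swap k w)) ≡ q × relabelʳ (suc k) k q (swap k w) ≡ w
    undo-left′ = subst (λ q′ → finalʳ q′ (map (kind (suc k) k) (swap k w)) ≡ q × relabelʳ (suc k) k q′ (swap k w) ≡ w)
      st (undo-left k≢1+k q w)
    lt′ : arrivals (map (kind (suc k) k) (swap k w)) < services (map (kind (suc k) k) (swap k w))
    lt′ = subst₂ _<_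
      (sym (trans (arrivals-kind (≢-sym k≢1+k) (swap k w)) (count-relabel-srv k≢1+k q w st)))
      (sym (trans (services-kind (≢-sym k≢1+k) (swap k w)) (count-relabel-arr k≢1+k q w st))) (word-lt W)
    q≡ : q ≡ finalʳ 0 (map (kind (suc k) k) (swap k w))
    q≡ = stationaryʳ-unique q (map (kind (suc k) k) (swap k w)) lt′ (proj₁ undo-left′)

  module _ {w′} (W′ : Word n L (transpose k c) w′) where
    private
      K′ = map (kind (suc k) k) w′
      q = finalʳ 0 K′
      w = swapʳ k w′
      lt″ : arrivals K′ < services K′
      lt″ = subst₂ _<_
        (sym (trans (arrivals-kind (≢-sym k≢1+k) w′) (trans (content W′ (suc k) 1≤1+k k<n) (transpose-high k c))))
        (sym (trans (services-kind (≢-sym k≢1+k) w′) (trans (content W′ k 1≤k k≤n) (transpose-low k c)))) lt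
      st : finalʳ q K′ ≡ q
      st = stationaryʳ K′ (<⇒≤ lt″)
      undo-right′ : final q (kinds k w) ≡ q × relabel k (suc k) q w ≡ w′
      undo-right′ = subst (λ q′ → final q′ (kinds k w) ≡ q × relabel k (suc k) q′ w ≡ w′)
        st (undo-right (≢-sym k≢1+k) q w′)
      countˡ : countOcc k w ≡ c k
      countˡ = trans (sym (count-relabel-srv k≢1+k q w (proj₁ undo-right′)))
        (trans (cong (countOcc (suc k)) (proj₂ undo-right′)) (trans (content W′ (suc k) 1≤1+k k<n) (transpose-high k c)))
      countʰ : countOcc (suc k) w ≡ c (suc k)
      countʰ = trans (sym (count-relabel-arr k≢1+k q w (proj₁ undo-right′)))
        (trans (cong (countOcc k) (proj₂ undo-right′)) (trans (content W′ k 1≤k k≤n) (transpose-low k c)))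

    swapʳ-word : Word n L c (swapʳ k w′)
    swapʳ-word = word (trans (length-relabelʳ (suc k) k q w′) (len W′))
      (relabelʳ-preserves q (1≤1+k , k<n) (letters W′)) cont
      where
      cont : ∀ r → 1 ≤ r → r ≤ n → countOcc r w ≡ c r
      cont r 1≤r r≤n with view k (suc k) r
      ... | isArr = countˡ
      ... | isSrv = countʰ
      ... | isOth p p′ = trans (sym (count-relabel-other p p′ q w))
          (trans (cong (countOcc r) (proj₂ undo-right′)) (trans (content W′ r 1≤r r≤n) (transpose-other k c r p p′)))

    swap-swapʳ : swap k (swapʳ k w′) ≡ w′
    swap-swapʳ = trans (cong (λ q′ → relabel k (suc k) q′ w)
      (sym (swap-unique w q (subst₂ _<_ (sym countˡ) (sym countʰ) lt) (proj₁ undo-right′)))) (proj₂ undo-right′)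

-- Queues among the rows from `j` on cannot distinguish smaller letters, so exchanges of smaller
-- rows are invisible to them. This relation expresses that.
Agree : ℕ → List ℕ → List ℕ → Set
Agree j = Pointwise (λ a b → a ≡ b ⊎ (a < j × b < j))

agree-refl : ∀ {j} w → Agree j w w
agree-refl []      = []
agree-refl (c ∷ w) = inj₁ refl ∷ agree-refl w

agree-trans : ∀ {j u v w} → Agree j u v → Agree j v w → Agree j u w
agree-trans [] [] = []
agree-trans (p ∷ ps) (q ∷ qs) = glue p q ∷ agree-trans ps qs
  where
  glue : ∀ {j a b c} → a ≡ b ⊎ (a < j × b < j) → b ≡ c ⊎ (b < j × c < j) → a ≡ c ⊎ (a < j × c < j)
  glue (inj₁ refl)    r              = r
  glue (inj₂ r)       (inj₁ refl)    = inj₂ r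
  glue (inj₂ (p , _)) (inj₂ (_ , q)) = inj₂ (p , q)

agree-sym : ∀ {j u v} → Agree j u v → Agree j v u
agree-sym [] = []
agree-sym (inj₁ p ∷ ps) = inj₁ (sym p) ∷ agree-sym ps
agree-sym (inj₂ (p , q) ∷ ps) = inj₂ (q , p) ∷ agree-sym ps

agree-mask : ∀ {j n u v} → j ≤ n → Agree j u v → mask n u ≡ mask n v
agree-mask j≤n [] = refl
agree-mask {n = n} j≤n (inj₁ refl ∷ ps) = cong (_ ∷_) (agree-mask j≤n ps)
agree-mask {n = n} j≤n (inj₂ (p , q) ∷ ps) = cong₂ _∷_
  (trans (≢⇒≡ᵇ-false (<⇒≢ (<-≤-trans p j≤n))) (sym (≢⇒≡ᵇ-false (<⇒≢ (<-≤-trans q j≤n))))) (agree-mask j≤n ps)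

agree-kinds : ∀ {j k u v} → j ≤ k → Agree j u v → kinds k u ≡ kinds k v
agree-kinds j≤k [] = refl
agree-kinds j≤k (inj₁ refl ∷ ps) = cong (_ ∷_) (agree-kinds j≤k ps)
agree-kinds {j} {k} j≤k (inj₂ (p , q) ∷ ps) = cong₂ _∷_ (trans (other p) (sym (other q))) (agree-kinds j≤k ps)
  where
  other : ∀ {x} → x < j → kind k (suc k) x ≡ oth
  other x<j rewrite ≢⇒≡ᵇ-false (<⇒≢ (<-≤-trans x<j j≤k)) | ≢⇒≡ᵇ-false (<⇒≢ (<-≤-trans x<j (m≤n⇒m≤1+n j≤k))) = refl

agree-relabel : ∀ {j k u v} q → j ≤ k → Agree j u v → Agree j (relabel k (suc k) q u) (relabel k (suc k) q v)
agree-relabel q j≤k [] = []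
agree-relabel {j} {k} q j≤k (inj₁ refl ∷ ps) = inj₁ refl ∷ agree-relabel _ j≤k ps
agree-relabel {j} {k} q j≤k (inj₂ (p , p′) ∷ ps)
  rewrite ≢⇒≡ᵇ-false (<⇒≢ (<-≤-trans p j≤k)) | ≢⇒≡ᵇ-false (<⇒≢ (<-≤-trans p (m≤n⇒m≤1+n j≤k)))
        | ≢⇒≡ᵇ-false (<⇒≢ (<-≤-trans p′ j≤k)) | ≢⇒≡ᵇ-false (<⇒≢ (<-≤-trans p′ (m≤n⇒m≤1+n j≤k)))
  = inj₂ (p , p′) ∷ agree-relabel q j≤k ps

agree-swap : ∀ {j k u v} → j ≤ k → Agree j u v → Agree j (swap k u) (swap k v)
agree-swap {j} {k} {u} {v} j≤k ps rewrite agree-kinds j≤k ps = agree-relabel _ j≤k ps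

relabel-agree : ∀ {j k} q w → suc k < j → Agree j w (relabel k (suc k) q w)
relabel-agree q [] lt = []
relabel-agree {j} {k} q (c ∷ w) lt = letter ∷ relabel-agree _ w lt
  where
  letter : c ≡ emit k (suc k) q c ⊎ (c < j × emit k (suc k) q c < j)
  letter with c ≡ᵇ suc k in eq
  ... | false = inj₁ refl
  ... | true with positive q
  ...   | true  = inj₁ refl
  ...   | false = inj₂ (subst (_< j) (sym (≡ᵇ-true⇒≡ c (suc k) eq)) lt , <-trans (n<1+n k) lt)

-- descend d k performs the queues k → k+1 → ... → k+d, after which the letter k+d marks the departures of the last one.
descend : ℕ → ℕ → List ℕ → List ℕ
descend zero    k w = w
descend (suc d) k w = descend d (suc k) (swap k w)

agree-descend : ∀ {j} d k {u v} → j ≤ k → Agree j u v → Agree j (descend d k u) (descend d k v)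
agree-descend zero    k j≤k ps = ps
agree-descend (suc d) k j≤k ps = agree-descend d (suc k) (m≤n⇒m≤1+n j≤k) (agree-swap j≤k ps)

-- Interchangeability of queues

data Letter : Set where
  X Y Z O : Letter

kindXY kindYZ : Letter → Kind
kindXY X = arr
kindXY Y = srv
kindXY Z = oth
kindXY O = oth
kindYZ X = oth
kindYZ Y = arr
kindYZ Z = srv
kindYZ O = oth

emitXY emitYZ : ℕ → Letter → Letter
emitXY q       X = X
emitXY zero    Y = X
emitXY (suc q) Y = Y
emitXY q       Z = Z
emitXY q       O = O
emitYZ q       X = X
emitYZ q       Y = Y
emitYZ zero    Z = Y
emitYZ (suc q) Z = Z
emitYZ q       O = O

relabelXY relabelYZ : ℕ → List Letter → List Letter
relabelXY q []      = []
relabelXY q (x ∷ w) = emitXY q x ∷ relabelXY (next (kindXY x) q) w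
relabelYZ q []      = []
relabelYZ q (x ∷ w) = emitYZ q x ∷ relabelYZ (next (kindYZ x) q) w

isZ : Letter → Bool
isZ X = false
isZ Y = false
isZ Z = true
isZ O = false

-- Interchangeability of queues: the invariant is q₁ + q₂ = p₁ + p₂ and q₂ = p₂ ⊓ r.
interchange : ∀ w {q₁ q₂} r p₁ p₂ → q₁ ≡ p₁ + (p₂ ∸ r) → q₂ ≡ p₂ ⊓ r →
  let w₁ = relabelXY q₁ w
      u  = relabelYZ r w
      u₁ = relabelXY p₁ u
      r′  = final r (map kindYZ w)
      p₁′ = final p₁ (map kindXY u)
      p₂′ = final p₂ (map kindYZ u₁)
  in map isZ (relabelYZ q₂ w₁) ≡ map isZ (relabelYZ p₂ u₁)
     × final q₁ (map kindXY w) ≡ p₁′ + (p₂′ ∸ r′)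
     × final q₂ (map kindYZ w₁) ≡ p₂′ ⊓ r′
interchange [] r p₁ p₂ e₁ e₂ = refl , e₁ , e₂
interchange (X ∷ w) r p₁ p₂ e₁ e₂ with interchange w r (suc p₁) p₂ (cong suc e₁) e₂
... | m , f = cong (_ ∷_) m , f
interchange (Y ∷ w) {suc q₁} r (suc p₁) p₂ e₁ e₂ with interchange w (suc r) p₁ (suc p₂) (cong pred e₁) (cong suc e₂)
... | m , f = cong (_ ∷_) m , f
interchange (Y ∷ w) {zero} r zero p₂ e₁ e₂ with m∸n≡0⇒m≤n {p₂} {r} (sym e₁)
... | p₂≤r with interchange w (suc r) 0 p₂ (sym (m≤n⇒m∸n≡0 (m≤n⇒m≤1+n p₂≤r)))
           (trans e₂ (trans (m≤n⇒m⊓n≡m p₂≤r) (sym (m≤n⇒m⊓n≡m (m≤n⇒m≤1+n p₂≤r)))))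
...   | m , f = cong (_ ∷_) m , f
-- Here `p₁` is 0 while `q₁` is not, so the surplus `p₂ ∸ r` is positive. The service moves a
-- customer in one order and is wasted in the other, but there it raises `r`, which restores the
-- invariant.
interchange (Y ∷ w) {suc q₁} r zero p₂ e₁ e₂ with m<n+m∸n e₁
  where
  m<n+m∸n : ∀ {a b c} → suc a ≡ b ∸ c → c < b
  m<n+m∸n {a} {b} {c} eq = m∸n≢0⇒n<m (λ z → 1+n≢0 (trans eq z))
... | r<p₂ with interchange w (suc r) 0 p₂ (trans (cong pred e₁) (pred[m∸n]≡m∸[1+n] p₂ r))
           (trans (cong suc (trans e₂ (m≥n⇒m⊓n≡n (<⇒≤ r<p₂)))) (sym (m≥n⇒m⊓n≡n r<p₂)))
...   | m , f = cong (_ ∷_) m , f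
interchange (Z ∷ w) {q₁} {q₂} zero p₁ p₂ e₁ e₂ with trans e₂ (⊓-zeroʳ p₂)
interchange (Z ∷ w) {q₁} {.0} zero zero p₂ e₁ e₂ | refl with interchange w 0 0 p₂ e₁ e₂
... | m , f = cong (_ ∷_) m , f
-- With `r` zero this Z is relabelled Y in the other order and moves a customer from `p₁` to `p₂`,
-- so that `q₁`, which is their sum, does not change.
interchange (Z ∷ w) {q₁} {.0} zero (suc p₁) p₂ e₁ e₂ | refl
  with interchange w 0 p₁ (suc p₂) (trans e₁ (sym (+-suc p₁ p₂))) refl
... | m , f = cong (_ ∷_) m , f
interchange (Z ∷ w) {q₁} (suc r) p₁ zero e₁ refl
  with interchange w r p₁ 0 (trans e₁ (cong (p₁ +_) (sym (0∸n≡0 r)))) refl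
... | m , f = cong (_ ∷_) m , f
interchange (Z ∷ w) (suc r) p₁ (suc p₂) e₁ refl with interchange w r p₁ p₂ e₁ refl
... | m , f = cong (_ ∷_) m , f
interchange (O ∷ w) r p₁ p₂ e₁ e₂ with interchange w r p₁ p₂ e₁ e₂
... | m , f = cong (_ ∷_) m , f

letter : ℕ → ℕ → Letter
letter k x = if x ≡ᵇ k then X else (if x ≡ᵇ suc k then Y else (if x ≡ᵇ suc (suc k) then Z else O))

data View₃ (k : ℕ) : ℕ → Set where
  theX : View₃ k k
  theY : View₃ k (suc k)
  theZ : View₃ k (suc (suc k))
  theO : ∀ {x} → x ≢ k → x ≢ suc k → x ≢ suc (suc k) → View₃ k x

view₃ : ∀ k x → View₃ k x
view₃ k x with x ≟ k | x ≟ suc k | x ≟ suc (suc k)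
... | yes refl | _        | _        = theX
... | no _     | yes refl | _        = theY
... | no _     | no _     | yes refl = theZ
... | no p     | no q     | no r     = theO p q r

letter-X : ∀ k → letter k k ≡ X
letter-X k rewrite ≡ᵇ-refl k = refl

letter-Y : ∀ k → letter k (suc k) ≡ Y
letter-Y k rewrite ≢⇒≡ᵇ-false (1+n≢n {k}) | ≡ᵇ-refl k = refl

2+k≢k : ∀ {k} → suc (suc k) ≢ k
2+k≢k {k} ()

letter-Z : ∀ k → letter k (suc (suc k)) ≡ Z
letter-Z k rewrite ≢⇒≡ᵇ-false (2+k≢k {k}) | ≢⇒≡ᵇ-false (1+n≢n {k}) | ≡ᵇ-refl k = refl

letter-O : ∀ {k x} → x ≢ k → x ≢ suc k → x ≢ suc (suc k) → letter k x ≡ O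
letter-O p q r rewrite ≢⇒≡ᵇ-false p | ≢⇒≡ᵇ-false q | ≢⇒≡ᵇ-false r = refl

kind-arr : ∀ a s → kind a s a ≡ arr
kind-arr a s rewrite ≡ᵇ-refl a = refl

kind-srv : ∀ {a s} → a ≢ s → kind a s s ≡ srv
kind-srv {a} {s} a≢s rewrite ≢⇒≡ᵇ-false (≢-sym a≢s) | ≡ᵇ-refl s = refl

kind-oth : ∀ {a s x} → x ≢ a → x ≢ s → kind a s x ≡ oth
kind-oth p q rewrite ≢⇒≡ᵇ-false p | ≢⇒≡ᵇ-false q = refl

emit-srv : ∀ a s q → emit a s q s ≡ (if positive q then s else a)
emit-srv a s zero    rewrite ≡ᵇ-refl s = refl
emit-srv a s (suc q) rewrite ≡ᵇ-refl s = refl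

emit-oth : ∀ {a s x} q → x ≢ s → emit a s q x ≡ x
emit-oth q p rewrite ≢⇒≡ᵇ-false p = refl

kind-XY : ∀ k x → kind k (suc k) x ≡ kindXY (letter k x)
kind-XY k x with view₃ k x
... | theX = trans (kind-arr k (suc k)) (sym (cong kindXY (letter-X k)))
... | theY = trans (kind-srv {k} {suc k} k≢1+k) (sym (cong kindXY (letter-Y k)))
... | theZ = trans (kind-oth {k} {suc k} 2+k≢k 1+n≢n) (sym (cong kindXY (letter-Z k)))
... | theO p q r = trans (kind-oth p q) (sym (cong kindXY (letter-O p q r)))

kind-YZ : ∀ k x → kind (suc k) (suc (suc k)) x ≡ kindYZ (letter k x)
kind-YZ k x with view₃ k x
... | theX = trans (kind-oth {suc k} {suc (suc k)} k≢1+k (≢-sym 2+k≢k)) (sym (cong kindYZ (letter-X k)))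
... | theY = trans (kind-arr (suc k) (suc (suc k))) (sym (cong kindYZ (letter-Y k)))
... | theZ = trans (kind-srv {suc k} {suc (suc k)} k≢1+k) (sym (cong kindYZ (letter-Z k)))
... | theO p q r = trans (kind-oth q r) (sym (cong kindYZ (letter-O p q r)))

letter-emitXY : ∀ k q x → letter k (emit k (suc k) q x) ≡ emitXY q (letter k x)
letter-emitXY k q x with view₃ k x
letter-emitXY k q .k | theX = trans (cong (letter k) (emit-oth {k} {suc k} q k≢1+k)) (trans (letter-X k) (sym (cong (emitXY q) (letter-X k))))
letter-emitXY k zero .(suc k) | theY = trans (cong (letter k) (emit-srv k (suc k) 0)) (trans (letter-X k) (sym (cong (emitXY 0) (letter-Y k))))
letter-emitXY k (suc q) .(suc k) | theY = trans (cong (letter k) (emit-srv k (suc k) (suc q))) (trans (letter-Y k) (sym (cong (emitXY (suc q)) (letter-Y k))))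
letter-emitXY k q .(suc (suc k)) | theZ = trans (cong (letter k) (emit-oth {k} {suc k} q 1+n≢n)) (trans (letter-Z k) (sym (cong (emitXY q) (letter-Z k))))
letter-emitXY k q x | theO p p′ r = trans (cong (letter k) (emit-oth q p′)) (trans (letter-O p p′ r) (sym (cong (emitXY q) (letter-O p p′ r))))

letter-emitYZ : ∀ k q x → letter k (emit (suc k) (suc (suc k)) q x) ≡ emitYZ q (letter k x)
letter-emitYZ k q x with view₃ k x
letter-emitYZ k q .k | theX = trans (cong (letter k) (emit-oth {suc k} {suc (suc k)} q (≢-sym 2+k≢k))) (trans (letter-X k) (sym (cong (emitYZ q) (letter-X k))))
letter-emitYZ k q .(suc k) | theY = trans (cong (letter k) (emit-oth {suc k} {suc (suc k)} q k≢1+k)) (trans (letter-Y k) (sym (cong (emitYZ q) (letter-Y k))))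
letter-emitYZ k zero .(suc (suc k)) | theZ = trans (cong (letter k) (emit-srv (suc k) (suc (suc k)) 0)) (trans (letter-Y k) (sym (cong (emitYZ 0) (letter-Z k))))
letter-emitYZ k (suc q) .(suc (suc k)) | theZ = trans (cong (letter k) (emit-srv (suc k) (suc (suc k)) (suc q))) (trans (letter-Z k) (sym (cong (emitYZ (suc q)) (letter-Z k))))
letter-emitYZ k q x | theO p p′ r = trans (cong (letter k) (emit-oth q r)) (trans (letter-O p p′ r) (sym (cong (emitYZ q) (letter-O p p′ r))))

kinds-XY : ∀ k w → kinds k w ≡ map kindXY (map (letter k) w)
kinds-XY k w = trans (map-cong (kind-XY k) w) (map-∘ w)

kinds-YZ : ∀ k w → kinds (suc k) w ≡ map kindYZ (map (letter k) w)
kinds-YZ k w = trans (map-cong (kind-YZ k) w) (map-∘ w)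

letters-relabelXY : ∀ k q w → map (letter k) (relabel k (suc k) q w) ≡ relabelXY q (map (letter k) w)
letters-relabelXY k q []      = refl
letters-relabelXY k q (x ∷ w) = cong₂ _∷_ (letter-emitXY k q x)
  (trans (letters-relabelXY k _ w) (cong (λ κ → relabelXY (next κ q) (map (letter k) w)) (kind-XY k x)))

letters-relabelYZ : ∀ k q w → map (letter k) (relabel (suc k) (suc (suc k)) q w) ≡ relabelYZ q (map (letter k) w)
letters-relabelYZ k q []      = refl
letters-relabelYZ k q (x ∷ w) = cong₂ _∷_ (letter-emitYZ k q x)
  (trans (letters-relabelYZ k _ w) (cong (λ κ → relabelYZ (next κ q) (map (letter k) w)) (kind-YZ k x)))

isZ-letter : ∀ k x → isZ (letter k x) ≡ (x ≡ᵇ suc (suc k))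
isZ-letter k x with view₃ k x
... | theX = trans (cong isZ (letter-X k)) (sym (≢⇒≡ᵇ-false (≢-sym (2+k≢k {k}))))
... | theY = trans (cong isZ (letter-Y k)) (sym (≢⇒≡ᵇ-false (k≢1+k {k})))
... | theZ = trans (cong isZ (letter-Z k)) (sym (≡ᵇ-refl k))
... | theO p q r = trans (cong isZ (letter-O p q r)) (sym (≢⇒≡ᵇ-false r))

mask-letter : ∀ k w → mask (suc (suc k)) w ≡ map isZ (map (letter k) w)
mask-letter k w = sym (trans (sym (map-∘ w)) (map-cong (isZ-letter k) w))

-- The only letter that the coarser relation fails to separate from smaller ones is `j` itself, and
-- the mask gives its positions.
agree-from-mask : ∀ {j u v} → Agree (suc j) u v → mask j u ≡ mask j v → Agree j u v
agree-from-mask [] eq = []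
agree-from-mask (inj₁ p ∷ ps) eq = inj₁ p ∷ agree-from-mask ps (∷-injectiveʳ eq)
agree-from-mask {j} {x ∷ _} {y ∷ _} (inj₂ (p , q) ∷ ps) eq = sharpen ∷ agree-from-mask ps (∷-injectiveʳ eq)
  where
  sharpen : x ≡ y ⊎ (x < j × y < j)
  sharpen with x ≟ j | y ≟ j
  ... | yes refl | yes refl = inj₁ refl
  ... | no x≢j   | no y≢j   = inj₂ (≤∧≢⇒< (s≤s⁻¹ p) x≢j , ≤∧≢⇒< (s≤s⁻¹ q) y≢j)
  ... | yes refl | no y≢j   = ⊥-elim (true≢false (trans (sym (≡ᵇ-refl x)) (trans (∷-injectiveˡ eq) (≢⇒≡ᵇ-false y≢j))))
    where
    true≢false : true ≢ false
    true≢false ()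
  ... | no x≢j   | yes refl = ⊥-elim (true≢false (trans (sym (≡ᵇ-refl y)) (trans (sym (∷-injectiveˡ eq)) (≢⇒≡ᵇ-false x≢j))))
    where
    true≢false : true ≢ false
    true≢false ()

module _ {k : ℕ} (w : List ℕ)
  (X<Y : countOcc k w < countOcc (suc k) w)
  (Y<Z : countOcc (suc k) w < countOcc (suc (suc k)) w) where

  private
    w₁ = swap k w
    u  = swap (suc k) w
    u₁ = swap k u
    r  = final 0 (kinds (suc k) w)
    p₁ = final 0 (kinds k u)
    p₂ = final 0 (kinds (suc k) u₁)
    q₁ = p₁ + (p₂ ∸ r)
    q₂ = p₂ ⊓ r
    X<Z = <-trans X<Y Y<Z

    r-stat : final r (kinds (suc k) w) ≡ r
    r-stat = swap-stationary w Y<Z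

    u-X : countOcc k u ≡ countOcc k w
    u-X = count-relabel-other k≢1+k (≢-sym 2+k≢k) r w
    u-Y : countOcc (suc k) u ≡ countOcc (suc (suc k)) w
    u-Y = count-relabel-arr k≢1+k r w r-stat
    u-Z : countOcc (suc (suc k)) u ≡ countOcc (suc k) w
    u-Z = count-relabel-srv k≢1+k r w r-stat

    u-lt : countOcc k u < countOcc (suc k) u
    u-lt = subst₂ _<_ (sym u-X) (sym u-Y) X<Z
    p₁-stat : final p₁ (kinds k u) ≡ p₁
    p₁-stat = swap-stationary u u-lt

    u₁-lt : countOcc (suc k) u₁ < countOcc (suc (suc k)) u₁
    u₁-lt = subst₂ _<_ (sym (trans (count-relabel-srv k≢1+k p₁ u p₁-stat) u-X))
      (sym (trans (count-relabel-other 2+k≢k 1+n≢n p₁ u) u-Z)) X<Y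
    p₂-stat : final p₂ (kinds (suc k) u₁) ≡ p₂
    p₂-stat = swap-stationary u₁ u₁-lt

    ℓ = map (letter k)

    runs : mask (suc (suc k)) (relabel (suc k) (suc (suc k)) q₂ (relabel k (suc k) q₁ w)) ≡ mask (suc (suc k)) (swap (suc k) u₁)
         × final q₁ (kinds k w) ≡ final p₁ (kinds k u) + (final p₂ (kinds (suc k) u₁) ∸ final r (kinds (suc k) w))
         × final q₂ (kinds (suc k) (relabel k (suc k) q₁ w)) ≡ final p₂ (kinds (suc k) u₁) ⊓ final r (kinds (suc k) w)
    runs with interchange (ℓ w) r p₁ p₂ refl refl
    ... | m , f₁ , f₂
      rewrite mask-letter k (relabel (suc k) (suc (suc k)) q₂ (relabel k (suc k) q₁ w))
            | mask-letter k (swap (suc k) u₁)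
            | letters-relabelYZ k q₂ (relabel k (suc k) q₁ w)
            | letters-relabelXY k q₁ w
            | letters-relabelYZ k p₂ u₁
            | letters-relabelXY k p₁ u
            | letters-relabelYZ k r w = m ,
              trans (cong (final q₁) (kinds-XY k w)) (trans f₁ (cong₂ _+_ e-p₁ (cong₂ _∸_ e-p₂ e-r))) ,
              trans (cong (final q₂) (trans (kinds-YZ k (relabel k (suc k) q₁ w)) (cong (map kindYZ) (letters-relabelXY k q₁ w))))
                (trans f₂ (cong₂ _⊓_ e-p₂ e-r))
      where
      ℓu : ℓ u ≡ relabelYZ r (ℓ w)
      ℓu = letters-relabelYZ k r w
      e-p₁ : final p₁ (map kindXY (relabelYZ r (ℓ w))) ≡ final p₁ (kinds k u)
      e-p₁ = cong (final p₁) (sym (trans (kinds-XY k u) (cong (map kindXY) ℓu)))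
      e-p₂ : final p₂ (map kindYZ (relabelXY p₁ (relabelYZ r (ℓ w)))) ≡ final p₂ (kinds (suc k) u₁)
      e-p₂ = cong (final p₂) (sym (trans (kinds-YZ k u₁) (cong (map kindYZ) (trans (letters-relabelXY k p₁ u) (cong (relabelXY p₁) ℓu)))))
      e-r : final r (map kindYZ (ℓ w)) ≡ final r (kinds (suc k) w)
      e-r = cong (final r) (sym (kinds-YZ k w))

    q₁-stat : final q₁ (kinds k w) ≡ q₁
    q₁-stat = trans (proj₁ (proj₂ runs)) (cong₂ _+_ p₁-stat (cong₂ _∸_ p₂-stat r-stat))
    q₁≡ : q₁ ≡ final 0 (kinds k w)
    q₁≡ = swap-unique w q₁ X<Y q₁-stat

    w₁-lt : countOcc (suc k) w₁ < countOcc (suc (suc k)) w₁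
    w₁-lt = subst₂ _<_ (sym (count-relabel-srv k≢1+k _ w (swap-stationary w X<Y)))
      (sym (count-relabel-other 2+k≢k 1+n≢n _ w)) X<Z
    w₁≡ : relabel k (suc k) q₁ w ≡ w₁
    w₁≡ = cong (λ q → relabel k (suc k) q w) q₁≡
    q₂≡ : q₂ ≡ final 0 (kinds (suc k) w₁)
    q₂≡ = swap-unique w₁ q₂ w₁-lt (trans (cong (λ v → final q₂ (kinds (suc k) v)) (sym w₁≡))
      (trans (proj₂ (proj₂ runs)) (cong₂ _⊓_ p₂-stat r-stat)))

    same-mask : mask (suc (suc k)) (swap (suc k) w₁) ≡ mask (suc (suc k)) (swap (suc k) u₁)
    same-mask = trans (cong (mask (suc (suc k))) (sym (cong₂ (relabel (suc k) (suc (suc k))) q₂≡ w₁≡))) (proj₁ runs)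

  -- Take the stationary lengths `r`, `p₁`, `p₂` of one order and define `q₁`, `q₂` by the
  -- invariant. The invariant at the end of the turn shows that `q₁` and `q₂` are stationary as
  -- well, so by uniqueness they are the lengths used in the other order, and the departures
  -- coincide.
  interchange-swap : Agree (suc (suc k)) (swap (suc k) (swap k w)) (swap (suc k) (swap k (swap (suc k) w)))
  interchange-swap = agree-from-mask (agree-trans (agree-sym (agree-trans (relabel-agree _ w k+1<) (relabel-agree _ w₁ k+2<)))
      (agree-trans (relabel-agree _ w k+2<) (agree-trans (relabel-agree _ u k+1<) (relabel-agree _ u₁ k+2<)))) same-mask
    where
    k+2< : suc (suc k) < suc (suc (suc k))
    k+2< = ≤-refl
    k+1< : suc k < suc (suc (suc k))
    k+1< = m≤n⇒m≤1+n ≤-refl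

-- Sums over words of given content

∑ : {A : Set} → List A → (A → ℕ) → ℕ
∑ xs f = sum (map f xs)

∑-cong : {A : Set} (xs : List A) {f g : A → ℕ} → (∀ x → x ∈ xs → f x ≡ g x) → ∑ xs f ≡ ∑ xs g
∑-cong []       eq = refl
∑-cong (x ∷ xs) eq = cong₂ _+_ (eq x (here refl)) (∑-cong xs (λ y p → eq y (there p)))

∑-++ : {A : Set} (xs ys : List A) (f : A → ℕ) → ∑ (xs ++ ys) f ≡ ∑ xs f + ∑ ys f
∑-++ xs ys f = trans (cong sum (map-++ f xs ys)) (sum-++ (map f xs) (map f ys))

∑-insert : {A : Set} (xs ys : List A) (y : A) (f : A → ℕ) → ∑ (xs ++ y ∷ ys) f ≡ f y + ∑ (xs ++ ys) f
∑-insert xs ys y f = begin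
  ∑ (xs ++ y ∷ ys) f       ≡⟨ ∑-++ xs (y ∷ ys) f ⟩
  ∑ xs f + (f y + ∑ ys f)  ≡⟨ solve 3 (λ a b c → a :+ (b :+ c) := b :+ (a :+ c)) refl (∑ xs f) (f y) (∑ ys f) ⟩
  f y + (∑ xs f + ∑ ys f)  ≡⟨ cong (f y +_) (sym (∑-++ xs ys f)) ⟩
  f y + ∑ (xs ++ ys) f     ∎
  where
  open ≡-Reasoning
  open +-*-Solver

∈-delete : {A : Set} {x y : A} (xs {ys} : List A) → x ∈ xs ++ y ∷ ys → x ≢ y → x ∈ xs ++ ys
∈-delete []       (here p)  x≢y = ⊥-elim (x≢y p)
∈-delete []       (there p) x≢y = p
∈-delete (_ ∷ xs) (here p)  x≢y = here p
∈-delete (_ ∷ xs) (there p) x≢y = there (∈-delete xs p x≢y)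

∈-weaken : {A : Set} {x y : A} (xs {ys} : List A) → x ∈ xs ++ ys → x ∈ xs ++ y ∷ ys
∈-weaken []       p         = there p
∈-weaken (_ ∷ xs) (here p)  = here p
∈-weaken (_ ∷ xs) (there p) = there (∈-weaken xs p)

unique-delete : {A : Set} {y : A} (xs {ys} : List A) → Unique (xs ++ y ∷ ys) → Unique (xs ++ ys) × y ∉ xs ++ ys
unique-delete []       (p ∷ u) = u , λ y∈ → All.lookup p y∈ refl
unique-delete {y = y} (x ∷ xs) {ys} (p ∷ u) with unique-delete xs u
... | u′ , y∉ = All.tabulate (λ z∈ → All.lookup p (∈-weaken xs z∈)) ∷ u′ , λ where
  (here y≡x) → All.lookup p (∈-++⁺ʳ xs (here refl)) (sym y≡x)
  (there q)  → y∉ q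

∑-bijection : {A B : Set} (σ : A → B) (xs : List A) (ys : List B) → Unique xs → Unique ys →
  (∀ {x} → x ∈ xs → σ x ∈ ys) → (∀ {y} → y ∈ ys → ∃ λ x → x ∈ xs × σ x ≡ y) →
  (∀ {x x′} → x ∈ xs → x′ ∈ xs → σ x ≡ σ x′ → x ≡ x′) →
  (f : B → ℕ) → ∑ xs (f ∘ σ) ≡ ∑ ys f
∑-bijection σ [] [] ux uy into onto inj f = refl
∑-bijection σ [] (y ∷ ys) ux uy into onto inj f with onto (here refl)
... | _ , () , _
∑-bijection σ (x ∷ xs) ys (x∉ ∷ ux) uy into onto inj f with ∈-∃++ (into (here refl))
... | ys₁ , ys₂ , refl with unique-delete ys₁ uy
...   | uy′ , σx∉ = trans (cong (f (σ x) +_) (∑-bijection σ xs (ys₁ ++ ys₂) ux uy′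
        (λ p → ∈-delete ys₁ (into (there p)) (λ eq → All.lookup x∉ p (sym (inj (there p) (here refl) eq))))
        onto′ (λ p q → inj (there p) (there q)) f))
      (sym (∑-insert ys₁ ys₂ (σ x) f))
  where
  onto′ : ∀ {y} → y ∈ ys₁ ++ ys₂ → ∃ λ x′ → x′ ∈ xs × σ x′ ≡ y
  onto′ y∈ with onto (∈-weaken ys₁ y∈)
  ... | _  , here refl , eq = ⊥-elim (σx∉ (subst (_∈ ys₁ ++ ys₂) (sym eq) y∈))
  ... | x′ , there p   , eq = x′ , p , eq

∈-bfilter⁻ : {A : Set} (p : A → Bool) (xs : List A) {x : A} → x ∈ bfilter p xs → x ∈ xs × p x ≡ true
∈-bfilter⁻ p (y ∷ xs) x∈ with p y in eq
∈-bfilter⁻ p (y ∷ xs) (here refl) | true  = here refl , eq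
∈-bfilter⁻ p (y ∷ xs) (there x∈)  | true  = let q , r = ∈-bfilter⁻ p xs x∈ in there q , r
∈-bfilter⁻ p (y ∷ xs) x∈          | false = let q , r = ∈-bfilter⁻ p xs x∈ in there q , r

∈-bfilter⁺ : {A : Set} (p : A → Bool) (xs : List A) {x : A} → x ∈ xs → p x ≡ true → x ∈ bfilter p xs
∈-bfilter⁺ p (y ∷ xs) (here refl) px rewrite px = here refl
∈-bfilter⁺ p (y ∷ xs) (there x∈)  px with p y
... | true  = there (∈-bfilter⁺ p xs x∈ px)
... | false = ∈-bfilter⁺ p xs x∈ px

bfilter-unique : {A : Set} (p : A → Bool) (xs : List A) → Unique xs → Unique (bfilter p xs)
bfilter-unique p []       []       = []
bfilter-unique p (x ∷ xs) (x∉ ∷ u) with p x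
... | true  = All.tabulate (λ y∈ → All.lookup x∉ (proj₁ (∈-bfilter⁻ p xs y∈))) ∷ bfilter-unique p xs u
... | false = bfilter-unique p xs u

∈-oneTo⁺ : ∀ {n r} → 1 ≤ r → r ≤ n → r ∈ oneTo n
∈-oneTo⁺ {n} {suc r} _ r<n = ∈-map⁺ suc (∈-upTo⁺ r<n)

∈-oneTo⁻ : ∀ {n r} → r ∈ oneTo n → 1 ≤ r × r ≤ n
∈-oneTo⁻ r∈ with ∈-map⁻ suc r∈
... | _ , p , refl = s≤s z≤n , ∈-upTo⁻ p

oneTo-unique : ∀ n → Unique (oneTo n)
oneTo-unique n = Unique.map⁺ suc-injective (Unique.upTo⁺ n)

words-cartesian : ∀ n L → words n (suc L) ≡ cartesianProductWith (λ w r → r ∷ w) (words n L) (oneTo n)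
words-cartesian n L = go (words n L)
  where
  go : ∀ ws → concatMap (λ w → map (λ r → r ∷ w) (oneTo n)) ws ≡ cartesianProductWith (λ w r → r ∷ w) ws (oneTo n)
  go []       = refl
  go (w ∷ ws) = cong (map (λ r → r ∷ w) (oneTo n) ++_) (go ws)

words-unique : ∀ n L → Unique (words n L)
words-unique n zero    = [] ∷ []
words-unique n (suc L) = subst Unique (sym (words-cartesian n L))
  (Unique.cartesianProductWith⁺ (λ w r → r ∷ w) (λ eq → ∷-injectiveʳ eq , ∷-injectiveˡ eq) (words-unique n L) (oneTo-unique n))

∈-words⁺ : ∀ {n} L {w} → length w ≡ L → All (λ x → 1 ≤ x × x ≤ n) w → w ∈ words n L
∈-words⁺ zero {[]} refl [] = here refl
∈-words⁺ {n} (suc L) {x ∷ w} eq ((p , q) ∷ ps) = subst ((x ∷ w) ∈_) (sym (words-cartesian n L))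
  (∈-cartesianProductWith⁺ (λ w r → r ∷ w) (∈-words⁺ L (suc-injective eq) ps) (∈-oneTo⁺ p q))

∈-words⁻ : ∀ {n} L {w} → w ∈ words n L → length w ≡ L × All (λ x → 1 ≤ x × x ≤ n) w
∈-words⁻ zero (here refl) = refl , []
∈-words⁻ {n} (suc L) w∈ with ∈-cartesianProductWith⁻ (λ w r → r ∷ w) (words n L) (oneTo n) (subst (_ ∈_) (words-cartesian n L) w∈)
... | w , r , w∈′ , r∈ , refl = let eq , ps = ∈-words⁻ L w∈′ in cong suc eq , ∈-oneTo⁻ r∈ ∷ ps

hasContent : ℕ → (ℕ → ℕ) → List ℕ → Bool
hasContent n c w = all (λ r → countOcc r w ≡ᵇ c r) (oneTo n)

wordsOf : ℕ → ℕ → (ℕ → ℕ) → List (List ℕ)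
wordsOf n L c = bfilter (hasContent n c) (words n L)

all-true⁻ : {A : Set} (p : A → Bool) (xs : List A) → all p xs ≡ true → ∀ {x} → x ∈ xs → p x ≡ true
all-true⁻ p (y ∷ xs) eq x∈ with p y in py
all-true⁻ p (y ∷ xs) eq (here refl) | true = py
all-true⁻ p (y ∷ xs) eq (there x∈)  | true = all-true⁻ p xs eq x∈

all-true⁺ : {A : Set} (p : A → Bool) (xs : List A) → (∀ {x} → x ∈ xs → p x ≡ true) → all p xs ≡ true
all-true⁺ p []       ps = refl
all-true⁺ p (x ∷ xs) ps rewrite ps (here refl) = all-true⁺ p xs (λ q → ps (there q))

∈-wordsOf⁻ : ∀ {n L c w} → w ∈ wordsOf n L c → Word n L c w
∈-wordsOf⁻ {n} {L} {c} {w} w∈ = let p , q = ∈-bfilter⁻ (hasContent n c) (words n L) w∈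
                                    eq , ps = ∈-words⁻ L p in
  word eq ps (λ r 1≤r r≤n → ≡ᵇ-true⇒≡ (countOcc r w) (c r)
    (all-true⁻ (λ r → countOcc r w ≡ᵇ c r) (oneTo n) q (∈-oneTo⁺ 1≤r r≤n)))

∈-wordsOf⁺ : ∀ {n L c w} → Word n L c w → w ∈ wordsOf n L c
∈-wordsOf⁺ {n} {L} {c} {w} W = ∈-bfilter⁺ (hasContent n c) (words n L) (∈-words⁺ L (Word.len W) (Word.letters W))
  (all-true⁺ (λ r → countOcc r w ≡ᵇ c r) (oneTo n) (λ r∈ → let p , q = ∈-oneTo⁻ r∈ in
    trans (cong (_≡ᵇ c _) (Word.content W _ p q)) (≡ᵇ-refl (c _))))

wordsOf-unique : ∀ n L c → Unique (wordsOf n L c)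
wordsOf-unique n L c = bfilter-unique (hasContent n c) (words n L) (words-unique n L)

∑-swap : ∀ {n L k c} → 1 ≤ k → k < n → c k < c (suc k) → (f : List ℕ → ℕ) →
  ∑ (wordsOf n L c) (f ∘ swap k) ≡ ∑ (wordsOf n L (transpose k c)) f
∑-swap {n} {L} {k} {c} 1≤k k<n lt = ∑-bijection (swap k) (wordsOf n L c) (wordsOf n L (transpose k c))
  (wordsOf-unique n L c) (wordsOf-unique n L (transpose k c))
  (λ w∈ → ∈-wordsOf⁺ (swap-word {n} {L} {k} {c} 1≤k k<n lt (from w∈)))
  (λ {w} w∈ → swapʳ k w , ∈-wordsOf⁺ (swapʳ-word {n} {L} {k} {c} 1≤k k<n lt (from′ w∈))
    , swap-swapʳ {n} {L} {k} {c} 1≤k k<n lt (from′ w∈))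
  (λ w∈ w∈′ eq → trans (sym (swapʳ-swap {n} {L} {k} {c} 1≤k k<n lt (from w∈)))
    (trans (cong (swapʳ k) eq) (swapʳ-swap {n} {L} {k} {c} 1≤k k<n lt (from w∈′))))
  where
  from : ∀ {w} → w ∈ wordsOf n L c → Word n L c w
  from = ∈-wordsOf⁻ {n} {L} {c}
  from′ : ∀ {w} → w ∈ wordsOf n L (transpose k c) → Word n L (transpose k c) w
  from′ = ∈-wordsOf⁻ {n} {L} {transpose k c}

-- Discarding rows

-- The statistic is left arbitrary so that the constant 1 transports the number of words in the same
-- way as the sum to be averaged.
Statistic : Set
Statistic = List Bool → List Bool → List Bool → ℕ

-- Sum of a statistic of the last row and of its departures from rows k₁ and k₂ (with k₁ + d₁ = k₂ + d₂ = n).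
total : (n L : ℕ) → (ℕ → ℕ) → Statistic → ℕ → ℕ → ℕ → ℕ → ℕ
total n L c Φ d₁ k₁ d₂ k₂ =
  ∑ (wordsOf n L c) (λ w → Φ (mask n w) (mask n (descend d₁ k₁ w)) (mask n (descend d₂ k₂ w)))

cong₃ : {A B C D : Set} (f : A → B → C → D) {a a′ : A} {b b′ : B} {c c′ : C} → a ≡ a′ → b ≡ b′ → c ≡ c′ → f a b c ≡ f a′ b′ c′
cong₃ f refl refl refl = refl

-- `descend (suc d) k` begins with `swap k`. Transport along this bijection leaves `d` queues
-- starting from row `suc k`, which now has the size of row `k`; rows `k` and `suc k` come before
-- `j`, so the last row and the other departures do not notice.
total-burke : ∀ {n L c} Φ d k d′ j → 1 ≤ k → suc k < j → j ≤ n → c k < c (suc k) →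
  total n L c Φ (suc d) k d′ j ≡ total n L (transpose k c) Φ d (suc k) d′ j
total-burke {n} {L} {c} Φ d k d′ j 1≤k k+1<j j≤n lt = trans
  (∑-cong (wordsOf n L c) (λ w _ → cong₃ Φ
    (agree-mask ≤-refl (relabel-agree _ w (<-≤-trans k+1<j j≤n))) refl
    (agree-mask j≤n (agree-descend d′ j ≤-refl (relabel-agree _ w k+1<j)))))
  (∑-swap {n} {L} {k} {c} 1≤k (<-trans (n<1+n k) (<-≤-trans k+1<j j≤n)) lt
    (λ w → Φ (mask n w) (mask n (descend d (suc k) w)) (mask n (descend d′ j w))))

-- The bijection at `suc k` removes the first queue of the departures from row `suc k`. The
-- departures from row `k` keep all their queues, since exchanging two services in series does not
-- alter what leaves the second.
total-interchange : ∀ {n L c} Φ d k → 1 ≤ k → suc (suc k) < n → c k < c (suc k) → c (suc k) < c (suc (suc k)) →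
  total n L c Φ (suc (suc d)) k (suc d) (suc k) ≡ total n L (transpose (suc k) c) Φ (suc (suc d)) k d (suc (suc k))
total-interchange {n} {L} {c} Φ d k 1≤k k+2<n lt₁ lt₂ = trans
  (∑-cong (wordsOf n L c) (λ w w∈ → cong₃ Φ
    (agree-mask ≤-refl (relabel-agree _ w k+2<n))
    (agree-mask (<⇒≤ k+2<n) (agree-descend d (suc (suc k)) ≤-refl (swapped w (∈-wordsOf⁻ {n} {L} {c} w∈))))
    refl))
  (∑-swap {n} {L} {suc k} {c} (s≤s z≤n) (<-trans (n<1+n (suc k)) k+2<n) lt₂
    (λ w → Φ (mask n w) (mask n (descend (suc (suc d)) k w)) (mask n (descend d (suc (suc k)) w))))
  where
  swapped : ∀ w → Word n L c w → Agree (suc (suc k)) (swap (suc k) (swap k w)) (swap (suc k) (swap k (swap (suc k) w)))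
  swapped w W = interchange-swap w
    (word-lt {n} {L} {k} {c} 1≤k (<-trans (n<1+n k) (<-trans (n<1+n (suc k)) k+2<n)) lt₁ W)
    (word-lt {n} {L} {suc k} {c} (s≤s z≤n) (<-trans (n<1+n (suc k)) k+2<n) lt₂ W)

record Lowered (k i : ℕ) (c : ℕ → ℕ) : Set where
  constructor lowered
  field
    size  : c k ≡ i
    above : ∀ m → k < m → c m ≡ m

-- Each Burke exchange carries the size `i` one row further and leaves the larger size behind, in a
-- row that no queue visits any more.
lower-row : ∀ {n L i} t k d d′ j c → 1 ≤ k → i ≤ k → k + t < j → j ≤ n → Lowered k i c →
  ∃ λ c′ → Lowered (k + t) i c′ × (∀ Φ → total n L c Φ (t + d) k d′ j ≡ total n L c′ Φ d (k + t) d′ j)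
lower-row zero k d d′ j c 1≤k i≤k lt j≤n Lw rewrite +-identityʳ k = c , Lw , λ Φ → refl
lower-row {n} {L} {i} (suc t) k d d′ j c 1≤k i≤k lt j≤n (lowered refl above) rewrite +-suc k t
  with lower-row {n} {L} {c k} t (suc k) d d′ j (transpose k c) (s≤s z≤n) (m≤n⇒m≤1+n i≤k) lt j≤n
    (lowered (transpose-high k c) (λ m k<m → trans (transpose-other k c m (≢-sym (<⇒≢ (<-trans (n<1+n k) k<m))) (≢-sym (<⇒≢ k<m)))
      (above m (<-trans (n<1+n k) k<m))))
... | c′ , Lw′ , eq = c′ , Lw′ , λ Φ → trans
  (total-burke {n} {L} {c} Φ (t + d) k d′ j 1≤k (≤-<-trans (s≤s (m≤m+n k t)) lt) j≤n
    (subst (c k <_) (sym (above (suc k) (n<1+n k))) (s≤s i≤k))) (eq Φ)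

-- To pass the next row, interchangeability first takes `j` past it. The large row then stands
-- directly after the row of size `i`, and a Burke exchange takes `i` past it too.
lower-pair : ∀ {L i j} t k c → 1 ≤ k → i < j → j ≤ suc k → c k ≡ i → Lowered (suc k) j c →
  let n = suc (suc (k + t)) in
  ∃ λ c′ → c′ (k + t) ≡ i × Lowered (suc (k + t)) j c′
    × (∀ Φ → total n L c Φ (suc (suc t)) k (suc t) (suc k) ≡ total n L c′ Φ 2 (k + t) 1 (suc (k + t)))
lower-pair zero k c 1≤k i<j j≤k+1 ci Lw rewrite +-identityʳ k = c , ci , Lw , λ Φ → refl
lower-pair {L} {i} {j} (suc t) k c 1≤k i<j j≤k+1 ci (lowered cj above) rewrite +-suc k t
  with lower-pair {L} {i} {j} t (suc k) (transpose k (transpose (suc k) c)) (s≤s z≤n) i<j (m≤n⇒m≤1+n j≤k+1)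
    (trans (transpose-high k (transpose (suc k) c)) (trans (transpose-other (suc k) c k k≢1+k (≢-sym 2+k≢k)) ci))
    (lowered (trans (transpose-other k (transpose (suc k) c) (suc (suc k)) 2+k≢k 1+n≢n) (trans (transpose-high (suc k) c) cj))
      (λ m lt → trans (transpose-other k (transpose (suc k) c) m
           (≢-sym (<⇒≢ (<-trans (n<1+n k) (<-trans (n<1+n (suc k)) lt)))) (≢-sym (<⇒≢ (<-trans (n<1+n (suc k)) lt))))
         (trans (transpose-other (suc k) c m (≢-sym (<⇒≢ (<-trans (n<1+n (suc k)) lt))) (≢-sym (<⇒≢ lt)))
           (above m (<-trans (n<1+n (suc k)) lt)))))
... | c′ , ci′ , Lw′ , eq = c′ , ci′ , Lw′ , λ Φ → trans
  (total-interchange {suc (suc (suc (k + t)))} {L} {c} Φ (suc t) k 1≤k (s≤s (s≤s (s≤s (m≤m+n k t)))) lt₁ lt₂)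
  (trans (total-burke {suc (suc (suc (k + t)))} {L} {transpose (suc k) c} Φ (suc (suc t)) k (suc t) (suc (suc k)) 1≤k ≤-refl (s≤s (s≤s (m≤n⇒m≤1+n (m≤m+n k t)))) lt₃) (eq Φ))
  where
  lt₁ : c k < c (suc k)
  lt₁ = subst₂ _<_ (sym ci) (sym cj) i<j
  lt₂ : c (suc k) < c (suc (suc k))
  lt₂ = subst₂ _<_ (sym cj) (sym (above (suc (suc k)) ≤-refl)) (s≤s j≤k+1)
  lt₃ : transpose (suc k) c k < transpose (suc k) c (suc k)
  lt₃ = subst₂ _<_ (sym (transpose-other (suc k) c k k≢1+k (≢-sym 2+k≢k))) (sym (transpose-low (suc k) c)) (<-trans lt₁ lt₂)

-- The bully path procedure

positions : ℕ → List Bool → List ℕ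
positions k []          = []
positions k (true ∷ B)  = k ∷ positions (suc k) B
positions k (false ∷ B) = positions (suc k) B

data Flip : ℕ → List Bool → List Bool → Set where
  here  : ∀ {B} → Flip 0 (false ∷ B) (true ∷ B)
  there : ∀ {p b B B′} → Flip p B B′ → Flip (suc p) (b ∷ B) (b ∷ B′)

data First : ℕ → List Bool → Set where
  here  : ∀ {B} → First 0 (true ∷ B)
  there : ∀ {p B} → First p B → First (suc p) (false ∷ B)

data FirstAfter : ℕ → ℕ → List Bool → Set where
  here  : ∀ {p b B} → First p B → FirstAfter 0 (suc p) (b ∷ B)
  there : ∀ {x p b B} → FirstAfter x p B → FirstAfter (suc x) (suc p) (b ∷ B)

data NoneAfter : ℕ → List Bool → Set where
  here  : ∀ {b B} → trues B ≡ 0 → NoneAfter 0 (b ∷ B)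
  there : ∀ {x b B} → NoneAfter x B → NoneAfter (suc x) (b ∷ B)

<ᵇ-true : ∀ {m n} → m < n → (m <ᵇ n) ≡ true
<ᵇ-true {m} {n} p with m <ᵇ n | <⇒<ᵇ p
... | true | _ = refl

<ᵇ-false : ∀ {m n} → n ≤ m → (m <ᵇ n) ≡ false
<ᵇ-false {m} {n} p with m <ᵇ n in eq
... | false = refl
... | true  = ⊥-elim (<⇒≱ (<ᵇ⇒< m n (subst IsTrue (sym eq) _)) p)

firstGt-later : ∀ x k B → x < k → firstGt x (positions k B) ≡ headM (positions k B)
firstGt-later x k []          p = refl
firstGt-later x k (true ∷ B)  p rewrite <ᵇ-true p = refl
firstGt-later x k (false ∷ B) p = firstGt-later x (suc k) B (m≤n⇒m≤1+n p)

headM-first : ∀ {p B} k → First p B → headM (positions k B) ≡ just (k + p)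
headM-first k here = cong just (sym (+-identityʳ k))
headM-first k (there {p} f) = trans (headM-first (suc k) f) (cong just (sym (+-suc k p)))

headM-none : ∀ k B → trues B ≡ 0 → headM (positions k B) ≡ nothing
headM-none k []          eq = refl
headM-none k (false ∷ B) eq = headM-none (suc k) B eq

firstGt-first : ∀ {x p B} k → FirstAfter x p B → firstGt (k + x) (positions k B) ≡ just (k + p)
firstGt-first k (here {p} {false} {B} f) rewrite +-identityʳ k | +-suc k p =
  trans (firstGt-later k (suc k) B ≤-refl) (headM-first (suc k) f)
firstGt-first k (here {p} {true} {B} f) rewrite +-identityʳ k | +-suc k p | <ᵇ-false (≤-refl {k}) =
  trans (firstGt-later k (suc k) B ≤-refl) (headM-first (suc k) f)
firstGt-first k (there {x} {p} {false} f) rewrite +-suc k x | +-suc k p = firstGt-first (suc k) f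
firstGt-first k (there {x} {p} {true} f) rewrite +-suc k x | +-suc k p | <ᵇ-false (m≤n⇒m≤1+n (m≤m+n k x)) = firstGt-first (suc k) f

firstGt-none : ∀ {x B} k → NoneAfter x B → firstGt (k + x) (positions k B) ≡ nothing
firstGt-none k (here {false} {B} eq) rewrite +-identityʳ k = trans (firstGt-later k (suc k) B ≤-refl) (headM-none (suc k) B eq)
firstGt-none k (here {true} {B} eq) rewrite +-identityʳ k | <ᵇ-false (≤-refl {k}) =
  trans (firstGt-later k (suc k) B ≤-refl) (headM-none (suc k) B eq)
firstGt-none k (there {x} {false} f) rewrite +-suc k x = firstGt-none (suc k) f
firstGt-none k (there {x} {true} f) rewrite +-suc k x | <ᵇ-false (m≤n⇒m≤1+n (m≤m+n k x)) = firstGt-none (suc k) f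

remove-earlier : ∀ x k B → x < k → remove x (positions k B) ≡ positions k B
remove-earlier x k []          p = refl
remove-earlier x k (true ∷ B)  p rewrite ≢⇒≡ᵇ-false (≢-sym (<⇒≢ p)) = cong (k ∷_) (remove-earlier x (suc k) B (m≤n⇒m≤1+n p))
remove-earlier x k (false ∷ B) p = remove-earlier x (suc k) B (m≤n⇒m≤1+n p)

remove-flip : ∀ {p B B′} k → Flip p B′ B → remove (k + p) (positions k B) ≡ positions k B′
remove-flip k (here {B}) rewrite +-identityʳ k | ≡ᵇ-refl k = remove-earlier k (suc k) B ≤-refl
remove-flip k (there {p} {false} f) rewrite +-suc k p = remove-flip (suc k) f
remove-flip k (there {p} {true} f) rewrite +-suc k p | ≢⇒≡ᵇ-false (<⇒≢ (s≤s (m≤m+n k p))) = cong (k ∷_) (remove-flip (suc k) f)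

unservedHere : Kind → ℕ → Bool
unservedHere srv q = not (positive q)
unservedHere arr q = false
unservedHere oth q = false

unserved : ℕ → List Kind → List Bool
unserved q []      = []
unserved q (k ∷ K) = unservedHere k q ∷ unserved (next k q) K

unserved-count : ∀ q K → trues (served q K) + trues (unserved q K) ≡ services K
unserved-count q []              = refl
unserved-count q (arr ∷ K)       = unserved-count (suc q) K
unserved-count zero (srv ∷ K)    = trans (+-suc _ _) (cong suc (unserved-count zero K))
unserved-count (suc q) (srv ∷ K) = cong suc (unserved-count q K)
unserved-count q (oth ∷ K)       = unserved-count q K

-- One more waiting customer takes the first unserved service, if there is one, and changes nothing else.
data Bump (q : ℕ) (K : List Kind) : Set where
  absorbed : ∀ p → First p (unserved q K) → Flip p (served q K) (served (suc q) K) →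
    Flip p (unserved (suc q) K) (unserved q K) → final (suc q) K ≡ final q K → Bump q K
  passed : trues (unserved q K) ≡ 0 → served (suc q) K ≡ served q K → unserved (suc q) K ≡ unserved q K →
    final (suc q) K ≡ suc (final q K) → Bump q K

bump : ∀ q K → Bump q K
bump q [] = passed refl refl refl refl
bump q (arr ∷ K) with bump (suc q) K
... | absorbed p f s u e = absorbed (suc p) (there f) (there s) (there u) e
... | passed n s u e     = passed n (cong (false ∷_) s) (cong (false ∷_) u) e
bump zero (srv ∷ K) = absorbed 0 here here here refl
bump (suc q) (srv ∷ K) with bump q K
... | absorbed p f s u e = absorbed (suc p) (there f) (there s) (there u) e
... | passed n s u e     = passed n (cong (true ∷_) s) (cong (false ∷_) u) e
bump q (oth ∷ K) with bump q K
... | absorbed p f s u e = absorbed (suc p) (there f) (there s) (there u) e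
... | passed n s u e     = passed n (cong (false ∷_) s) (cong (false ∷_) u) e

data Arrive : ℕ → List Kind → List Kind → Set where
  here  : ∀ {K} → Arrive 0 (oth ∷ K) (arr ∷ K)
  there : ∀ {x k K K′} → Arrive x K K′ → Arrive (suc x) (k ∷ K) (k ∷ K′)

data Inserted (q x : ℕ) (K K′ : List Kind) : Set where
  absorbed : ∀ p → FirstAfter x p (unserved q K) → Flip p (served q K) (served q K′) →
    Flip p (unserved q K′) (unserved q K) → final q K′ ≡ final q K → Inserted q x K K′
  passed : NoneAfter x (unserved q K) → served q K′ ≡ served q K → unserved q K′ ≡ unserved q K →
    final q K′ ≡ suc (final q K) → Inserted q x K K′

insert : ∀ {x K K′} q → Arrive x K K′ → Inserted q x K K′
insert q (here {K}) with bump q K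
... | absorbed p f s u e = absorbed (suc p) (here f) (there s) (there u) e
... | passed n s u e     = passed (here n) (cong (false ∷_) s) (cong (false ∷_) u) e
insert q (there {k = k} a) with insert (next k q) a
... | absorbed p f s u e = absorbed (suc p) (there f) (there s) (there u) e
... | passed n s u e     = passed (there n) (cong (_ ∷_) s) (cong (_ ∷_) u) e

-- A new customer not served before the end of the word is carried round the cycle as one more
-- customer at the start, and then takes the first unserved service of the row: this is wrapping. An
-- unserved service must exist, for otherwise the customer would circulate for ever.
bully-step : ∀ {x K K′} q → Arrive x K K′ → final q K ≡ q → 0 < trues (unserved q K) →
  ∃₂ λ q′ p → final q′ K′ ≡ q′ × Flip p (served q K) (served q′ K′) × Flip p (unserved q′ K′) (unserved q K)
    × bully (suc x) (positions 1 (unserved q K)) ≡ just (suc p)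
bully-step {x} {K} {K′} q a st pos with insert q a
... | absorbed p f s u e = q , p , trans e st , s , u , cong (_<∣> headM (positions 1 (unserved q K))) (firstGt-first 1 f)
... | passed n s u e with bump q K′
...   | passed n′ _ _ _ = ⊥-elim (<-irrefl (sym (trans (cong trues (sym u)) n′)) pos)
...   | absorbed p f′ s′ u′ e′ = suc q , p , trans e′ (trans e (cong suc st))
        , subst (λ B → Flip p B (served (suc q) K′)) s s′
        , subst (Flip p (unserved (suc q) K′)) u u′
        , trans (cong (_<∣> headM (positions 1 (unserved q K))) (firstGt-none 1 n))
                (headM-first 1 (subst (First p) u f′))

-- Used and available entries of a row

data Row (m : ℕ) : List ℕ → List Bool → Set where
  []    : Row m [] []
  own   : ∀ {w U} b → Row m w U → Row m (m ∷ w) (b ∷ U)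
  other : ∀ {c w U} → c ≢ m → Row m w U → Row m (c ∷ w) (false ∷ U)

data Take (m : ℕ) : ℕ → List ℕ → List Bool → List Bool → Set where
  here  : ∀ {w U} → Take m 0 (m ∷ w) (false ∷ U) (true ∷ U)
  there : ∀ {p c w u U U′} → Take m p w U U′ → Take m (suc p) (c ∷ w) (u ∷ U) (u ∷ U′)

available : ℕ → List ℕ → List Bool → List Bool
available m (c ∷ w) (u ∷ U) = ((c ≡ᵇ m) ∧ not u) ∷ available m w U
available m _       _       = []

-- Only the used entries of row `m` arrive, so that the queue also describes the procedure in the
-- middle of a phase.
usedKind : ℕ → ℕ → Bool → Kind
usedKind m c u = if c ≡ᵇ suc m then srv else (if u then arr else oth)

usedKinds : ℕ → List ℕ → List Bool → List Kind
usedKinds m (c ∷ w) (u ∷ U) = usedKind m c u ∷ usedKinds m w U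
usedKinds m _       _       = []

take-flip : ∀ {m p w U U′} → Take m p w U U′ → Flip p U U′
take-flip here      = here
take-flip (there t) = there (take-flip t)

take-available : ∀ {m p w U U′} → Take m p w U U′ → Flip p (available m w U′) (available m w U)
take-available {m} here rewrite ≡ᵇ-refl m = here
take-available (there t) = there (take-available t)

take-arrive : ∀ {m p w U U′} → Take m p w U U′ → Arrive p (usedKinds m w U) (usedKinds m w U′)
take-arrive {m} here rewrite ≢⇒≡ᵇ-false (k≢1+k {m}) = here
take-arrive (there t) = there (take-arrive t)

take-row : ∀ {m p w U U′} → Take m p w U U′ → Row m w U → Row m w U′
take-row here      (own _ ρ)     = own true ρ
take-row here      (other m≢m ρ) = ⊥-elim (m≢m refl)
take-row (there t) (own b ρ)     = own b (take-row t ρ)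
take-row (there t) (other c ρ)   = other c (take-row t ρ)

served-row : ∀ {m w U} q → Row m w U → Row (suc m) w (served q (usedKinds m w U))
served-row q [] = []
served-row {m} q (own b ρ) rewrite ≢⇒≡ᵇ-false (k≢1+k {m}) with b
... | true  = other k≢1+k (served-row (suc q) ρ)
... | false = other k≢1+k (served-row q ρ)
served-row {m} q (other {c} c≢m ρ) with c ≡ᵇ suc m in eq
... | true rewrite ≡ᵇ-true⇒≡ c (suc m) eq = own (positive q) (served-row (pred q) ρ)
... | false = other (λ c≡ → false≢true (trans (sym eq) (trans (cong (_≡ᵇ suc m) c≡) (≡ᵇ-refl m)))) (served-row q ρ)
  where
  false≢true : false ≢ true
  false≢true ()

flip-take : ∀ {m p w U U′ q q′} → Row m w U → Row m w U′ →
  Flip p (served q (usedKinds m w U)) (served q′ (usedKinds m w U′)) →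
  Take (suc m) p w (served q (usedKinds m w U)) (served q′ (usedKinds m w U′))
flip-take ρ ρ′ f = go (served-row _ ρ′) f
  where
  go : ∀ {r p w B B′} → Row r w B′ → Flip p B B′ → Take r p w B B′
  go (own .true ρ)  here      = here
  go (own b ρ)      (there f) = there (go ρ f)
  go (other c ρ)    (there f) = there (go ρ f)

unserved-letter : ∀ m c u q → (c ≡ᵇ suc m) ∧ not (serves (usedKind m c u) q) ≡ unservedHere (usedKind m c u) q
unserved-letter m c u q with c ≡ᵇ suc m | u
... | true  | _     = refl
... | false | true  = refl
... | false | false = refl

unserved-available : ∀ {m w U} q → Row m w U → available (suc m) w (served q (usedKinds m w U)) ≡ unserved q (usedKinds m w U)
unserved-available q [] = refl
unserved-available {m} {c ∷ w} {u ∷ U} q (own _ ρ)   = cong₂ _∷_ (unserved-letter m c u q) (unserved-available _ ρ)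
unserved-available {m} {c ∷ w} {u ∷ U} q (other _ ρ) = cong₂ _∷_ (unserved-letter m c u q) (unserved-available _ ρ)

row-count : ∀ {m w U} → Row m w U → trues U ≤ countOcc m w
row-count [] = z≤n
row-count {m} (own {w} true ρ)  rewrite ≡ᵇ-refl m = s≤s (row-count ρ)
row-count {m} (own {w} false ρ) rewrite ≡ᵇ-refl m = m≤n⇒m≤1+n (row-count ρ)
row-count (other c≢m ρ) rewrite ≢⇒≡ᵇ-false c≢m = row-count ρ

row-arrivals : ∀ {m w U} → Row m w U → arrivals (usedKinds m w U) ≤ trues U
row-arrivals [] = z≤n
row-arrivals {m} (own {w} true ρ)  rewrite ≢⇒≡ᵇ-false (k≢1+k {m}) = s≤s (row-arrivals ρ)
row-arrivals {m} (own {w} false ρ) rewrite ≢⇒≡ᵇ-false (k≢1+k {m}) = row-arrivals ρ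
row-arrivals {m} (other {c} c≢m ρ) with c ≡ᵇ suc m
... | true  = row-arrivals ρ
... | false = row-arrivals ρ

row-services : ∀ {m w U} → Row m w U → services (usedKinds m w U) ≡ countOcc (suc m) w
row-services [] = refl
row-services {m} (own {w} true ρ)  rewrite ≢⇒≡ᵇ-false (k≢1+k {m}) = row-services ρ
row-services {m} (own {w} false ρ) rewrite ≢⇒≡ᵇ-false (k≢1+k {m}) = row-services ρ
row-services {m} (other {c} c≢m ρ) with c ≡ᵇ suc m
... | true  = cong suc (row-services ρ)
... | false = row-services ρ

some-unserved : ∀ {m w U} q → Row m w U → countOcc m w < countOcc (suc m) w → final q (usedKinds m w U) ≡ q →
  0 < trues (unserved q (usedKinds m w U))
some-unserved {m} {w} {U} q ρ lt st = +-cancelˡ-< (trues (served q K)) 0 (trues (unserved q K))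
  (subst₂ _<_ (sym (trans (+-identityʳ _) (served-count-stationary q K st))) (sym (unserved-count q K))
    (≤-<-trans (≤-trans (row-arrivals ρ) (row-count ρ)) (subst (countOcc m w <_) (sym (row-services ρ)) lt)))
  where K = usedKinds m w U

-- Phases of the procedure and labels of the endpoints

bitAt : List Bool → ℕ → Bool
bitAt []      p       = false
bitAt (b ∷ B) zero    = b
bitAt (b ∷ B) (suc p) = bitAt B p

flip-before : ∀ {p B B′} → Flip p B B′ → bitAt B p ≡ false
flip-before here      = refl
flip-before (there f) = flip-before f

flip-after : ∀ {p B B′} → Flip p B B′ → bitAt B′ p ≡ true
flip-after here      = refl
flip-after (there f) = flip-after f

flip-elsewhere : ∀ {p B B′ x} → Flip p B B′ → x ≢ p → bitAt B′ x ≡ bitAt B x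
flip-elsewhere {x = zero}  here      x≢p = ⊥-elim (x≢p refl)
flip-elsewhere {x = suc x} here      x≢p = refl
flip-elsewhere {x = zero}  (there f) x≢p = refl
flip-elsewhere {x = suc x} (there f) x≢p = flip-elsewhere f (λ eq → x≢p (cong suc eq))

upd-same : ∀ av r l → upd av r l r ≡ l
upd-same av r l rewrite ≡ᵇ-refl r = refl

upd-other : ∀ av r l {r′} → r′ ≢ r → upd av r l r′ ≡ av r′
upd-other av r l p rewrite ≢⇒≡ᵇ-false p = refl

path-step : ∀ k r x av {y} → bully x (av (suc r)) ≡ just y →
  path (suc k) r x av ≡ path k (suc r) y (upd av (suc r) (remove y (av (suc r))))
path-step k r x av eq with bully x (av (suc r))
path-step k r x av refl | just y = refl

startAll-step : ∀ n r x xs lab av {e av′} → member x (av r) ≡ true →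
  path (n ∸ r) r x (upd av r (remove x (av r))) ≡ (just e , av′) →
  startAll n r (x ∷ xs) (lab , av) ≡ startAll n r xs ((e , r) ∷ lab , av′)
startAll-step n r x xs lab av m p rewrite m | p = refl

-- Entries of a queue are numbered from 1, bits of a mask from 0.
label : Labels → ℕ → Maybe ℕ
label lab p = lookupLab (suc p) lab

label-same : ∀ e r lab → label ((suc e , r) ∷ lab) e ≡ just r
label-same e r lab rewrite ≡ᵇ-refl e = refl

label-other : ∀ {e p} r lab → p ≢ e → label ((suc e , r) ∷ lab) p ≡ label lab p
label-other r lab p≢e rewrite ≢⇒≡ᵇ-false p≢e = refl

Labelled : Labels → List Bool → Set
Labelled lab E = ∀ p → bitAt E p ≡ is-just (label lab p)

AtMost : ℕ → Labels → Set
AtMost r lab = ∀ p l → label lab p ≡ just l → l ≤ r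

record Extends (r : ℕ) (lab lab′ : Labels) : Set where
  field
    kept : ∀ p l → label lab p ≡ just l → label lab′ p ≡ just l
    new  : ∀ p → label lab p ≡ nothing → label lab′ p ≡ nothing ⊎ ∃ λ l → r ≤ l × label lab′ p ≡ just l
open Extends

extends-refl : ∀ {r lab} → Extends r lab lab
extends-refl = record { kept = λ p l eq → eq ; new = λ p eq → inj₁ eq }

extends-trans : ∀ {r r′ lab lab′ lab″} → r ≤ r′ → Extends r lab lab′ → Extends r′ lab′ lab″ → Extends r lab lab″
extends-trans r≤r′ x y = record
  { kept = λ p l eq → kept y p l (kept x p l eq)
  ; new  = λ p eq → compose p (new x p eq) }
  where
  compose : ∀ p → _ → _
  compose p (inj₂ (l , r≤l , eq)) = inj₂ (l , r≤l , kept y p l eq)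
  compose p (inj₁ eq) with new y p eq
  ... | inj₁ eq′ = inj₁ eq′
  ... | inj₂ (l , r′≤l , eq′) = inj₂ (l , ≤-trans r≤r′ r′≤l , eq′)

module _ {lab : Labels} {E E′ : List Bool} {e : ℕ} (r : ℕ) (f : Flip e E E′) (ok : Labelled lab E) where

  private
    unlabelled : label lab e ≡ nothing
    unlabelled with label lab e | ok e
    ... | nothing | _  = refl
    ... | just _  | eq = ⊥-elim (true≢false (trans (sym eq) (flip-before f)))
      where
      true≢false : true ≢ false
      true≢false ()

  labelled-step : Labelled ((suc e , r) ∷ lab) E′
  labelled-step p with p ≟ e
  ... | yes refl = trans (flip-after f) (sym (cong is-just (label-same e r lab)))
  ... | no p≢e   = trans (flip-elsewhere f p≢e) (trans (ok p) (sym (cong is-just (label-other r lab p≢e))))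

  extends-step : Extends r lab ((suc e , r) ∷ lab)
  extends-step = record { kept = kept′ ; new = new′ }
    where
    kept′ : ∀ p l → label lab p ≡ just l → label ((suc e , r) ∷ lab) p ≡ just l
    kept′ p l eq with p ≟ e
    ... | no p≢e = trans (label-other r lab p≢e) eq
    ... | yes refl with trans (sym eq) unlabelled
    ...   | ()
    new′ : ∀ p → label lab p ≡ nothing → label ((suc e , r) ∷ lab) p ≡ nothing ⊎ ∃ λ l → r ≤ l × label ((suc e , r) ∷ lab) p ≡ just l
    new′ p eq with p ≟ e
    ... | no p≢e = inj₁ (trans (label-other r lab p≢e) eq)
    ... | yes refl = inj₂ (r , ≤-refl , label-same e r lab)

atMost-step : ∀ {r lab} e → AtMost r lab → AtMost r ((suc e , r) ∷ lab)
atMost-step {r} {lab} e am p l eq with p ≟ e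
... | yes refl = ≤-reflexive (just-injective (trans (sym eq) (label-same e r lab)))
... | no p≢e   = am p l (trans (sym (label-other r lab p≢e)) eq)

Link : List ℕ → ℕ → List Bool → List Bool → Set
Link w m U V = ∃ λ q → final q (usedKinds m w U) ≡ q × served q (usedKinds m w U) ≡ V

-- The invariant between two bully paths: from row `r` down, the used entries of each row are the
-- departures of a stationary queue fed by the used entries of the row before, and `av` lists what
-- remains. The paths themselves are not recorded.
data Chain (w : List ℕ) (av : Avail) : ℕ → ℕ → List Bool → List Bool → Set where
  end  : ∀ {r U} → Chain w av 0 r U U
  link : ∀ {k r U V E} → Link w r U V → av (suc r) ≡ positions 1 (available (suc r) w V) →
         Chain w av k (suc r) V E → Chain w av (suc k) r U E

chain-cong : ∀ {w av av′ k r U E} → (∀ m → r < m → av′ m ≡ av m) → Chain w av k r U E → Chain w av′ k r U E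
chain-cong eq end = end
chain-cong {r = r} eq (link l a ch) = link l (trans (eq (suc r) ≤-refl) a) (chain-cong (λ m p → eq m (<-trans (n<1+n r) p)) ch)

-- One more used entry in a row is one more arrival. By `bully-step` it makes exactly one more entry
-- of the next row used, namely the bullied one, and this is the new arrival one level down.
path-spec : ∀ {w} k r {p av U U′ E} → (∀ m → r ≤ m → m < r + k → countOcc m w < countOcc (suc m) w) →
  Row r w U → Take r p w U U′ → Chain w av k r U E →
  ∃₂ λ e av′ → ∃ λ E′ → path k r (suc p) av ≡ (just (suc e) , av′) × Chain w av′ k r U′ E′
    × Take (r + k) e w E E′ × (∀ m → m ≤ r → av′ m ≡ av m)
path-spec {w} zero r {p} {av} {U} {U′} lt ρ t end =
  p , av , U′ , refl , end , subst (λ r → Take r p w U U′) (sym (+-identityʳ r)) t , λ m _ → refl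
path-spec {w} (suc k) r {p} {av} {U} {U′} {E} lt ρ t (link {V = V} (q , st , refl) a ch)
  with bully-step q (take-arrive t) st (some-unserved q ρ (lt r ≤-refl (m<m+n r (s≤s z≤n))) st)
... | q′ , p′ , st′ , f , u , b
  with path-spec {w} k (suc r) {p′} {av₁} {V} {V′} {E} (λ m r<m m< → lt m (<⇒≤ r<m) (subst (m <_) (sym (+-suc r k)) m<))
         (served-row q ρ) t′ (chain-cong above ch)
  where
  ρ′ = take-row t ρ
  V′ = served q′ (usedKinds r w U′)
  av₁ = upd av (suc r) (remove (suc p′) (av (suc r)))
  t′ : Take (suc r) p′ w V V′
  t′ = flip-take ρ ρ′ f
  above : ∀ m → suc r < m → av₁ m ≡ av m
  above m lt′ = upd-other av (suc r) _ (≢-sym (<⇒≢ lt′))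
... | e , av′ , E′ , eq , ch′ , te , below =
  e , av′ , E′ , trans (path-step k r (suc p) av b′) eq
  , link (q′ , st′ , refl) a′ ch′ , subst (λ r → Take r e w E E′) (sym (+-suc r k)) te
  , λ m m≤r → trans (below m (m≤n⇒m≤1+n m≤r)) (upd-other av (suc r) _ (<⇒≢ (s≤s m≤r)))
  where
  ρ′ = take-row t ρ
  b′ : bully (suc p) (av (suc r)) ≡ just (suc p′)
  b′ = trans (cong (bully (suc p)) (trans a (cong (positions 1) (unserved-available q ρ)))) b
  a′ : av′ (suc r) ≡ positions 1 (available (suc r) w (served q′ (usedKinds r w U′)))
  a′ = trans (below (suc r) ≤-refl) (trans (upd-same av (suc r) _)
    (trans (cong (remove (suc p′)) (trans a (cong (positions 1) (unserved-available q ρ))))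
    (trans (remove-flip 1 u) (cong (positions 1) (sym (unserved-available q′ ρ′))))))

take-first : ∀ {r w U x xs} k → Row r w U → positions k (available r w U) ≡ x ∷ xs →
  ∃₂ λ p U′ → x ≡ k + p × Take r p w U U′ × positions k (available r w U′) ≡ xs
take-first {r} k (own {w} {U} false ρ) eq rewrite ≡ᵇ-refl r with eq
... | refl = 0 , true ∷ U , sym (+-identityʳ k) , here , lemma
  where
  lemma : positions k (available r (r ∷ w) (true ∷ U)) ≡ positions (suc k) (available r w U)
  lemma rewrite ≡ᵇ-refl r = refl
take-first {r} k (own true ρ) eq rewrite ≡ᵇ-refl r with take-first (suc k) ρ eq
... | p , U′ , e , t , e′ = suc p , true ∷ U′ , trans e (sym (+-suc k p)) , there t , lemma U′ e′
  where
  lemma : ∀ {w xs} U′ → positions (suc k) (available r w U′) ≡ xs → positions k (available r (r ∷ w) (true ∷ U′)) ≡ xs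
  lemma U′ e rewrite ≡ᵇ-refl r = e
take-first {r} k (other {c} c≢r ρ) eq rewrite ≢⇒≡ᵇ-false c≢r with take-first (suc k) ρ eq
... | p , U′ , e , t , e′ = suc p , false ∷ U′ , trans e (sym (+-suc k p)) , there t , lemma U′ e′
  where
  lemma : ∀ {w xs} U′ → positions (suc k) (available r w U′) ≡ xs → positions k (available r (c ∷ w) (false ∷ U′)) ≡ xs
  lemma U′ e rewrite ≢⇒≡ᵇ-false c≢r = e

startAll-spec : ∀ {w n} k r xs {lab av U E} → r + k ≡ n → (∀ m → r ≤ m → m < n → countOcc m w < countOcc (suc m) w) →
  av r ≡ xs → positions 1 (available r w U) ≡ xs → Row r w U → Chain w av k r U E → Labelled lab E → AtMost r lab →
  ∃₂ λ lab′ av′ → ∃₂ λ U′ E′ → startAll n r xs (lab , av) ≡ (lab′ , av′) × positions 1 (available r w U′) ≡ []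
    × Row r w U′ × Chain w av′ k r U′ E′ × Labelled lab′ E′ × AtMost r lab′ × Extends r lab lab′
startAll-spec k r [] {lab} {av} {U} {E} _ _ _ eq ρ ch ok am = lab , av , U , E , refl , eq , ρ , ch , ok , am , extends-refl
startAll-spec {w} k r (x ∷ xs) {lab} {av} {U} {E} refl lt eav eq ρ ch ok am with take-first 1 ρ eq
... | p , U′ , refl , t , eq′
  with path-spec k r {p} {upd av r (remove (suc p) (av r))} lt ρ t
         (chain-cong (λ m r<m → upd-other av r _ (≢-sym (<⇒≢ r<m))) ch)
... | e , av′ , E′ , path≡ , ch′ , te , below
  with startAll-spec {w} k r xs {(suc e , r) ∷ lab} {av′} {U′} {E′} refl lt av′r eq′ (take-row t ρ) ch′
         (labelled-step {lab} r (take-flip te) ok) (atMost-step {r} {lab} e am)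
  where
  av′r : av′ r ≡ xs
  av′r = trans (below r ≤-refl) (trans (upd-same av r _) (trans (cong (remove (suc p)) (trans eav (sym eq)))
           (trans (remove-flip 1 (take-available t)) eq′)))
... | lab″ , av″ , U″ , E″ , start≡ , none , ρ″ , ch″ , ok″ , am″ , ext =
  lab″ , av″ , U″ , E″ , trans (startAll-step (r + k) r (suc p) xs lab av mem path′) start≡ , none , ρ″ , ch″ , ok″ , am″
  , extends-trans ≤-refl (extends-step {lab} r (take-flip te) ok) ext
  where
  mem : member (suc p) (av r) ≡ true
  mem rewrite eav | ≡ᵇ-refl p = refl
  path′ : path (r + k ∸ r) r (suc p) (upd av r (remove (suc p) (av r))) ≡ (just (suc e) , av′)
  path′ = trans (cong (λ d → path d r (suc p) (upd av r (remove (suc p) (av r)))) (m+n∸m≡n r k)) path≡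

row-full : ∀ {r w U} k → Row r w U → positions k (available r w U) ≡ [] → U ≡ mask r w
row-full k [] eq = refl
row-full {r} k (own true ρ) eq rewrite ≡ᵇ-refl r = cong (true ∷_) (row-full (suc k) ρ eq)
row-full {r} k (own false ρ) eq rewrite ≡ᵇ-refl r with eq
... | ()
row-full k (other c≢r ρ) eq rewrite ≢⇒≡ᵇ-false c≢r = cong (false ∷_) (row-full (suc k) ρ eq)

usedKinds-mask : ∀ {r w v} → Agree (suc r) w v → usedKinds r w (mask r v) ≡ kinds r v
usedKinds-mask [] = refl
usedKinds-mask {r} (_∷_ {x = c} {y = x} p ps) = cong₂ _∷_ (sameKind p) (usedKinds-mask ps)
  where
  sameKind : c ≡ x ⊎ (c < suc r × x < suc r) → usedKind r c (x ≡ᵇ r) ≡ kind r (suc r) x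
  sameKind (inj₁ refl) with view r (suc r) x
  ... | isArr rewrite ≢⇒≡ᵇ-false (k≢1+k {r}) | ≡ᵇ-refl r = refl
  ... | isSrv rewrite ≡ᵇ-refl r | ≢⇒≡ᵇ-false (1+n≢n {r}) = refl
  ... | isOth p q rewrite ≢⇒≡ᵇ-false p | ≢⇒≡ᵇ-false q = refl
  sameKind (inj₂ (c< , x<)) rewrite ≢⇒≡ᵇ-false (<⇒≢ c<) | ≢⇒≡ᵇ-false (<⇒≢ x<) = refl

agree-weaken : ∀ {j w v} → Agree j w v → Agree (suc j) w v
agree-weaken [] = []
agree-weaken (inj₁ p ∷ ps)        = inj₁ p ∷ agree-weaken ps
agree-weaken (inj₂ (p , q) ∷ ps) = inj₂ (m≤n⇒m≤1+n p , m≤n⇒m≤1+n q) ∷ agree-weaken ps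

agree-count : ∀ {j n u v} → j ≤ n → Agree j u v → countOcc n u ≡ countOcc n v
agree-count {n = n} {u} {v} j≤n ps = trans (count-mask n u) (trans (cong trues (agree-mask j≤n ps)) (sym (count-mask n v)))

range : ℕ → ℕ → List ℕ
range r zero    = []
range r (suc k) = r ∷ range (suc r) k

module _ {w : List ℕ} {n : ℕ} (content : ∀ m → 1 ≤ m → m ≤ n → countOcc m w ≡ m) where

  counts-increase : ∀ m → 1 ≤ m → m < n → countOcc m w < countOcc (suc m) w
  counts-increase m 1≤m m<n = subst₂ _<_ (sym (content m 1≤m (<⇒≤ m<n))) (sym (content (suc m) (s≤s z≤n) m<n)) ≤-refl

  -- When row `r` is completely used, the chain is determined: at each link uniqueness of the
  -- stationary state identifies the used entries with the departures marked by `swap`. The word `v`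
  -- has passed through the earlier queues and differs from `w` only among letters up to `r`.
  chain-descend : ∀ {av} k r v {E} → r + k ≤ n → Agree (suc r) w v → countOcc r v ≤ r →
    Chain w av k r (mask r v) E → E ≡ mask (r + k) (descend k r v)
  chain-descend zero r v r+k≤n ag lt end = cong (λ m → mask m v) (sym (+-identityʳ r))
  chain-descend (suc k) r v r+k≤n ag lt (link (q , st , refl) _ ch) rewrite +-suc r k =
    chain-descend k (suc r) (swap r v) r+k≤n
      (agree-trans (agree-weaken ag) (relabel-agree _ v ≤-refl))
      (≤-trans (≤-reflexive (count-relabel-srv k≢1+k _ v (swap-stationary v v-lt))) (m≤n⇒m≤1+n lt))
      (subst (λ V → Chain w _ k (suc r) V _) served≡ ch)
    where
    v-lt : countOcc r v < countOcc (suc r) v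
    v-lt = subst (countOcc r v <_) (trans (sym (content (suc r) (s≤s z≤n) (≤-trans (s≤s (m≤m+n r k)) r+k≤n))) (agree-count ≤-refl ag)) (s≤s lt)
    q≡ : q ≡ final 0 (kinds r v)
    q≡ = swap-unique v q v-lt (trans (cong (final q) (sym (usedKinds-mask ag))) st)
    served≡ : served q (usedKinds r w (mask r v)) ≡ mask (suc r) (swap r v)
    served≡ = trans (cong₂ served q≡ (usedKinds-mask ag)) (sym (mask-relabel k≢1+k _ v))

  departureMask : ℕ → List Bool
  departureMask j = mask n (descend (n ∸ j) j w)

  Splits : ℕ → Labels → Set
  Splits j lab = ∀ p → (bitAt (departureMask j) p ≡ true × ∃ λ l → l ≤ j × label lab p ≡ just l)
                     ⊎ (bitAt (departureMask j) p ≡ false × (label lab p ≡ nothing ⊎ ∃ λ l → j < l × label lab p ≡ just l))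

  -- At the end of phase `j` the labelled endpoints are the departures from row `j`, all with labels
  -- at most `j`. Later phases keep these labels and give only larger ones.
  splits : ∀ j {lab lab′ E} → E ≡ departureMask j → Labelled lab E → AtMost j lab → Extends (suc j) lab lab′ → Splits j lab′
  splits j {lab} refl ok am ext p with label lab p in eq | ok p
  ... | just l  | b = inj₁ (b , l , am p l eq , Extends.kept ext p l eq)
  ... | nothing | b = inj₂ (b , Extends.new ext p eq)

  -- The entries of row `suc r` used at the end of phase `r` are those with which phase `suc r`
  -- starts, so the tail of the chain is handed on.
  phases-spec : ∀ k r {lab av U E} → 1 ≤ r → r + k ≡ n → av r ≡ positions 1 (available r w U) →
    Row r w U → Chain w av k r U E → Labelled lab E → AtMost (pred r) lab →
    ∃₂ λ lab′ av′ → ∃ λ E′ → phases n (range r k) (lab , av) ≡ (lab′ , av′)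
      × av′ n ≡ positions 1 (available n w E′) × Row n w E′ × Labelled lab′ E′ × Extends r lab lab′ × AtMost (pred n) lab′
      × (∀ j → r ≤ j → j < n → Splits j lab′)
  phases-spec zero r {lab} {av} {U} 1≤r r+k≡n eav ρ end ok am with trans (sym (+-identityʳ r)) r+k≡n
  ... | refl = lab , av , U , refl , eav , ρ , ok , extends-refl , am , λ j r≤j j<r → ⊥-elim (<⇒≱ j<r r≤j)
  phases-spec (suc k) r {lab} {av} 1≤r refl eav ρ ch ok am
    with startAll-spec (suc k) r (av r) {lab} {av} refl (λ m r≤m → counts-increase m (≤-trans 1≤r r≤m)) refl (sym eav) ρ ch ok
           (λ p l eq → ≤-trans (am p l eq) pred[n]≤n)
  ... | lab₁ , av₁ , U₁ , E₁ , start≡ , none , ρ₁ , ch₁@(link {V = V} (q , st , refl) a₁ tail₁) , ok₁ , am₁ , ext₁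
    with phases-spec k (suc r) {lab₁} {av₁} {V} {E₁} (s≤s z≤n) (sym (+-suc r k)) a₁ (served-row q ρ₁) tail₁ ok₁ am₁
  ... | lab₂ , av₂ , E₂ , phases≡ , a₂ , ρ₂ , ok₂ , ext₂ , am₂ , sp =
    lab₂ , av₂ , E₂ , trans (cong (phases (r + suc k) (range (suc r) k)) start≡) phases≡ , a₂ , ρ₂ , ok₂
    , extends-trans (n≤1+n r) ext₁ ext₂ , am₂ , sp′
    where
    E₁≡ : E₁ ≡ departureMask r
    E₁≡ = trans (chain-descend (suc k) r w ≤-refl (agree-refl w) (≤-reflexive (content r 1≤r (m≤m+n r (suc k))))
            (subst (λ U → Chain w av₁ (suc k) r U E₁) (row-full 1 ρ₁ none) ch₁))
          (cong (λ d → mask (r + suc k) (descend d r w)) (sym (m+n∸m≡n r (suc k))))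
    sp′ : ∀ j → r ≤ j → j < r + suc k → Splits j lab₂
    sp′ j r≤j j<n with m≤n⇒m<n∨m≡n r≤j
    ... | inj₁ r<j  = sp j r<j j<n
    ... | inj₂ refl = splits r {lab₁} {lab₂} E₁≡ ok₁ am₁ ext₂

-- The projected word in terms of departures

applyUpTo-range : ∀ r m (f : ℕ → ℕ) → (∀ x → suc (f x) ≡ r + x) → map suc (applyUpTo f m) ≡ range r m
applyUpTo-range r zero    f eq = refl
applyUpTo-range r (suc m) f eq = cong₂ _∷_ (trans (eq 0) (+-identityʳ r))
  (applyUpTo-range (suc r) m (f ∘ suc) (λ x → trans (eq (suc x)) (+-suc r x)))

oneTo-range : ∀ m → oneTo m ≡ range 1 m
oneTo-range m = applyUpTo-range 1 m id (λ x → refl)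

rowOf-positions : ∀ w r → rowOf w r ≡ positions 1 (mask r w)
rowOf-positions w r = trans (cong (λ l → map proj₁ (bfilter (λ p → proj₂ p ≡ᵇ r) (zip l w))) (oneTo-range (length w))) (go 1 w)
  where
  go : ∀ k w → map proj₁ (bfilter (λ p → proj₂ p ≡ᵇ r) (zip (range k (length w)) w)) ≡ positions k (mask r w)
  go k [] = refl
  go k (c ∷ w) with c ≡ᵇ r
  ... | true  = cong (k ∷_) (go (suc k) w)
  ... | false = go (suc k) w

select : List Bool → List Bool → List Bool
select (true ∷ B)  (d ∷ D) = d ∷ select B D
select (false ∷ B) (d ∷ D) = select B D
select _           _       = []

map-positions : ∀ (g : ℕ → Bool) k B D → length B ≡ length D →
  (∀ p → bitAt B p ≡ true → g (k + p) ≡ bitAt D p) → map g (positions k B) ≡ select B D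
map-positions g k []          []      len eq = refl
map-positions g k (true ∷ B)  (d ∷ D) len eq = cong₂ _∷_ (trans (cong g (sym (+-identityʳ k))) (eq 0 refl))
  (map-positions g (suc k) B D (suc-injective len) (λ p b → trans (cong g (sym (+-suc k p))) (eq (suc p) b)))
map-positions g k (false ∷ B) (d ∷ D) len eq =
  map-positions g (suc k) B D (suc-injective len) (λ p b → trans (cong g (sym (+-suc k p))) (eq (suc p) b))

member-positions : ∀ k B p → bitAt B p ≡ true → member (k + p) (positions k B) ≡ true
member-positions k (true ∷ B) zero b rewrite +-identityʳ k | ≡ᵇ-refl k = refl
member-positions k (true ∷ B) (suc p) b rewrite +-suc k p | member-positions (suc k) B p b = ∨-zeroʳ _
member-positions k (false ∷ B) (suc p) b rewrite +-suc k p = member-positions (suc k) B p b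

row-available : ∀ {n w E} p → Row n w E → bitAt (mask n w) p ≡ true → bitAt E p ≡ false → bitAt (available n w E) p ≡ true
row-available {n} zero (own .false ρ) b refl rewrite ≡ᵇ-refl n = refl
row-available zero (other c≢n ρ) b e rewrite ≢⇒≡ᵇ-false c≢n with b
... | ()
row-available (suc p) (own _ ρ) b e = row-available p ρ b e
row-available (suc p) (other _ ρ) b e = row-available p ρ b e

length-descend : ∀ d k w → length (descend d k w) ≡ length w
length-descend zero    k w = refl
length-descend (suc d) k w = trans (length-descend d (suc k) (swap k w)) (length-relabel k (suc k) _ w)

none : List ℕ → List Bool
none = map (λ _ → false)

row-none : ∀ m w → Row m w (none w)
row-none m [] = []
row-none m (c ∷ w) with c ≟ m
... | yes refl = own false (row-none m w)
... | no c≢m   = other c≢m (row-none m w)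

available-none : ∀ m w → available m w (none w) ≡ mask m w
available-none m [] = refl
available-none m (c ∷ w) with c ≡ᵇ m
... | true  = cong (true ∷_) (available-none m w)
... | false = cong (false ∷_) (available-none m w)

link-none : ∀ m w → Link w m (none w) (none w)
link-none m w = 0 , proj₁ (go w) , proj₂ (go w)
  where
  go : ∀ w → final 0 (usedKinds m w (none w)) ≡ 0 × served 0 (usedKinds m w (none w)) ≡ none w
  go [] = refl , refl
  go (c ∷ w) with c ≡ᵇ suc m
  ... | true  = proj₁ (go w) , cong (false ∷_) (proj₂ (go w))
  ... | false = proj₁ (go w) , cong (false ∷_) (proj₂ (go w))

chain-none : ∀ w k r → Chain w (rowOf w) k r (none w) (none w)
chain-none w zero    r = end
chain-none w (suc k) r = link (link-none r w)
  (trans (rowOf-positions w (suc r)) (cong (positions 1) (sym (available-none (suc r) w)))) (chain-none w k (suc r))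

bitAt-none : ∀ w p → bitAt (none w) p ≡ false
bitAt-none []      p       = refl
bitAt-none (c ∷ w) zero    = refl
bitAt-none (c ∷ w) (suc p) = bitAt-none w p

≤ᵇ-true : ∀ {m n} → m ≤ n → (m ≤ᵇ n) ≡ true
≤ᵇ-true {m} {n} p with m ≤ᵇ n | ≤⇒≤ᵇ p
... | true | _ = refl

≤ᵇ-false : ∀ {m n} → n < m → (m ≤ᵇ n) ≡ false
≤ᵇ-false {m} {n} p with m ≤ᵇ n in eq
... | false = refl
... | true  = ⊥-elim (<⇒≱ p (≤ᵇ⇒≤ m n (subst IsTrue (sym eq) _)))

all-positions : ∀ {P : ℕ → Set} k B → (∀ p → bitAt B p ≡ true → P (k + p)) → All P (positions k B)
all-positions     k []          ps = []
all-positions {P} k (true ∷ B)  ps = subst P (+-identityʳ k) (ps 0 refl) ∷ all-positions (suc k) B (λ p b → subst P (+-suc k p) (ps (suc p) b))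
all-positions {P} k (false ∷ B) ps = all-positions (suc k) B (λ p b → subst P (+-suc k p) (ps (suc p) b))

module _ {w : List ℕ} {n₀ : ℕ} (content : ∀ m → 1 ≤ m → m ≤ suc n₀ → countOcc m w ≡ m) where

  private
    n = suc n₀

  projWord-labels : ∃ λ labelOf → projWord n w ≡ map labelOf (positions 1 (mask n w))
    × (∀ p → bitAt (mask n w) p ≡ true → 1 ≤ labelOf (suc p) × labelOf (suc p) ≤ n)
    × (∀ j → 1 ≤ j → j < n → ∀ p → bitAt (mask n w) p ≡ true → (labelOf (suc p) ≤ᵇ j) ≡ bitAt (mask n (descend (n ∸ j) j w)) p)
  projWord-labels
    with phases-spec content n₀ 1 {[]} {rowOf w} ≤-refl refl
           (trans (rowOf-positions w 1) (cong (positions 1) (sym (available-none 1 w))))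
           (row-none 1 w) (chain-none w n₀ 1) (bitAt-none w) (λ p l ())
  ... | lab , av , E , phases≡ , a , ρ , ok , ext , am , sp = labelOf , proj≡ , range-of , agrees
    where
    labelOf′ : Labels × Avail → ℕ → ℕ
    labelOf′ st e = maybe (λ l → l) (if member e (proj₂ st n) then n else 0) (lookupLab e (proj₁ st))
    labelOf = labelOf′ (lab , av)
    proj≡ : projWord n w ≡ map labelOf (positions 1 (mask n w))
    proj≡ = cong₂ (λ st l → map (labelOf′ st) l)
      (trans (cong (λ rs → phases n rs ([] , rowOf w)) (oneTo-range n₀)) phases≡) (rowOf-positions w n)
    -- An entry of the last row without a label is still available, so it receives the label `n` and
    -- not the default 0.
    unlabelled : ∀ p → bitAt (mask n w) p ≡ true → label lab p ≡ nothing → labelOf (suc p) ≡ n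
    unlabelled p b eq rewrite eq | a
      | member-positions 1 (available n w E) p (row-available p ρ b (trans (ok p) (cong is-just eq))) = refl
    labelled : ∀ p {l} → label lab p ≡ just l → labelOf (suc p) ≡ l
    labelled p eq rewrite eq = refl
    range-of : ∀ p → bitAt (mask n w) p ≡ true → 1 ≤ labelOf (suc p) × labelOf (suc p) ≤ n
    range-of p b with Extends.new ext p refl
    ... | inj₁ eq rewrite unlabelled p b eq = s≤s z≤n , ≤-refl
    ... | inj₂ (l , 1≤l , eq) rewrite labelled p eq = 1≤l , m≤n⇒m≤1+n (am p l eq)
    agrees : ∀ j → 1 ≤ j → j < n → ∀ p → bitAt (mask n w) p ≡ true → (labelOf (suc p) ≤ᵇ j) ≡ bitAt (mask n (descend (n ∸ j) j w)) p
    agrees j 1≤j j<n p b with sp j 1≤j j<n p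
    ... | inj₁ (d , l , l≤j , eq) = trans (cong (_≤ᵇ j) (labelled p eq)) (trans (≤ᵇ-true l≤j) (sym d))
    ... | inj₂ (d , inj₂ (l , j<l , eq)) = trans (cong (_≤ᵇ j) (labelled p eq)) (trans (≤ᵇ-false j<l) (sym d))
    ... | inj₂ (d , inj₁ eq) = trans (cong (_≤ᵇ j) (unlabelled p b eq)) (trans (≤ᵇ-false j<n) (sym d))

  projWord-range : All (λ l → 1 ≤ l × l ≤ n) (projWord n w)
  projWord-range = let labelOf , proj≡ , bounds , _ = projWord-labels in
    subst (All _) (sym proj≡) (All.map⁺ (all-positions 1 (mask n w) bounds))

  -- The letters at most j of the projected word are the departures from row j.
  projWord-departures : ∀ j → 1 ≤ j → j < n → map (_≤ᵇ j) (projWord n w) ≡ select (mask n w) (mask n (descend (n ∸ j) j w))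
  projWord-departures j 1≤j j<n = let labelOf , proj≡ , _ , agrees = projWord-labels in
    trans (cong (map (_≤ᵇ j)) proj≡) (trans (sym (map-∘ (positions 1 (mask n w))))
      (map-positions _ 1 (mask n w) _ lengths (agrees j 1≤j j<n)))
    where
    lengths : length (mask n w) ≡ length (mask n (descend (n ∸ j) j w))
    lengths = trans (length-map _ w) (sym (trans (length-map _ (descend (n ∸ j) j w)) (length-descend (n ∸ j) j w)))

-- Words in three letters

-- Removing a letter from a word lowers its multiplicity by one and is impossible if the
-- multiplicity is 0; the value 0 stands for the empty sum.
below : ℕ → (ℕ → ℕ) → ℕ
below zero    f = 0
below (suc k) f = f k

-- Sum of Ψ over the words of length N with x letters X, y letters Y and z letters Z.
∑W : ℕ → ℕ → ℕ → ℕ → (List Letter → ℕ) → ℕ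
∑W zero    zero    zero    zero    Ψ = Ψ []
∑W zero    zero    zero    (suc _) Ψ = 0
∑W zero    zero    (suc _) _       Ψ = 0
∑W zero    (suc _) _       _       Ψ = 0
∑W (suc N) x y z Ψ = below x (λ x′ → ∑W N x′ y z (Ψ ∘ (X ∷_)))
                   + below y (λ y′ → ∑W N x y′ z (Ψ ∘ (Y ∷_)))
                   + below z (λ z′ → ∑W N x y z′ (Ψ ∘ (Z ∷_)))

data Shuffle : ℕ → ℕ → ℕ → ℕ → List Letter → Set where
  []  : Shuffle 0 0 0 0 []
  X∷_ : ∀ {N x y z w} → Shuffle N x y z w → Shuffle (suc N) (suc x) y z (X ∷ w)
  Y∷_ : ∀ {N x y z w} → Shuffle N x y z w → Shuffle (suc N) x (suc y) z (Y ∷ w)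
  Z∷_ : ∀ {N x y z w} → Shuffle N x y z w → Shuffle (suc N) x y (suc z) (Z ∷ w)

below-cong : ∀ k {f g : ℕ → ℕ} → (∀ j → k ≡ suc j → f j ≡ g j) → below k f ≡ below k g
below-cong zero    eq = refl
below-cong (suc k) eq = eq k refl

∑W-cong : ∀ N x y z {Ψ Ψ′ : List Letter → ℕ} → (∀ w → Shuffle N x y z w → Ψ w ≡ Ψ′ w) → ∑W N x y z Ψ ≡ ∑W N x y z Ψ′
∑W-cong zero    zero    zero    zero    eq = eq [] []
∑W-cong zero    zero    zero    (suc _) eq = refl
∑W-cong zero    zero    (suc _) _       eq = refl
∑W-cong zero    (suc _) _       _       eq = refl
∑W-cong (suc N) x y z eq = cong₂ _+_ (cong₂ _+_
  (below-cong x (λ { x′ refl → ∑W-cong N x′ y z (λ w s → eq (X ∷ w) (X∷ s)) }))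
  (below-cong y (λ { y′ refl → ∑W-cong N x y′ z (λ w s → eq (Y ∷ w) (Y∷ s)) })))
  (below-cong z (λ { z′ refl → ∑W-cong N x y z′ (λ w s → eq (Z ∷ w) (Z∷ s)) }))

below-+ : ∀ k (f g h : ℕ → ℕ) → below k (λ j → f j + g j + h j) ≡ below k f + below k g + below k h
below-+ zero    f g h = refl
below-+ (suc k) f g h = refl

below-comm : ∀ k l (F : ℕ → ℕ → ℕ) → below k (λ i → below l (λ j → F i j)) ≡ below l (λ j → below k (λ i → F i j))
below-comm zero    zero    F = refl
below-comm zero    (suc l) F = refl
below-comm (suc k) zero    F = refl
below-comm (suc k) (suc l) F = refl

-- Splitting off the first letter and splitting off the last letter commute, so the nine sums over
-- first and last letters can be regrouped.
∑W-snoc : ∀ N x y z Ψ → ∑W (suc N) x y z Ψ ≡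
    below x (λ x′ → ∑W N x′ y z (λ w → Ψ (w ++ [ X ])))
  + below y (λ y′ → ∑W N x y′ z (λ w → Ψ (w ++ [ Y ])))
  + below z (λ z′ → ∑W N x y z′ (λ w → Ψ (w ++ [ Z ])))
∑W-snoc zero x y z Ψ = cong₂ _+_ (cong₂ _+_
  (below-cong x (λ x′ _ → ∑W-cong 0 x′ y z (λ { _ [] → refl })))
  (below-cong y (λ y′ _ → ∑W-cong 0 x y′ z (λ { _ [] → refl }))))
  (below-cong z (λ z′ _ → ∑W-cong 0 x y z′ (λ { _ [] → refl })))
∑W-snoc (suc N) x y z Ψ = begin
  below x (λ x′ → ∑W (suc N) x′ y z (Ψ ∘ (X ∷_))) + below y (λ y′ → ∑W (suc N) x y′ z (Ψ ∘ (Y ∷_)))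
    + below z (λ z′ → ∑W (suc N) x y z′ (Ψ ∘ (Z ∷_)))
    ≡⟨ cong₂ _+_ (cong₂ _+_
         (trans (below-cong x (λ x′ _ → ∑W-snoc N x′ y z (Ψ ∘ (X ∷_)))) (below-+ x _ _ _))
         (trans (below-cong y (λ y′ _ → ∑W-snoc N x y′ z (Ψ ∘ (Y ∷_)))) (below-+ y _ _ _)))
         (trans (below-cong z (λ z′ _ → ∑W-snoc N x y z′ (Ψ ∘ (Z ∷_)))) (below-+ z _ _ _)) ⟩
  (xx + below x (λ x′ → below y (λ y′ → xy x′ y′)) + below x (λ x′ → below z (λ z′ → xz x′ z′)))
    + (below y (λ y′ → below x (λ x′ → yx y′ x′)) + yy + below y (λ y′ → below z (λ z′ → yz y′ z′)))
    + (below z (λ z′ → below x (λ x′ → zx z′ x′)) + below z (λ z′ → below y (λ y′ → zy z′ y′)) + zz)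
    ≡⟨ cong₂ _+_ (cong₂ _+_
         (cong₂ _+_ (cong (xx +_) (below-comm x y xy)) (below-comm x z xz))
         (cong₂ _+_ (cong (_+ yy) (below-comm y x yx)) (below-comm y z yz)))
         (cong (_+ zz) (cong₂ _+_ (below-comm z x zx) (below-comm z y zy))) ⟩
  (xx + XY + XZ) + (YX + yy + YZ) + (ZX + ZY + zz)
    ≡⟨ solve 9 (λ a b c d e f g h i → (a :+ b :+ c) :+ (d :+ e :+ f) :+ (g :+ h :+ i)
         := (a :+ d :+ g) :+ (b :+ e :+ h) :+ (c :+ f :+ i)) refl xx XY XZ YX yy YZ ZX ZY zz ⟩
  (xx + YX + ZX) + (XY + yy + ZY) + (XZ + YZ + zz)
    ≡⟨ sym (cong₂ _+_ (cong₂ _+_ (below-+ x _ _ _) (below-+ y _ _ _)) (below-+ z _ _ _)) ⟩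
  below x (λ x′ → ∑W (suc N) x′ y z (λ w → Ψ (w ++ [ X ])))
    + below y (λ y′ → ∑W (suc N) x y′ z (λ w → Ψ (w ++ [ Y ])))
    + below z (λ z′ → ∑W (suc N) x y z′ (λ w → Ψ (w ++ [ Z ]))) ∎
  where
  open ≡-Reasoning
  open +-*-Solver
  xx = below x (λ x′ → below x′ (λ x″ → ∑W N x″ y z (λ w → Ψ (X ∷ w ++ [ X ]))))
  yy = below y (λ y′ → below y′ (λ y″ → ∑W N x y″ z (λ w → Ψ (Y ∷ w ++ [ Y ]))))
  zz = below z (λ z′ → below z′ (λ z″ → ∑W N x y z″ (λ w → Ψ (Z ∷ w ++ [ Z ]))))
  xy xz yx yz zx zy : ℕ → ℕ → ℕ
  xy x′ y′ = ∑W N x′ y′ z (λ w → Ψ (X ∷ w ++ [ Y ]))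
  xz x′ z′ = ∑W N x′ y z′ (λ w → Ψ (X ∷ w ++ [ Z ]))
  yx y′ x′ = ∑W N x′ y′ z (λ w → Ψ (Y ∷ w ++ [ X ]))
  yz y′ z′ = ∑W N x y′ z′ (λ w → Ψ (Y ∷ w ++ [ Z ]))
  zx z′ x′ = ∑W N x′ y z′ (λ w → Ψ (Z ∷ w ++ [ X ]))
  zy z′ y′ = ∑W N x y′ z′ (λ w → Ψ (Z ∷ w ++ [ Y ]))
  XY = below y (λ y′ → below x (λ x′ → xy x′ y′))
  XZ = below z (λ z′ → below x (λ x′ → xz x′ z′))
  YX = below x (λ x′ → below y (λ y′ → yx y′ x′))
  YZ = below z (λ z′ → below y (λ y′ → yz y′ z′))
  ZX = below x (λ x′ → below z (λ z′ → zx z′ x′))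
  ZY = below y (λ y′ → below z (λ z′ → zy z′ y′))

rotate : List Letter → List Letter
rotate []      = []
rotate (c ∷ w) = w ++ [ c ]

∑W-rotate : ∀ N x y z Ψ → ∑W N x y z (Ψ ∘ rotate) ≡ ∑W N x y z Ψ
∑W-rotate zero    x y z Ψ = ∑W-cong 0 x y z (λ { _ [] → refl })
∑W-rotate (suc N) x y z Ψ = sym (∑W-snoc N x y z Ψ)

-- Two queues in series, the second with two priority classes

record State : Set where
  constructor state
  field
    waiting first second : ℕ
    flag : Bool
open State public

-- X: a customer joins the first queue.  Y: a first-class customer passes to the second queue, or else a second-class customer
-- is created there.  Z: a service of the second queue; the flag remembers whether it served a first-class customer
-- (or, if the parameter is false, any customer).
step : Bool → Letter → State → State
step t X (state e f s m)             = state (suc e) f s m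
step t Y (state zero f s m)          = state zero f (suc s) m
step t Y (state (suc e) f s m)       = state e (suc f) s m
step t Z (state e zero s m)          = state e zero (pred s) (if t then false else positive s)
step t Z (state e (suc f) s m)       = state e f s true
step t O σ                           = σ

run : Bool → State → List Letter → State
run t σ []      = σ
run t σ (c ∷ w) = run t (step t c σ) w

run-++ : ∀ t σ u v → run t σ (u ++ v) ≡ run t (run t σ u) v
run-++ t σ []      v = refl
run-++ t σ (c ∷ u) v = run-++ t (step t c σ) u v

start : State
start = state 0 0 0 false

count : Bool → (State → ℕ) → ℕ → ℕ → ℕ → ℕ → ℕ
count t P N x y z = ∑W N x y z (λ w → P (run t start w))

count-cong : ∀ t {P P′} N x y z → (∀ σ → P σ ≡ P′ σ) → count t P N x y z ≡ count t P′ N x y z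
count-cong t N x y z eq = ∑W-cong N x y z (λ w _ → eq (run t start w))

count-step : ∀ t P N x y z → count t P (suc N) x y z ≡
    below x (λ x′ → count t (P ∘ step t X) N x′ y z)
  + below y (λ y′ → count t (P ∘ step t Y) N x y′ z)
  + below z (λ z′ → count t (P ∘ step t Z) N x y z′)
count-step t P N x y z = trans (∑W-snoc N x y z (λ w → P (run t start w))) (cong₂ _+_ (cong₂ _+_
  (below-cong x (λ x′ _ → ∑W-cong N x′ y z (λ w _ → cong P (run-++ t start w [ X ]))))
  (below-cong y (λ y′ _ → ∑W-cong N x y′ z (λ w _ → cong P (run-++ t start w [ Y ])))))
  (below-cong z (λ z′ _ → ∑W-cong N x y z′ (λ w _ → cong P (run-++ t start w [ Z ])))))

below-zero : ∀ k {f : ℕ → ℕ} → (∀ j → f j ≡ 0) → below k f ≡ 0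
below-zero zero    p = refl
below-zero (suc k) p = p k

∑W-zero : ∀ N x y z → ∑W N x y z (λ _ → 0) ≡ 0
∑W-zero zero    zero    zero    zero    = refl
∑W-zero zero    zero    zero    (suc _) = refl
∑W-zero zero    zero    (suc _) _       = refl
∑W-zero zero    (suc _) _       _       = refl
∑W-zero (suc N) x y z = cong₂ _+_
  (cong₂ _+_ (below-zero x (λ k → ∑W-zero N k y z)) (below-zero y (λ k → ∑W-zero N x k z))) (below-zero z (λ k → ∑W-zero N x y k))

leq : ℕ → ℕ → Bool
leq zero    n       = true
leq (suc m) zero    = false
leq (suc m) (suc n) = leq m n

𝟙 : Bool → ℕ
𝟙 true  = 1
𝟙 false = 0

-- Undoing the last letter turns such a condition into another one with shifted `E` and `t`, or into
-- the empty condition, which makes induction on the last letter possible. Undoing Y under `exactly`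
-- raises `E`: a Y that meets an empty first queue would leave a second-class customer. At `t` zero
-- `exactly` and `atMost` coincide.
atMost exactly : ℕ → ℕ → State → ℕ
atMost  E t (state e f s m) = 𝟙 (leq E e ∧ leq (f + s) t)
exactly E t (state e f s m) = 𝟙 (leq E e ∧ ((f ≡ᵇ t) ∧ (s ≡ᵇ 0)))

module _ (τ : Bool) where

  atMost-X : ∀ E t σ → atMost (suc E) t (step τ X σ) ≡ atMost E t σ
  atMost-X E t (state e f s m) = refl

  atMost-X₀ : ∀ t σ → atMost 0 t (step τ X σ) ≡ atMost 0 t σ
  atMost-X₀ t (state e f s m) = refl

  atMost-Y : ∀ E t σ → atMost (suc E) (suc t) (step τ Y σ) ≡ atMost (suc (suc E)) t σ
  atMost-Y E t (state zero f s m)    = refl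
  atMost-Y E t (state (suc e) f s m) = refl

  atMost-Y₀ : ∀ t σ → atMost 0 (suc t) (step τ Y σ) ≡ atMost 0 t σ
  atMost-Y₀ t (state zero f s m) rewrite +-suc f s = refl
  atMost-Y₀ t (state (suc e) f s m) = refl

  atMost-Y-none : ∀ E σ → atMost E 0 (step τ Y σ) ≡ 0
  atMost-Y-none zero    (state zero f s m) rewrite +-suc f s = refl
  atMost-Y-none (suc E) (state zero f s m) = refl
  atMost-Y-none E (state (suc e) f s m) with leq E e
  ... | true  = refl
  ... | false = refl

  atMost-Z : ∀ E t σ → atMost E t (step τ Z σ) ≡ atMost E (suc t) σ
  atMost-Z E t (state e zero zero m)    = refl
  atMost-Z E t (state e zero (suc s) m) = refl
  atMost-Z E t (state e (suc f) s m)    = refl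

  exactly-X : ∀ E t σ → exactly (suc E) t (step τ X σ) ≡ exactly E t σ
  exactly-X E t (state e f s m) = refl

  exactly-X₀ : ∀ t σ → exactly 0 t (step τ X σ) ≡ exactly 0 t σ
  exactly-X₀ t (state e f s m) = refl

  exactly-Y : ∀ E t σ → exactly E (suc t) (step τ Y σ) ≡ exactly (suc E) t σ
  exactly-Y E t (state zero f s m) with leq E 0 | f ≡ᵇ suc t
  ... | true  | true  = refl
  ... | true  | false = refl
  ... | false | _     = refl
  exactly-Y E t (state (suc e) f s m) = refl

  exactly-Z : ∀ E t σ → exactly E (suc t) (step τ Z σ) ≡ exactly E (suc (suc t)) σ
  exactly-Z E t (state e zero s m)    = refl
  exactly-Z E t (state e (suc f) s m) = refl

  exactly-zero : ∀ E σ → exactly E 0 σ ≡ atMost E 0 σ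
  exactly-zero E (state e zero zero m)    = refl
  exactly-zero E (state e zero (suc s) m) = refl
  exactly-zero E (state e (suc f) s m)    = refl

-- Linear counts

module LinearCounts where

  open import Data.Integer using (ℤ; +_; -[1+_]; 0ℤ; 1ℤ)

  -- Coefficient of αᵃβᵇγᶜ in (α + β + γ)ᴺ, with c = N - a - b; it vanishes unless a, b, c ≥ 0.
  tri₀ : ℤ → ℤ → ℤ
  tri₀ (+ zero) (+ zero) = 1ℤ
  tri₀ _        _        = 0ℤ

  trinomial : ℕ → ℤ → ℤ → ℤ
  trinomial zero    a b = tri₀ a b
  trinomial (suc N) a b = trinomial N (ℤ.pred a) b ℤ.+ trinomial N a (ℤ.pred b) ℤ.+ trinomial N a b

  -- The integer x - k; unlike _⊖_ it computes by recursion on both arguments.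
  _⊝_ : ℕ → ℕ → ℤ
  x     ⊝ zero  = + x
  zero  ⊝ suc k = -[1+ k ]
  suc x ⊝ suc k = x ⊝ k

  pred-⊝ : ∀ x k → ℤ.pred (x ⊝ k) ≡ x ⊝ suc k
  pred-⊝ zero    zero    = refl
  pred-⊝ (suc x) zero    = refl
  pred-⊝ zero    (suc k) = refl
  pred-⊝ (suc x) (suc k) = pred-⊝ x k

  ⊝-negative : ∀ {x k} → x < k → ∃ λ j → x ⊝ k ≡ -[1+ j ]
  ⊝-negative {zero}  {suc k} _ = k , refl
  ⊝-negative {suc x} {suc k} p = ⊝-negative (s≤s⁻¹ p)

  trinomial-negˡ : ∀ N k b → trinomial N -[1+ k ] b ≡ 0ℤ
  trinomial-negˡ zero    k b = refl
  trinomial-negˡ (suc N) k b rewrite trinomial-negˡ N (suc k) b | trinomial-negˡ N k (ℤ.pred b) | trinomial-negˡ N k b = refl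

  trinomial-negʳ : ∀ N a k → trinomial N a -[1+ k ] ≡ 0ℤ
  trinomial-negʳ zero    (+ zero)  k = refl
  trinomial-negʳ zero    (+ suc _) k = refl
  trinomial-negʳ zero    -[1+ _ ]  k = refl
  trinomial-negʳ (suc N) a k rewrite trinomial-negʳ N (ℤ.pred a) k | trinomial-negʳ N a (suc k) | trinomial-negʳ N a k = refl

  trinomial-⊝ˡ : ∀ N {x k} b → x < k → trinomial N (x ⊝ k) b ≡ 0ℤ
  trinomial-⊝ˡ N b x<k with ⊝-negative x<k
  ... | j , eq rewrite eq = trinomial-negˡ N j b

  trinomial-⊝ʳ : ∀ N {y k} a → y < k → trinomial N a (y ⊝ k) ≡ 0ℤ
  trinomial-⊝ʳ N a y<k with ⊝-negative y<k
  ... | j , eq rewrite eq = trinomial-negʳ N a j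

  trinomial-large : ∀ N a b → N < a + b → trinomial N (+ a) (+ b) ≡ 0ℤ
  trinomial-large zero    zero    (suc b) p = refl
  trinomial-large zero    (suc a) b       p = refl
  trinomial-large (suc N) zero (suc b) p
    rewrite trinomial-negˡ N 0 (+ suc b) | trinomial-large N 0 b (s≤s⁻¹ p) | trinomial-large N 0 (suc b) (m≤n⇒m≤1+n (s≤s⁻¹ p)) = refl
  trinomial-large (suc N) (suc a) zero p
    rewrite trinomial-large N a 0 (s≤s⁻¹ p) | trinomial-negʳ N (+ suc a) 0 | trinomial-large N (suc a) 0 (m≤n⇒m≤1+n (s≤s⁻¹ p)) = refl
  trinomial-large (suc N) (suc a) (suc b) p
    rewrite trinomial-large N a (suc b) (s≤s⁻¹ p)
          | trinomial-large N (suc a) b (subst (N <_) (+-suc a b) (s≤s⁻¹ p))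
          | trinomial-large N (suc a) (suc b) (m≤n⇒m≤1+n (s≤s⁻¹ p)) = refl

  -- (x - E) + (y + E) = x + y
  trinomial-shifted-large : ∀ N E x y → N < x + y → trinomial N (x ⊝ E) (+ (y + E)) ≡ 0ℤ
  trinomial-shifted-large N zero x y p rewrite +-identityʳ y = trinomial-large N x y p
  trinomial-shifted-large N (suc E) zero y p = trinomial-negˡ N E (+ (y + suc E))
  trinomial-shifted-large N (suc E) (suc x) y p rewrite +-suc y E = trinomial-shifted-large N E x (suc y) (subst (N <_) (sym (+-suc x y)) p)

  -- Four terms of a reflection principle; each of them satisfies the trinomial recursion.
  reflected : ℕ → ℤ → ℤ → ℤ → ℤ → ℤ → ℤ
  reflected N a a′ b b′ b″ = trinomial N a b ℤ.- trinomial N a′ b ℤ.- trinomial N a b′ ℤ.+ trinomial N a′ b″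

  atMostForm exactlyForm : ℕ → ℕ → ℕ → ℕ → ℕ → ℤ
  atMostForm  N E t x y = reflected N (x ⊝ E) (x ⊝ (E + suc t)) (+ (y + E)) (y ⊝ suc t) (+ y)
  exactlyForm N E t x y = reflected N (x ⊝ (E + t)) (x ⊝ suc (E + t)) (+ (y + E)) (y ⊝ 1) (+ y)

  +below : ∀ k (f : ℕ → ℕ) (v : ℤ) → (k ≡ 0 → v ≡ 0ℤ) → (∀ j → k ≡ suc j → + f j ≡ v) → + below k f ≡ v
  +below zero    f v z s = sym (z refl)
  +below (suc k) f v z s = s k refl

  module _ (τ : Bool) where

    open ℤ.+-*-Solver

    vanish₄ : ∀ {a b c d : ℤ} → a ≡ 0ℤ → b ≡ 0ℤ → c ≡ 0ℤ → d ≡ 0ℤ → a ℤ.- b ℤ.- c ℤ.+ d ≡ 0ℤ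
    vanish₄ refl refl refl refl = refl

    -- Without a constraint on the first queue only the ballot reflection remains.
    ballotForm : ℕ → ℕ → ℕ → ℕ → ℤ
    ballotForm N t x y = trinomial N (+ x) (+ y) ℤ.- trinomial N (+ x) (y ⊝ suc t)

    atMost-base : ∀ t x y z → x + y + z ≡ 0 → + count τ (atMost 0 t) 0 x y z ≡ ballotForm 0 t x y
    atMost-base t zero zero zero eq = refl

    -- The range of `y` is stable under undoing a last letter that the condition allows. On its edge
    -- `y ≡ z + suc t` the queue cannot be as short as `t`, and the two trinomials are equal by
    -- symmetry.
    count-atMost₀ : ∀ N t x y z → x + y + z ≡ N → y ≤ z + suc t → + count τ (atMost 0 t) N x y z ≡ ballotForm N t x y
    count-atMost₀ zero t x y z eq _ = atMost-base t x y z eq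
    count-atMost₀ (suc N) t x y z eq y≤ = begin
      + count τ (atMost 0 t) (suc N) x y z
        ≡⟨ cong +_ (count-step τ (atMost 0 t) N x y z) ⟩
      + (below x (λ x′ → count τ (atMost 0 t ∘ step τ X) N x′ y z)
        + below y (λ y′ → count τ (atMost 0 t ∘ step τ Y) N x y′ z)
        + below z (λ z′ → count τ (atMost 0 t ∘ step τ Z) N x y z′))
        ≡⟨ cong₂ ℤ._+_ (cong₂ ℤ._+_ (+below x _ _ x-zero x-suc) (y-part t refl)) (+below z _ _ z-zero z-suc) ⟩
      (T (ℤ.pred (+ x)) (+ y) ℤ.- T (ℤ.pred (+ x)) (y ⊝ suc t)) ℤ.+ (T (+ x) (ℤ.pred (+ y)) ℤ.- T (+ x) (y ⊝ suc t))
        ℤ.+ (T (+ x) (+ y) ℤ.- T (+ x) (y ⊝ suc (suc t)))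
        ≡⟨ cong (λ b → (T (ℤ.pred (+ x)) (+ y) ℤ.- T (ℤ.pred (+ x)) (y ⊝ suc t)) ℤ.+ (T (+ x) (ℤ.pred (+ y)) ℤ.- T (+ x) (y ⊝ suc t))
             ℤ.+ (T (+ x) (+ y) ℤ.- T (+ x) b)) (sym (pred-⊝ y (suc t))) ⟩
      (T (ℤ.pred (+ x)) (+ y) ℤ.- T (ℤ.pred (+ x)) (y ⊝ suc t)) ℤ.+ (T (+ x) (ℤ.pred (+ y)) ℤ.- T (+ x) (y ⊝ suc t))
        ℤ.+ (T (+ x) (+ y) ℤ.- T (+ x) (ℤ.pred (y ⊝ suc t)))
        ≡⟨ solve 6 (λ a b c d e f → (a :- b) :+ (c :- d) :+ (e :- f) := (a :+ c :+ e) :- (b :+ f :+ d)) refl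
             (T (ℤ.pred (+ x)) (+ y)) (T (ℤ.pred (+ x)) (y ⊝ suc t)) (T (+ x) (ℤ.pred (+ y))) (T (+ x) (y ⊝ suc t))
             (T (+ x) (+ y)) (T (+ x) (ℤ.pred (y ⊝ suc t))) ⟩
      ballotForm (suc N) t x y ∎
      where
      open ≡-Reasoning
      T = trinomial N
      x-zero : x ≡ 0 → T (ℤ.pred (+ x)) (+ y) ℤ.- T (ℤ.pred (+ x)) (y ⊝ suc t) ≡ 0ℤ
      x-zero refl rewrite trinomial-negˡ N 0 (+ y) | trinomial-negˡ N 0 (y ⊝ suc t) = refl
      x-suc : ∀ j → x ≡ suc j → + count τ (atMost 0 t ∘ step τ X) N j y z ≡ T (ℤ.pred (+ x)) (+ y) ℤ.- T (ℤ.pred (+ x)) (y ⊝ suc t)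
      x-suc j refl = trans (cong +_ (count-cong τ N j y z (atMost-X₀ τ t))) (count-atMost₀ N t j y z (suc-injective eq) y≤)
      y-part : ∀ t′ → t′ ≡ t → + below y (λ y′ → count τ (atMost 0 t′ ∘ step τ Y) N x y′ z)
        ≡ T (+ x) (ℤ.pred (+ y)) ℤ.- T (+ x) (y ⊝ suc t)
      -- A final Y leaves a customer in the second queue, so nothing is counted, and the two
      -- trinomials are the same.
      y-part zero refl = +below y _ _ (λ _ → diff) (λ { j refl → trans (cong +_ (trans (count-cong τ N x j z (atMost-Y-none τ 0)) (∑W-zero N x j z))) (sym diff) })
        where
        diff : T (+ x) (ℤ.pred (+ y)) ℤ.- T (+ x) (y ⊝ 1) ≡ 0ℤ
        diff rewrite pred-⊝ y 0 = ℤ.+-inverseʳ (T (+ x) (y ⊝ 1))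
      y-part (suc t′) refl = +below y _ _
        (λ { refl → cong₂ ℤ._-_ (trinomial-negʳ N (+ x) 0) (trinomial-negʳ N (+ x) (suc t′)) })
        (λ { j refl → trans (cong +_ (count-cong τ N x j z (atMost-Y₀ τ t′)))
          (count-atMost₀ N t′ x j z (suc-injective (trans (cong (_+ z) (sym (+-suc x j))) eq)) (s≤s⁻¹ (subst (suc j ≤_) (+-suc z (suc t′)) y≤))) })
      z-zero : z ≡ 0 → T (+ x) (+ y) ℤ.- T (+ x) (y ⊝ suc (suc t)) ≡ 0ℤ
      z-zero refl = cong₂ ℤ._-_ (trinomial-large N x y (≤-reflexive (sym (trans (sym (+-identityʳ (x + y))) eq))))
        (trinomial-⊝ʳ N (+ x) (s≤s y≤))
      z-suc : ∀ j → z ≡ suc j → + count τ (atMost 0 t ∘ step τ Z) N x y j ≡ T (+ x) (+ y) ℤ.- T (+ x) (y ⊝ suc (suc t))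
      z-suc j refl = trans (cong +_ (count-cong τ N x y j (atMost-Z τ 0 t)))
        (count-atMost₀ N (suc t) x y j (suc-injective (trans (sym (+-suc (x + y) j)) eq)) (subst (y ≤_) (sym (+-suc j (suc t))) y≤))

    atMostForm₀ : ∀ N t x y → atMostForm N 0 t x y ≡ ballotForm N t x y
    atMostForm₀ N t x y rewrite +-identityʳ y =
      solve 3 (λ a b c → a :- b :- c :+ b := a :- c) refl
        (trinomial N (+ x) (+ y)) (trinomial N (x ⊝ suc t) (+ y)) (trinomial N (+ x) (y ⊝ suc t))

    cong-reflected : ∀ N {a a′ b b′ b″ c c′ d d′ d″} → a ≡ c → a′ ≡ c′ → b ≡ d → b′ ≡ d′ → b″ ≡ d″ →
      reflected N a a′ b b′ b″ ≡ reflected N c c′ d d′ d″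
    cong-reflected N refl refl refl refl refl = refl

    -- Undoing X lowers `x` and `E`, undoing Y lowers `y` and `t` and raises `E`, undoing Z raises
    -- `t`. Each of the four terms thereby runs through the three branches of the trinomial
    -- recursion once, but every term in an order of its own.
    reflected-atMost : ∀ N a a′ b b′ b″ → reflected (suc N) a a′ b b′ b″ ≡
      reflected N a a′ (ℤ.pred b) b′ b″ ℤ.+ reflected N (ℤ.pred a) a′ b b′ (ℤ.pred b″)
        ℤ.+ reflected N a (ℤ.pred a′) b (ℤ.pred b′) b″
    reflected-atMost N a a′ b b′ b″ =
      solve 12 (λ p₁ p₂ p₃ q₁ q₂ q₃ r₁ r₂ r₃ s₁ s₂ s₃ →
          (p₁ :+ p₂ :+ p₃) :- (q₁ :+ q₂ :+ q₃) :- (r₁ :+ r₂ :+ r₃) :+ (s₁ :+ s₂ :+ s₃)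
          := (p₂ :- q₂ :- r₃ :+ s₃) :+ (p₁ :- q₃ :- r₁ :+ s₂) :+ (p₃ :- q₁ :- r₂ :+ s₁)) refl
        (T (ℤ.pred a) b) (T a (ℤ.pred b)) (T a b) (T (ℤ.pred a′) b) (T a′ (ℤ.pred b)) (T a′ b)
        (T (ℤ.pred a) b′) (T a (ℤ.pred b′)) (T a b′) (T (ℤ.pred a′) b″) (T a′ (ℤ.pred b″)) (T a′ b″)
      where T = trinomial N

    reflected-exactly : ∀ N a a′ b b′ b″ → reflected (suc N) a a′ b b′ b″ ≡
      reflected N a a′ (ℤ.pred b) b′ b″ ℤ.+ reflected N a a′ b (ℤ.pred b′) (ℤ.pred b″)
        ℤ.+ reflected N (ℤ.pred a) (ℤ.pred a′) b b′ b″
    reflected-exactly N a a′ b b′ b″ =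
      solve 12 (λ p₁ p₂ p₃ q₁ q₂ q₃ r₁ r₂ r₃ s₁ s₂ s₃ →
          (p₁ :+ p₂ :+ p₃) :- (q₁ :+ q₂ :+ q₃) :- (r₁ :+ r₂ :+ r₃) :+ (s₁ :+ s₂ :+ s₃)
          := (p₂ :- q₂ :- r₃ :+ s₃) :+ (p₃ :- q₃ :- r₂ :+ s₂) :+ (p₁ :- q₁ :- r₁ :+ s₁)) refl
        (T (ℤ.pred a) b) (T a (ℤ.pred b)) (T a b) (T (ℤ.pred a′) b) (T a′ (ℤ.pred b)) (T a′ b)
        (T (ℤ.pred a) b′) (T a (ℤ.pred b′)) (T a b′) (T (ℤ.pred a′) b″) (T a′ (ℤ.pred b″)) (T a′ b″)
      where T = trinomial N

    reflected-neg : ∀ N {x k k′} b b′ b″ → x < k → x < k′ → reflected N (x ⊝ k) (x ⊝ k′) b b′ b″ ≡ 0ℤ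
    reflected-neg N b b′ b″ p p′ = vanish₄ (trinomial-⊝ˡ N b p) (trinomial-⊝ˡ N b p′) (trinomial-⊝ˡ N b′ p) (trinomial-⊝ˡ N b″ p′)

    -- The two inequalities bound a region in which the induction on the last letter stays. Where a
    -- letter is missing its contribution to the form vanishes, since arguments become negative or
    -- exceed the length; for `E` zero the ballot form is the base.
    count-atMost : ∀ N E t x y z → x + y + z ≡ N → x ≤ y + E → y ≤ z + suc t →
      + count τ (atMost E t) N x y z ≡ atMostForm N E t x y
    count-atMost N zero t x y z eq _ y≤ = trans (count-atMost₀ N t x y z eq y≤) (sym (atMostForm₀ N t x y))
    count-atMost zero (suc E) t zero zero zero eq _ _ = refl
    count-atMost (suc N) (suc E) t x y z eq x≤ y≤ = begin
      + count τ (atMost (suc E) t) (suc N) x y z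
        ≡⟨ cong +_ (count-step τ (atMost (suc E) t) N x y z) ⟩
      + (below x (λ x′ → count τ (atMost (suc E) t ∘ step τ X) N x′ y z)
        + below y (λ y′ → count τ (atMost (suc E) t ∘ step τ Y) N x y′ z)
        + below z (λ z′ → count τ (atMost (suc E) t ∘ step τ Z) N x y z′))
        ≡⟨ cong₂ ℤ._+_ (cong₂ ℤ._+_ (+below x _ _ x-zero x-suc) (y-part t refl)) (+below z _ _ z-zero z-suc) ⟩
      reflected N a a′ (ℤ.pred b) b′ b″ ℤ.+ reflected N (ℤ.pred a) a′ b b′ (ℤ.pred b″) ℤ.+ reflected N a (ℤ.pred a′) b (ℤ.pred b′) b″
        ≡⟨ sym (reflected-atMost N a a′ b b′ b″) ⟩
      atMostForm (suc N) (suc E) t x y ∎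
      where
      open ≡-Reasoning
      a  = x ⊝ suc E
      a′ = x ⊝ (suc E + suc t)
      b  = + (y + suc E)
      b′ = y ⊝ suc t
      b″ = + y
      x-zero : x ≡ 0 → reflected N a a′ (ℤ.pred b) b′ b″ ≡ 0ℤ
      x-zero refl = reflected-neg N (ℤ.pred b) b′ b″ (s≤s z≤n) (s≤s z≤n)
      x-suc : ∀ j → x ≡ suc j → + count τ (atMost (suc E) t ∘ step τ X) N j y z ≡ reflected N a a′ (ℤ.pred b) b′ b″
      x-suc j refl = trans (cong +_ (count-cong τ N j y z (atMost-X τ E t)))
        (trans (count-atMost N E t j y z (suc-injective eq) (s≤s⁻¹ (subst (suc j ≤_) (+-suc y E) x≤)) y≤)
          (cong-reflected N refl refl (sym (cong (ℤ.pred ∘ +_) (+-suc y E))) refl refl))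
      y-part : ∀ t′ → t′ ≡ t → + below y (λ y′ → count τ (atMost (suc E) t′ ∘ step τ Y) N x y′ z)
        ≡ reflected N (ℤ.pred a) a′ b b′ (ℤ.pred b″)
      -- With `t` zero, `pred a` equals `a′` and `b′` equals `pred b″`, so the four terms cancel in
      -- pairs. Correspondingly, no word ending in Y leaves the second queue empty.
      y-part zero refl = +below y _ _ (λ _ → cancel)
        (λ { j refl → trans (cong +_ (trans (count-cong τ N x j z (atMost-Y-none τ (suc E))) (∑W-zero N x j z))) (sym cancel) })
        where
        cancel : reflected N (ℤ.pred a) (x ⊝ (suc E + 1)) b (y ⊝ 1) (ℤ.pred b″) ≡ 0ℤ
        cancel rewrite pred-⊝ x (suc E) | +-comm E 1 | pred-⊝ y 0 =
          solve 2 (λ p q → p :- p :- q :+ q := con 0ℤ) refl (trinomial N (x ⊝ suc (suc E)) b) (trinomial N (x ⊝ suc (suc E)) (y ⊝ 1))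
      y-part (suc t′) refl = +below y _ _
        (λ { refl → trans (cong-reflected N (pred-⊝ x (suc E)) refl refl refl refl)
                      (reflected-neg N b b′ (ℤ.pred b″) (s≤s x≤) (≤-trans (s≤s x≤) (s≤s (subst (suc E ≤_) (sym (+-suc E (suc t′))) (s≤s (m≤m+n E (suc t′))))))) })
        (λ { j refl → trans (cong +_ (count-cong τ N x j z (atMost-Y τ E t′)))
          (trans (count-atMost N (suc (suc E)) t′ x j z (suc-injective (trans (cong (_+ z) (sym (+-suc x j))) eq))
                   (subst (x ≤_) (sym (+-suc j (suc E))) x≤) (s≤s⁻¹ (subst (suc j ≤_) (+-suc z (suc t′)) y≤)))
            (cong-reflected N (sym (pred-⊝ x (suc E))) (cong (x ⊝_) (cong suc (sym (+-suc E (suc t′))))) (cong +_ (+-suc j (suc E))) refl refl)) })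
      z-zero : z ≡ 0 → reflected N a (ℤ.pred a′) b (ℤ.pred b′) b″ ≡ 0ℤ
      z-zero refl = vanish₄
        (trinomial-shifted-large N (suc E) x y (≤-reflexive (sym (trans (sym (+-identityʳ (x + y))) eq))))
        (trans (cong (λ a → trinomial N a b) (pred-⊝ x (suc E + suc t))) (trinomial-⊝ˡ N b far))
        (trans (cong (trinomial N a) (pred-⊝ y (suc t))) (trinomial-⊝ʳ N a (s≤s y≤)))
        (trans (cong (λ a → trinomial N a b″) (pred-⊝ x (suc E + suc t))) (trinomial-⊝ˡ N b″ far))
        where
        far : x < suc (suc E + suc t)
        far = s≤s (≤-trans x≤ (≤-trans (+-monoˡ-≤ (suc E) y≤) (≤-reflexive (+-comm (suc t) (suc E)))))
      z-suc : ∀ j → z ≡ suc j → + count τ (atMost (suc E) t ∘ step τ Z) N x y j ≡ reflected N a (ℤ.pred a′) b (ℤ.pred b′) b″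
      z-suc j refl = trans (cong +_ (count-cong τ N x y j (atMost-Z τ (suc E) t)))
        (trans (count-atMost N (suc E) (suc t) x y j (suc-injective (trans (sym (+-suc (x + y) j)) eq)) x≤ (subst (y ≤_) (sym (+-suc j (suc t))) y≤))
          (cong-reflected N refl (trans (cong (x ⊝_) (cong suc (+-suc E (suc t)))) (sym (pred-⊝ x (suc E + suc t)))) refl (sym (pred-⊝ y (suc t))) refl))

    exactlyForm₀ : ∀ N t x y → exactlyForm N 0 t x y ≡ trinomial N (x ⊝ t) (+ y) ℤ.- trinomial N (x ⊝ t) (y ⊝ 1)
    exactlyForm₀ N t x y rewrite +-identityʳ y =
      solve 3 (λ a b c → a :- b :- c :+ b := a :- c) refl
        (trinomial N (x ⊝ t) (+ y)) (trinomial N (x ⊝ suc t) (+ y)) (trinomial N (x ⊝ t) (y ⊝ 1))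

    -- At `t` zero this is an instance of `count-atMost`. The case of `E` zero is separate because
    -- undoing X no longer lowers `E`; the form then collapses to two terms, while undoing Y still
    -- leads to the four-term form with `E` one.
    count-exactly : ∀ N E t x y z → x + y + z ≡ N → x ≤ y + E → y ≤ z + t →
      + count τ (exactly E t) N x y z ≡ exactlyForm N E t x y
    count-exactly N E zero x y z eq x≤ y≤ = trans (cong +_ (count-cong τ N x y z (exactly-zero τ E)))
      (trans (count-atMost N E 0 x y z eq x≤ (≤-trans y≤ (+-monoʳ-≤ z z≤n)))
        (cong-reflected N (cong (x ⊝_) (sym (+-identityʳ E))) (cong (x ⊝_) (+-suc E 0)) refl refl refl))
    count-exactly zero E (suc t) zero zero zero eq _ _ with E
    ... | zero  = refl
    ... | suc _ = refl
    count-exactly (suc N) (suc E) (suc t) x y z eq x≤ y≤ = begin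
      + count τ (exactly (suc E) (suc t)) (suc N) x y z
        ≡⟨ cong +_ (count-step τ (exactly (suc E) (suc t)) N x y z) ⟩
      + (below x (λ x′ → count τ (exactly (suc E) (suc t) ∘ step τ X) N x′ y z)
        + below y (λ y′ → count τ (exactly (suc E) (suc t) ∘ step τ Y) N x y′ z)
        + below z (λ z′ → count τ (exactly (suc E) (suc t) ∘ step τ Z) N x y z′))
        ≡⟨ cong₂ ℤ._+_ (cong₂ ℤ._+_ (+below x _ _ x-zero x-suc) (+below y _ _ y-zero y-suc)) (+below z _ _ z-zero z-suc) ⟩
      reflected N a a′ (ℤ.pred b) b′ b″ ℤ.+ reflected N a a′ b (ℤ.pred b′) (ℤ.pred b″) ℤ.+ reflected N (ℤ.pred a) (ℤ.pred a′) b b′ b″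
        ≡⟨ sym (reflected-exactly N a a′ b b′ b″) ⟩
      exactlyForm (suc N) (suc E) (suc t) x y ∎
      where
      open ≡-Reasoning
      k  = suc E + suc t
      a  = x ⊝ k
      a′ = x ⊝ suc k
      b  = + (y + suc E)
      b′ = y ⊝ 1
      b″ = + y
      x-zero : x ≡ 0 → reflected N a a′ (ℤ.pred b) b′ b″ ≡ 0ℤ
      x-zero refl = reflected-neg N (ℤ.pred b) b′ b″ (s≤s z≤n) (s≤s z≤n)
      x-suc : ∀ j → x ≡ suc j → + count τ (exactly (suc E) (suc t) ∘ step τ X) N j y z ≡ reflected N a a′ (ℤ.pred b) b′ b″
      x-suc j refl = trans (cong +_ (count-cong τ N j y z (exactly-X τ E (suc t))))
        (trans (count-exactly N E (suc t) j y z (suc-injective eq) (s≤s⁻¹ (subst (suc j ≤_) (+-suc y E) x≤)) y≤)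
          (cong-reflected N refl refl (sym (cong (ℤ.pred ∘ +_) (+-suc y E))) refl refl))
      y-zero : y ≡ 0 → reflected N a a′ b (ℤ.pred b′) (ℤ.pred b″) ≡ 0ℤ
      y-zero refl = reflected-neg N b (ℤ.pred b′) (ℤ.pred b″) close (m≤n⇒m≤1+n close)
        where
        close : x < k
        close = ≤-trans (s≤s x≤) (≤-trans (≤-reflexive (+-comm 1 (suc E))) (+-monoʳ-≤ (suc E) (s≤s z≤n)))
      y-suc : ∀ j → y ≡ suc j → + count τ (exactly (suc E) (suc t) ∘ step τ Y) N x j z ≡ reflected N a a′ b (ℤ.pred b′) (ℤ.pred b″)
      y-suc j refl = trans (cong +_ (count-cong τ N x j z (exactly-Y τ (suc E) t)))
        (trans (count-exactly N (suc (suc E)) t x j z (suc-injective (trans (cong (_+ z) (sym (+-suc x j))) eq))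
                 (subst (x ≤_) (sym (+-suc j (suc E))) x≤) (s≤s⁻¹ (subst (suc j ≤_) (+-suc z t) y≤)))
          (cong-reflected N (cong (x ⊝_) (cong suc (sym (+-suc E t)))) (cong (x ⊝_) (cong (suc ∘ suc) (sym (+-suc E t))))
            (cong +_ (+-suc j (suc E))) (sym (pred-⊝ j 0)) refl))
      z-zero : z ≡ 0 → reflected N (ℤ.pred a) (ℤ.pred a′) b b′ b″ ≡ 0ℤ
      z-zero refl = trans (cong-reflected N (pred-⊝ x k) (pred-⊝ x (suc k)) refl refl refl)
        (reflected-neg N b b′ b″ (s≤s far) (m≤n⇒m≤1+n (s≤s far)))
        where
        far : x ≤ k
        far = ≤-trans x≤ (≤-trans (+-monoˡ-≤ (suc E) y≤) (≤-reflexive (+-comm (suc t) (suc E))))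
      z-suc : ∀ j → z ≡ suc j → + count τ (exactly (suc E) (suc t) ∘ step τ Z) N x y j ≡ reflected N (ℤ.pred a) (ℤ.pred a′) b b′ b″
      z-suc j refl = trans (cong +_ (count-cong τ N x y j (exactly-Z τ (suc E) t)))
        (trans (count-exactly N (suc E) (suc (suc t)) x y j (suc-injective (trans (sym (+-suc (x + y) j)) eq)) x≤ (subst (y ≤_) (sym (+-suc j (suc t))) y≤))
          (cong-reflected N (trans (cong (x ⊝_) (+-suc (suc E) (suc t))) (sym (pred-⊝ x k)))
            (trans (cong (x ⊝_) (cong suc (+-suc (suc E) (suc t)))) (sym (pred-⊝ x (suc k)))) refl refl refl))
    count-exactly (suc N) zero (suc t) x y z eq x≤ y≤ = begin
      + count τ (exactly 0 (suc t)) (suc N) x y z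
        ≡⟨ cong +_ (count-step τ (exactly 0 (suc t)) N x y z) ⟩
      + (below x (λ x′ → count τ (exactly 0 (suc t) ∘ step τ X) N x′ y z)
        + below y (λ y′ → count τ (exactly 0 (suc t) ∘ step τ Y) N x y′ z)
        + below z (λ z′ → count τ (exactly 0 (suc t) ∘ step τ Z) N x y z′))
        ≡⟨ cong₂ ℤ._+_ (cong₂ ℤ._+_ (+below x _ _ x-zero x-suc) (+below y _ _ y-zero y-suc)) (+below z _ _ z-zero z-suc) ⟩
      (T (ℤ.pred a) b ℤ.- T (ℤ.pred a) b′) ℤ.+ (T a b ℤ.- T (ℤ.pred a) b ℤ.- T a (ℤ.pred b′) ℤ.+ T (ℤ.pred a) b′)
        ℤ.+ (T (ℤ.pred a) b ℤ.- T (ℤ.pred a) b′)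
        -- The term `T a b′` is inserted on both sides of the difference: it is the second branch of
        -- the recursion for the first trinomial and the third branch for the other.
        ≡⟨ solve 5 (λ p q r s u → (p :- q) :+ (r :- p :- s :+ q) :+ (p :- q) := (p :+ u :+ r) :- (q :+ s :+ u)) refl
             (T (ℤ.pred a) b) (T (ℤ.pred a) b′) (T a b) (T a (ℤ.pred b′)) (T a b′) ⟩
      (T (ℤ.pred a) b ℤ.+ T a b′ ℤ.+ T a b) ℤ.- (T (ℤ.pred a) b′ ℤ.+ T a (ℤ.pred b′) ℤ.+ T a b′)
        ≡⟨ cong (λ c → (T (ℤ.pred a) b ℤ.+ T a c ℤ.+ T a b) ℤ.- (T (ℤ.pred a) b′ ℤ.+ T a (ℤ.pred b′) ℤ.+ T a b′)) (sym (pred-⊝ y 0)) ⟩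
      trinomial (suc N) a b ℤ.- trinomial (suc N) a b′
        ≡⟨ sym (exactlyForm₀ (suc N) (suc t) x y) ⟩
      exactlyForm (suc N) 0 (suc t) x y ∎
      where
      open ≡-Reasoning
      T = trinomial N
      a  = x ⊝ suc t
      b  = + y
      b′ = y ⊝ 1
      far : y ≤ suc t → x < suc (suc t)
      far y≤ = s≤s (≤-trans (≤-trans x≤ (≤-reflexive (+-identityʳ y))) y≤)
      x-zero : x ≡ 0 → T (ℤ.pred a) b ℤ.- T (ℤ.pred a) b′ ≡ 0ℤ
      x-zero refl = cong₂ ℤ._-_ (trinomial-negˡ N (suc t) b) (trinomial-negˡ N (suc t) b′)
      x-suc : ∀ j → x ≡ suc j → + count τ (exactly 0 (suc t) ∘ step τ X) N j y z ≡ T (ℤ.pred a) b ℤ.- T (ℤ.pred a) b′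
      x-suc j refl = trans (cong +_ (count-cong τ N j y z (exactly-X₀ τ (suc t))))
        (trans (count-exactly N 0 (suc t) j y z (suc-injective eq) (≤-trans (n≤1+n j) x≤) y≤)
          (trans (exactlyForm₀ N (suc t) j y) (cong (λ c → T c b ℤ.- T c b′) (sym (pred-⊝ j t)))))
      y-zero : y ≡ 0 → T a b ℤ.- T (ℤ.pred a) b ℤ.- T a (ℤ.pred b′) ℤ.+ T (ℤ.pred a) b′ ≡ 0ℤ
      y-zero refl rewrite pred-⊝ x (suc t) = vanish₄ (trinomial-⊝ˡ N b near) (trinomial-⊝ˡ N b (m≤n⇒m≤1+n near))
        (trinomial-⊝ˡ N _ near) (trinomial-⊝ˡ N b′ (m≤n⇒m≤1+n near))
        where
        near : x < suc t
        near = s≤s (≤-trans x≤ z≤n)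
      y-suc : ∀ j → y ≡ suc j → + count τ (exactly 0 (suc t) ∘ step τ Y) N x j z
        ≡ T a b ℤ.- T (ℤ.pred a) b ℤ.- T a (ℤ.pred b′) ℤ.+ T (ℤ.pred a) b′
      y-suc j refl = trans (cong +_ (count-cong τ N x j z (exactly-Y τ 0 t)))
        (trans (count-exactly N 1 t x j z (suc-injective (trans (cong (_+ z) (sym (+-suc x j))) eq))
                 (subst (x ≤_) (trans (+-identityʳ (suc j)) (+-comm 1 j)) x≤) (s≤s⁻¹ (subst (suc j ≤_) (+-suc z t) y≤)))
          (cong-reflected N refl (sym (pred-⊝ x (suc t))) (cong +_ (+-comm j 1)) (sym (pred-⊝ j 0)) refl))
      z-zero : z ≡ 0 → T (ℤ.pred a) b ℤ.- T (ℤ.pred a) b′ ≡ 0ℤ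
      z-zero refl rewrite pred-⊝ x (suc t) = cong₂ ℤ._-_ (trinomial-⊝ˡ N b (far y≤)) (trinomial-⊝ˡ N b′ (far y≤))
      z-suc : ∀ j → z ≡ suc j → + count τ (exactly 0 (suc t) ∘ step τ Z) N x y j ≡ T (ℤ.pred a) b ℤ.- T (ℤ.pred a) b′
      z-suc j refl = trans (cong +_ (count-cong τ N x y j (exactly-Z τ 0 t)))
        (trans (count-exactly N 0 (suc (suc t)) x y j (suc-injective (trans (sym (+-suc (x + y) j)) eq)) x≤ (subst (y ≤_) (sym (+-suc j (suc t))) y≤))
          (trans (exactlyForm₀ N (suc (suc t)) x y) (cong (λ c → T c b ℤ.- T c b′) (sym (pred-⊝ x (suc t))))))

  -- Multinomial numbers and product formulas

  shuffles : ℕ → ℕ → ℕ → ℕ → ℕ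
  shuffles N x y z = ∑W N x y z (λ _ → 1)

  fact₃ : ℕ → ℕ → ℕ → ℕ
  fact₃ x y z = x ! * y ! * z !

  shuffles-fact : ∀ N x y z → x + y + z ≡ N → shuffles N x y z * fact₃ x y z ≡ N !
  shuffles-fact zero zero zero zero eq = refl
  shuffles-fact (suc N) x y z eq = begin
    (Px + Py + Pz) * fact₃ x y z ≡⟨ solve 4 (λ a b c f → (a :+ b :+ c) :* f := a :* f :+ b :* f :+ c :* f) refl Px Py Pz (fact₃ x y z) ⟩
    Px * fact₃ x y z + Py * fact₃ x y z + Pz * fact₃ x y z ≡⟨ cong₂ _+_ (cong₂ _+_ (part-x x eq) (part-y y eq)) (part-z z eq) ⟩
    x * N ! + y * N ! + z * N !                           ≡⟨ solve 4 (λ x y z f → x :* f :+ y :* f :+ z :* f := (x :+ y :+ z) :* f) refl x y z (N !) ⟩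
    (x + y + z) * N !                                     ≡⟨ cong (_* N !) eq ⟩
    suc N * N !                                           ∎
    where
    open ≡-Reasoning
    open +-*-Solver
    Px = below x (λ x′ → shuffles N x′ y z)
    Py = below y (λ y′ → shuffles N x y′ z)
    Pz = below z (λ z′ → shuffles N x y z′)
    part-x : ∀ x → x + y + z ≡ suc N → below x (λ x′ → shuffles N x′ y z) * fact₃ x y z ≡ x * N !
    part-x zero    _  = refl
    part-x (suc x) eq = trans (solve 5 (λ m k a b c → m :* (k :* a :* b :* c) := k :* (m :* (a :* b :* c))) refl (shuffles N x y z) (suc x) (x !) (y !) (z !))
      (cong (suc x *_) (shuffles-fact N x y z (suc-injective eq)))
    part-y : ∀ y → x + y + z ≡ suc N → below y (λ y′ → shuffles N x y′ z) * fact₃ x y z ≡ y * N !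
    part-y zero    _  = refl
    part-y (suc y) eq = trans (solve 5 (λ m k a b c → m :* (a :* (k :* b) :* c) := k :* (m :* (a :* b :* c))) refl (shuffles N x y z) (suc y) (x !) (y !) (z !))
      (cong (suc y *_) (shuffles-fact N x y z (suc-injective (trans (cong (_+ z) (sym (+-suc x y))) eq))))
    part-z : ∀ z → x + y + z ≡ suc N → below z (λ z′ → shuffles N x y z′) * fact₃ x y z ≡ z * N !
    part-z zero    _  = refl
    part-z (suc z) eq = trans (solve 5 (λ m k a b c → m :* (a :* b :* (k :* c)) := k :* (m :* (a :* b :* c))) refl (shuffles N x y z) (suc z) (x !) (y !) (z !))
      (cong (suc z *_) (shuffles-fact N x y z (suc-injective (trans (sym (+-suc (x + y) z)) eq))))

  cancel-fact : ∀ x y z {a b} → a * fact₃ x y z ≡ b * fact₃ x y z → a ≡ b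
  cancel-fact x y z {a} {b} eq = *-cancelʳ-≡ a b (fact₃ x y z) {{m*n≢0 (x ! * y !) (z !) {{m*n≢0 (x !) (y !) {{x !≢0}} {{y !≢0}}}} {{z !≢0}}}} eq

  module _ where
    open +-*-Solver
    open ≡-Reasoning

    absorb-x : ∀ N x y z → x + y + z ≡ N → suc x * shuffles (suc N) (suc x) y z ≡ suc N * shuffles N x y z
    absorb-x N x y z eq = cancel-fact x y z (begin
      suc x * M * fact₃ x y z                ≡⟨ solve 5 (λ m k a b c → k :* m :* (a :* b :* c) := m :* (k :* a :* b :* c)) refl M (suc x) (x !) (y !) (z !) ⟩
      M * fact₃ (suc x) y z                  ≡⟨ shuffles-fact (suc N) (suc x) y z (cong suc eq) ⟩
      suc N * N !                            ≡⟨ cong (suc N *_) (sym (shuffles-fact N x y z eq)) ⟩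
      suc N * (shuffles N x y z * fact₃ x y z) ≡⟨ sym (*-assoc (suc N) (shuffles N x y z) (fact₃ x y z)) ⟩
      suc N * shuffles N x y z * fact₃ x y z ∎)
      where M = shuffles (suc N) (suc x) y z

    absorb-y : ∀ N x y z → x + y + z ≡ N → suc y * shuffles (suc N) x (suc y) z ≡ suc N * shuffles N x y z
    absorb-y N x y z eq = cancel-fact x y z (begin
      suc y * M * fact₃ x y z                ≡⟨ solve 5 (λ m k a b c → k :* m :* (a :* b :* c) := m :* (a :* (k :* b) :* c)) refl M (suc y) (x !) (y !) (z !) ⟩
      M * fact₃ x (suc y) z                  ≡⟨ shuffles-fact (suc N) x (suc y) z (trans (cong (_+ z) (+-suc x y)) (cong suc eq)) ⟩
      suc N * N !                            ≡⟨ cong (suc N *_) (sym (shuffles-fact N x y z eq)) ⟩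
      suc N * (shuffles N x y z * fact₃ x y z) ≡⟨ sym (*-assoc (suc N) (shuffles N x y z) (fact₃ x y z)) ⟩
      suc N * shuffles N x y z * fact₃ x y z ∎)
      where M = shuffles (suc N) x (suc y) z

    absorb-z : ∀ N x y z → x + y + z ≡ N → suc z * shuffles (suc N) x y (suc z) ≡ suc N * shuffles N x y z
    absorb-z N x y z eq = cancel-fact x y z (begin
      suc z * M * fact₃ x y z                ≡⟨ solve 5 (λ m k a b c → k :* m :* (a :* b :* c) := m :* (a :* b :* (k :* c))) refl M (suc z) (x !) (y !) (z !) ⟩
      M * fact₃ x y (suc z)                  ≡⟨ shuffles-fact (suc N) x y (suc z) (trans (+-suc (x + y) z) (cong suc eq)) ⟩
      suc N * N !                            ≡⟨ cong (suc N *_) (sym (shuffles-fact N x y z eq)) ⟩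
      suc N * (shuffles N x y z * fact₃ x y z) ≡⟨ sym (*-assoc (suc N) (shuffles N x y z) (fact₃ x y z)) ⟩
      suc N * shuffles N x y z * fact₃ x y z ∎)
      where M = shuffles (suc N) x y (suc z)

    exchange-yz : ∀ N x y z → x + y + z ≡ N → suc y * shuffles (suc N) x (suc y) z ≡ suc z * shuffles (suc N) x y (suc z)
    exchange-yz N x y z eq = trans (absorb-y N x y z eq) (sym (absorb-z N x y z eq))

  trinomial-shuffles : ∀ N x y z → x + y + z ≡ N → trinomial N (+ x) (+ y) ≡ + shuffles N x y z
  trinomial-shuffles zero zero zero zero eq = refl
  trinomial-shuffles (suc N) x y z eq = sym (cong₂ ℤ._+_ (cong₂ ℤ._+_
    (+below x _ (trinomial N (ℤ.pred (+ x)) (+ y)) (λ { refl → trinomial-negˡ N 0 (+ y) }) (λ { j refl → sym (trinomial-shuffles N j y z (suc-injective eq)) }))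
    (+below y _ (trinomial N (+ x) (ℤ.pred (+ y))) (λ { refl → trinomial-negʳ N (+ x) 0 })
      (λ { j refl → sym (trinomial-shuffles N x j z (suc-injective (trans (cong (_+ z) (sym (+-suc x j))) eq))) })))
    (+below z _ (trinomial N (+ x) (+ y)) (λ { refl → trinomial-large N x y (≤-reflexive (sym (trans (sym (+-identityʳ (x + y))) eq))) })
      (λ { j refl → sym (trinomial-shuffles N x y j (suc-injective (trans (sym (+-suc (x + y) j)) eq))) })))

  -- A Z read in such a state completes an adjacent pair: it finds the second queue empty, so its
  -- letter exceeds `j`, while the Z before it served a customer that counts for the flag, so its
  -- letter is at most `i`.
  done : State → ℕ
  done (state e f s m) = 𝟙 ((f ≡ᵇ 0) ∧ ((s ≡ᵇ 0) ∧ m))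

  done-X : ∀ t σ → done (step t X σ) ≡ done σ
  done-X t (state e f s m) = refl

  done-Y : ∀ t σ → done (step t Y σ) ≡ 0
  done-Y t (state zero zero s m)    = refl
  done-Y t (state zero (suc f) s m) = refl
  done-Y t (state (suc e) f s m)    = refl

  done-Z : ∀ σ → done (step true Z σ) ≡ exactly 0 1 σ
  done-Z (state e zero zero m)          = refl
  done-Z (state e zero (suc zero) m)    = refl
  done-Z (state e zero (suc (suc s)) m) = refl
  done-Z (state e (suc zero) zero m)    = refl
  done-Z (state e (suc zero) (suc s) m) = refl
  done-Z (state e (suc (suc f)) s m)    = refl

  -- When any customer sets the flag, only the total length matters: it must be one before the
  -- service, and this is a difference of two `atMost` conditions.
  done-Z′ : ∀ σ → done (step false Z σ) + atMost 0 0 σ ≡ atMost 0 1 σ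
  done-Z′ (state e zero zero m)             = refl
  done-Z′ (state e zero (suc zero) m)       = refl
  done-Z′ (state e zero (suc (suc s)) m)    = refl
  done-Z′ (state e (suc zero) zero m)       = refl
  done-Z′ (state e (suc zero) (suc s) m)    = refl
  done-Z′ (state e (suc (suc f)) s m)       = refl

  ∑W-+ : ∀ N x y z Ψ Ψ′ → ∑W N x y z (λ w → Ψ w + Ψ′ w) ≡ ∑W N x y z Ψ + ∑W N x y z Ψ′
  ∑W-+ zero    zero    zero    zero    Ψ Ψ′ = refl
  ∑W-+ zero    zero    zero    (suc _) Ψ Ψ′ = refl
  ∑W-+ zero    zero    (suc _) _       Ψ Ψ′ = refl
  ∑W-+ zero    (suc _) _       _       Ψ Ψ′ = refl
  ∑W-+ (suc N) x y z Ψ Ψ′ = trans (cong₂ _+_ (cong₂ _+_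
    (b x (λ k → ∑W-+ N k y z (Ψ ∘ (X ∷_)) (Ψ′ ∘ (X ∷_)))) (b y (λ k → ∑W-+ N x k z (Ψ ∘ (Y ∷_)) (Ψ′ ∘ (Y ∷_)))))
    (b z (λ k → ∑W-+ N x y k (Ψ ∘ (Z ∷_)) (Ψ′ ∘ (Z ∷_)))))
    (solve 6 (λ a b c d e f → (a :+ b) :+ (c :+ d) :+ (e :+ f) := (a :+ c :+ e) :+ (b :+ d :+ f)) refl
      (below x (λ k → ∑W N k y z (Ψ ∘ (X ∷_)))) (below x (λ k → ∑W N k y z (Ψ′ ∘ (X ∷_))))
      (below y (λ k → ∑W N x k z (Ψ ∘ (Y ∷_)))) (below y (λ k → ∑W N x k z (Ψ′ ∘ (Y ∷_))))
      (below z (λ k → ∑W N x y k (Ψ ∘ (Z ∷_)))) (below z (λ k → ∑W N x y k (Ψ′ ∘ (Z ∷_)))))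
    where
    open +-*-Solver
    b : ∀ k {f g h : ℕ → ℕ} → (∀ j → h j ≡ f j + g j) → below k h ≡ below k f + below k g
    b zero    p = refl
    b (suc k) p = p k

  count-done-step : ∀ t N x y z → count t done (suc N) x y z ≡
    below x (λ x′ → count t done N x′ y z) + below z (λ z′ → count t (done ∘ step t Z) N x y z′)
  count-done-step t N x y z = trans (count-step t done N x y z) (cong (_+ below z (λ z′ → count t (done ∘ step t Z) N x y z′))
    (trans (cong₂ _+_ (below-cong x (λ x′ _ → count-cong t N x′ y z (done-X t)))
      (below-zero y (λ y′ → trans (count-cong t N x y′ z (done-Y t)) (∑W-zero N x y′ z)))) (+-identityʳ _)))

  -- The ratio of neighbouring multinomial numbers, with the denominator cleared so that `y` may be
  -- 0.
  trinomial-previous : ∀ N x y z → x + y + z ≡ N → + suc z ℤ.* trinomial N (+ x) (y ⊝ 1) ≡ + (y * shuffles N x y z)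
  trinomial-previous N x zero z eq = trans (cong (+ suc z ℤ.*_) (trinomial-negʳ N (+ x) 0)) (ℤ.*-zeroʳ (+ suc z))
  trinomial-previous (suc N) x (suc y) z eq = begin
    + suc z ℤ.* trinomial (suc N) (+ x) (+ y)        ≡⟨ cong (+ suc z ℤ.*_) (trinomial-shuffles (suc N) x y (suc z) (trans (+-suc (x + y) z) (cong suc eq′))) ⟩
    + suc z ℤ.* + shuffles (suc N) x y (suc z)       ≡⟨ sym (ℤ.pos-* (suc z) _) ⟩
    + (suc z * shuffles (suc N) x y (suc z))         ≡⟨ cong +_ (sym (exchange-yz N x y z eq′)) ⟩
    + (suc y * shuffles (suc N) x (suc y) z)         ∎
    where
    open ≡-Reasoning
    eq′ : x + y + z ≡ N
    eq′ = suc-injective (trans (cong (_+ z) (sym (+-suc x y))) eq)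
  trinomial-previous zero x (suc y) z eq = ⊥-elim (1+n≢0 (trans (cong (_+ z) (sym (+-suc x y))) eq))

  -- The second trinomial of the form is `y / (z + 2)` times the first, and `z + 2` exceeds `y` by
  -- `suc g`. This is the ballot factor.
  count-exactly-one : ∀ N x y z g → x + y + suc z ≡ N → x < y → suc z ≡ y + g →
    suc (suc z) * count true (exactly 0 1) N (suc x) y z ≡ suc g * shuffles N x y (suc z)
  count-exactly-one N x y z g eq x<y z≡ = ℤ.+-injective (begin
    + (suc (suc z) * r)                                    ≡⟨ ℤ.pos-* (suc (suc z)) r ⟩
    + suc (suc z) ℤ.* + r                                  ≡⟨ cong (+ suc (suc z) ℤ.*_) (trans (count-exactly true N 0 1 (suc x) y z eq′ x≤ y≤) (exactlyForm₀ true N 1 (suc x) y)) ⟩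
    + suc (suc z) ℤ.* (trinomial N (+ x) (+ y) ℤ.- trinomial N (+ x) (y ⊝ 1))
      ≡⟨ solve 3 (λ k a b → k :* (a :- b) := k :* a :- k :* b) refl (+ suc (suc z)) (trinomial N (+ x) (+ y)) (trinomial N (+ x) (y ⊝ 1)) ⟩
    + suc (suc z) ℤ.* trinomial N (+ x) (+ y) ℤ.- + suc (suc z) ℤ.* trinomial N (+ x) (y ⊝ 1)
      ≡⟨ cong₂ ℤ._-_ (cong (+ suc (suc z) ℤ.*_) (trinomial-shuffles N x y (suc z) eq)) (trinomial-previous N x y (suc z) eq) ⟩
    + suc (suc z) ℤ.* + M ℤ.- + (y * M)
      ≡⟨ cong₂ ℤ._-_ (trans (sym (ℤ.pos-* (suc (suc z)) M)) (cong +_ (trans (cong (λ k → suc k * M) z≡) (split y g M)))) refl ⟩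
    + (y * M + suc g * M) ℤ.- + (y * M)
      ≡⟨ trans (cong (ℤ._- + (y * M)) (ℤ.pos-+ (y * M) (suc g * M))) (solve 2 (λ a b → (a :+ b) :- a := b) refl (+ (y * M)) (+ (suc g * M))) ⟩
    + (suc g * M)                                          ∎)
    where
    open ≡-Reasoning
    open ℤ.+-*-Solver
    r = count true (exactly 0 1) N (suc x) y z
    M = shuffles N x y (suc z)
    eq′ : suc x + y + z ≡ N
    eq′ = trans (sym (+-suc (x + y) z)) eq
    x≤ : suc x ≤ y + 0
    x≤ = ≤-trans x<y (≤-reflexive (sym (+-identityʳ y)))
    y≤ : y ≤ z + 1
    y≤ = ≤-trans (m≤m+n y g) (≤-reflexive (trans (sym z≡) (+-comm 1 z)))
    split : ∀ y g M → suc (y + g) * M ≡ y * M + suc g * M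
    split y g M = trans (cong (_* M) (sym (+-suc y g))) (*-distribʳ-+ M y (suc g))

  -- A final X does not affect `done`, a final Y excludes it, and a final Z leads to
  -- `count-exactly-one`. In the sum of the two contributions `x` and `suc (y + suc z)` add up to
  -- `suc N`, which absorption exchanges for `suc x`; this makes the product formula survive the
  -- induction.
  count-done : ∀ N x y z g → x + y + z ≡ N → x ≤ y → z ≡ y + g →
    suc z * suc (y + z) * count true done N x y z ≡ x * suc g * shuffles N x y z
  count-done zero zero zero zero g eq _ _ = *-zeroʳ (suc zero * suc zero)
  count-done (suc N) x y zero g eq x≤y z≡ with n≤0⇒n≡0 (≤-trans (m≤m+n y g) (≤-reflexive (sym z≡)))
  ... | refl with x≤y
  ...   | z≤n = ⊥-elim (1+n≢0 (sym eq))
  count-done (suc N) zero y (suc z) g eq x≤y z≡ =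
    trans (cong (suc (suc z) * suc (y + suc z) *_) zero-count) (*-zeroʳ (suc (suc z) * suc (y + suc z)))
    where
    form : + count true (exactly 0 1) N 0 y z ≡ 0ℤ
    form = trans (count-exactly true N 0 1 0 y z (suc-injective (trans (sym (+-suc y z)) eq)) z≤n
             (≤-trans (m≤m+n y g) (≤-reflexive (trans (sym z≡) (+-comm 1 z)))))
      (trans (exactlyForm₀ true N 1 0 y) (cong₂ ℤ._-_ (trinomial-negˡ N 0 (+ y)) (trinomial-negˡ N 0 (y ⊝ 1))))
    zero-count : count true done (suc N) 0 y (suc z) ≡ 0
    zero-count = trans (count-done-step true N 0 y (suc z)) (trans (count-cong true N 0 y z done-Z) (ℤ.+-injective form))
  count-done (suc N) (suc x) y (suc z) g eq x≤y z≡ = begin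
    k * s * count true done (suc N) (suc x) y (suc z)
      ≡⟨ cong (k * s *_) (trans (count-done-step true N (suc x) y (suc z)) (cong (λ r → Q + r) (count-cong true N (suc x) y z done-Z))) ⟩
    k * s * (Q + R)
      ≡⟨ solve 4 (λ k s q r → k :* s :* (q :+ r) := k :* s :* q :+ s :* (k :* r)) refl k s Q R ⟩
    k * s * Q + s * (k * R)
      ≡⟨ cong₂ _+_ (count-done N x y (suc z) g eq′ (<⇒≤ x≤y) z≡) (cong (s *_) (count-exactly-one N x y z g eq′ x≤y z≡)) ⟩
    x * suc g * M + s * (suc g * M)
      ≡⟨ solve 4 (λ x g s m → x :* g :* m :+ s :* (g :* m) := g :* ((x :+ s) :* m)) refl x (suc g) s M ⟩
    suc g * ((x + s) * M)
      ≡⟨ cong (λ l → suc g * (l * M)) (trans (+-suc x (y + suc z)) (cong suc (trans (sym (+-assoc x y (suc z))) eq′))) ⟩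
    suc g * (suc N * M)
      ≡⟨ cong (suc g *_) (sym (absorb-x N x y (suc z) eq′)) ⟩
    suc g * (suc x * shuffles (suc N) (suc x) y (suc z))
      ≡⟨ solve 3 (λ g x m → g :* (x :* m) := x :* g :* m) refl (suc g) (suc x) (shuffles (suc N) (suc x) y (suc z)) ⟩
    suc x * suc g * shuffles (suc N) (suc x) y (suc z) ∎
    where
    open ≡-Reasoning
    open +-*-Solver
    k = suc (suc z)
    s = suc (y + suc z)
    Q = count true done N x y (suc z)
    R = count true (exactly 0 1) N (suc x) y z
    M = shuffles N x y (suc z)
    eq′ : x + y + suc z ≡ N
    eq′ = suc-injective eq

  -- Without X, `done-Z′` gives a difference of two ballot counts in which the leading trinomials
  -- cancel.
  count-done′ : ∀ N y z g → y + suc z ≡ N → suc z ≡ suc y + g →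
    suc (suc z) * count false done (suc N) 0 (suc y) (suc z) ≡ suc (suc g) * shuffles N 0 y (suc z)
  count-done′ N y z g eq z≡ = ℤ.+-injective (begin
    + (suc (suc z) * count false done (suc N) 0 (suc y) (suc z))
      ≡⟨ cong (λ r → + (suc (suc z) * r)) (count-done-step false N 0 (suc y) (suc z)) ⟩
    + (suc (suc z) * r)                                    ≡⟨ ℤ.pos-* (suc (suc z)) r ⟩
    + suc (suc z) ℤ.* + r                                  ≡⟨ cong (+ suc (suc z) ℤ.*_) r≡ ⟩
    + suc (suc z) ℤ.* (trinomial N (+ 0) (+ y) ℤ.- trinomial N (+ 0) (y ⊝ 1))
      ≡⟨ solve 3 (λ k a b → k :* (a :- b) := k :* a :- k :* b) refl (+ suc (suc z)) (trinomial N (+ 0) (+ y)) (trinomial N (+ 0) (y ⊝ 1)) ⟩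
    + suc (suc z) ℤ.* trinomial N (+ 0) (+ y) ℤ.- + suc (suc z) ℤ.* trinomial N (+ 0) (y ⊝ 1)
      ≡⟨ cong₂ ℤ._-_ (cong (+ suc (suc z) ℤ.*_) (trinomial-shuffles N 0 y (suc z) eq)) (trinomial-previous N 0 y (suc z) eq) ⟩
    + suc (suc z) ℤ.* + M ℤ.- + (y * M)
      ≡⟨ cong₂ ℤ._-_ (trans (sym (ℤ.pos-* (suc (suc z)) M)) (cong +_ (trans (cong (λ k → suc k * M) z≡) (split y g M)))) refl ⟩
    + (y * M + suc (suc g) * M) ℤ.- + (y * M)
      ≡⟨ trans (cong (ℤ._- + (y * M)) (ℤ.pos-+ (y * M) (suc (suc g) * M))) (solve 2 (λ a b → (a :+ b) :- a := b) refl (+ (y * M)) (+ (suc (suc g) * M))) ⟩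
    + (suc (suc g) * M)                                    ∎)
    where
    open ≡-Reasoning
    open ℤ.+-*-Solver
    r = count false (done ∘ step false Z) N 0 (suc y) z
    M = shuffles N 0 y (suc z)
    r₀ = count false (atMost 0 0) N 0 (suc y) z
    r₁ = count false (atMost 0 1) N 0 (suc y) z
    eq′ : 0 + suc y + z ≡ N
    eq′ = trans (sym (+-suc y z)) eq
    y≤ : suc y ≤ suc z
    y≤ = ≤-trans (m≤m+n (suc y) g) (≤-reflexive (sym z≡))
    sum≡ : r + r₀ ≡ r₁
    sum≡ = trans (sym (∑W-+ N 0 (suc y) z _ _)) (count-cong false N 0 (suc y) z done-Z′)
    r≡ : + r ≡ trinomial N (+ 0) (+ y) ℤ.- trinomial N (+ 0) (y ⊝ 1)
    r≡ = begin
      + r                              ≡⟨ solve 2 (λ a b → a := (a :+ b) :- b) refl (+ r) (+ r₀) ⟩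
      (+ r ℤ.+ + r₀) ℤ.- + r₀          ≡⟨ cong (ℤ._- + r₀) (trans (sym (ℤ.pos-+ r r₀)) (cong +_ sum≡)) ⟩
      + r₁ ℤ.- + r₀                    ≡⟨ cong₂ ℤ._-_
        (count-atMost₀ false N 1 0 (suc y) z eq′ (≤-trans y≤ (≤-trans (n≤1+n (suc z)) (≤-reflexive (+-comm 2 z)))))
        (count-atMost₀ false N 0 0 (suc y) z eq′ (≤-trans y≤ (≤-reflexive (+-comm 1 z)))) ⟩
      (T (+ suc y) ℤ.- T (y ⊝ 1)) ℤ.- (T (+ suc y) ℤ.- T (+ y))
        ≡⟨ solve 3 (λ a b d → (a :- b) :- (a :- d) := d :- b) refl (T (+ suc y)) (T (y ⊝ 1)) (T (+ y)) ⟩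
      T (+ y) ℤ.- T (y ⊝ 1) ∎
      where T = trinomial N (+ 0)
    split : ∀ y g M → suc (suc y + g) * M ≡ y * M + suc (suc g) * M
    split y g M = trans (cong (_* M) (sym (trans (+-suc y (suc g)) (cong suc (+-suc y g))))) (*-distribʳ-+ M y (suc (suc g)))

open LinearCounts

-- The queues on a cycle

-- The second queue as seen by first-class customers, whom second-class ones never delay.
firstKinds : ℕ → List Letter → List Kind
firstKinds e []      = []
firstKinds e (X ∷ v) = oth ∷ firstKinds (suc e) v
firstKinds e (Y ∷ v) = (if positive e then arr else oth) ∷ firstKinds (pred e) v
firstKinds e (Z ∷ v) = srv ∷ firstKinds e v
firstKinds e (O ∷ v) = oth ∷ firstKinds e v

firstKinds-arrivals : ∀ e v → arrivals (firstKinds e v) ≡ trues (served e (map kindXY v))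
firstKinds-arrivals e []            = refl
firstKinds-arrivals e (X ∷ v)       = firstKinds-arrivals (suc e) v
firstKinds-arrivals zero (Y ∷ v)    = firstKinds-arrivals zero v
firstKinds-arrivals (suc e) (Y ∷ v) = cong suc (firstKinds-arrivals e v)
firstKinds-arrivals e (Z ∷ v)       = firstKinds-arrivals e v
firstKinds-arrivals e (O ∷ v)       = firstKinds-arrivals e v

firstKinds-services : ∀ e v → services (firstKinds e v) ≡ services (map kindYZ v)
firstKinds-services e []            = refl
firstKinds-services e (X ∷ v)       = firstKinds-services (suc e) v
firstKinds-services zero (Y ∷ v)    = firstKinds-services zero v
firstKinds-services (suc e) (Y ∷ v) = firstKinds-services e v
firstKinds-services e (Z ∷ v)       = cong suc (firstKinds-services e v)
firstKinds-services e (O ∷ v)       = firstKinds-services e v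

services≡arrivals : ∀ v → services (map kindXY v) ≡ arrivals (map kindYZ v)
services≡arrivals []      = refl
services≡arrivals (X ∷ v) = services≡arrivals v
services≡arrivals (Y ∷ v) = cong suc (services≡arrivals v)
services≡arrivals (Z ∷ v) = services≡arrivals v
services≡arrivals (O ∷ v) = services≡arrivals v

record Balanced (v : List Letter) : Set where
  constructor balanced
  field
    X<Y : arrivals (map kindXY v) < services (map kindXY v)
    Y<Z : arrivals (map kindYZ v) < services (map kindYZ v)

shuffle-counts : ∀ {N x y z v} → Shuffle N x y z v →
  arrivals (map kindXY v) ≡ x × services (map kindXY v) ≡ y × arrivals (map kindYZ v) ≡ y × services (map kindYZ v) ≡ z × length v ≡ N
shuffle-counts [] = refl , refl , refl , refl , refl
shuffle-counts (X∷ s) = let a , b , c , d , e = shuffle-counts s in cong suc a , b , c , d , cong suc e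
shuffle-counts (Y∷ s) = let a , b , c , d , e = shuffle-counts s in a , cong suc b , cong suc c , d , cong suc e
shuffle-counts (Z∷ s) = let a , b , c , d , e = shuffle-counts s in a , b , c , cong suc d , cong suc e

shuffle-balanced : ∀ {N x y z v} → x < y → y < z → Shuffle N x y z v → Balanced v
shuffle-balanced x<y y<z s = let a , b , c , d , _ = shuffle-counts s in
  balanced (subst₂ _<_ (sym a) (sym b) x<y) (subst₂ _<_ (sym c) (sym d) y<z)

balanced-rotate : ∀ c v → Balanced (c ∷ v) → Balanced (v ++ [ c ])
balanced-rotate c v (balanced p q) = balanced
  (subst₂ _<_ (arr≡ kindXY) (srv≡ kindXY) p) (subst₂ _<_ (arr≡ kindYZ) (srv≡ kindYZ) q)
  where
  arr≡ : ∀ k → arrivals (map k (c ∷ v)) ≡ arrivals (map k (v ++ [ c ]))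
  arr≡ k = trans (arrivals-∷ (k c) (map k v)) (trans (sym (arrivals-++ (map k v) [ k c ])) (cong arrivals (sym (map-++ k v [ c ]))))
  srv≡ : ∀ k → services (map k (c ∷ v)) ≡ services (map k (v ++ [ c ]))
  srv≡ k = trans (services-∷ (k c) (map k v)) (trans (sym (services-++ (map k v) [ k c ])) (cong services (sym (map-++ k v [ c ]))))

waiting* first* total* : List Letter → ℕ
waiting* v = final 0 (map kindXY v)
first* v = final 0 (firstKinds (waiting* v) v)
total* v = final 0 (map kindYZ v)

module _ (t : Bool) where

  waiting-run : ∀ v e f s m → waiting (run t (state e f s m) v) ≡ final e (map kindXY v)
  waiting-run []      e f s m             = refl
  waiting-run (X ∷ v) e f s m             = waiting-run v (suc e) f s m
  waiting-run (Y ∷ v) zero f s m          = waiting-run v zero f (suc s) m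
  waiting-run (Y ∷ v) (suc e) f s m       = waiting-run v e (suc f) s m
  waiting-run (Z ∷ v) e zero s m          = waiting-run v e zero (pred s) _
  waiting-run (Z ∷ v) e (suc f) s m       = waiting-run v e f s true
  waiting-run (O ∷ v) e f s m             = waiting-run v e f s m

  first-run : ∀ v e f s m → first (run t (state e f s m) v) ≡ final f (firstKinds e v)
  first-run []      e f s m             = refl
  first-run (X ∷ v) e f s m             = first-run v (suc e) f s m
  first-run (Y ∷ v) zero f s m          = first-run v zero f (suc s) m
  first-run (Y ∷ v) (suc e) f s m       = first-run v e (suc f) s m
  first-run (Z ∷ v) e zero s m          = first-run v e zero (pred s) _
  first-run (Z ∷ v) e (suc f) s m       = first-run v e f s true
  first-run (O ∷ v) e f s m             = first-run v e f s m

  total-run : ∀ v e f s m → first (run t (state e f s m) v) + second (run t (state e f s m) v) ≡ final (f + s) (map kindYZ v)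
  total-run []      e f s m             = refl
  total-run (X ∷ v) e f s m             = total-run v (suc e) f s m
  total-run (Y ∷ v) zero f s m          = trans (total-run v zero f (suc s) m) (cong (λ q → final q (map kindYZ v)) (+-suc f s))
  total-run (Y ∷ v) (suc e) f s m       = total-run v e (suc f) s m
  total-run (Z ∷ v) e zero s m          = total-run v e zero (pred s) _
  total-run (Z ∷ v) e (suc f) s m       = total-run v e f s true
  total-run (O ∷ v) e f s m             = total-run v e f s m

  flag-irrelevant : ∀ v e f s m m′ → 0 < services (map kindYZ v) → run t (state e f s m) v ≡ run t (state e f s m′) v
  flag-irrelevant (X ∷ v) e f s m m′ p             = flag-irrelevant v (suc e) f s m m′ p
  flag-irrelevant (Y ∷ v) zero f s m m′ p          = flag-irrelevant v zero f (suc s) m m′ p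
  flag-irrelevant (Y ∷ v) (suc e) f s m m′ p       = flag-irrelevant v e (suc f) s m m′ p
  flag-irrelevant (Z ∷ v) e zero s m m′ p          = refl
  flag-irrelevant (Z ∷ v) e (suc f) s m m′ p       = refl
  flag-irrelevant (O ∷ v) e f s m m′ p             = flag-irrelevant v e f s m m′ p

  Stationary : List Letter → State → Set
  Stationary v φ = run t φ v ≡ φ

  -- The first turn brings the three counts to their stationary values. Its flag may still stem from
  -- the empty start of the second queue, and the second turn corrects it.
  warm canonical : List Letter → State
  warm v = run t (state (waiting* v) 0 0 false) v
  canonical v = run t (warm v) v

  module _ {v : List Letter} (B : Balanced v) where
    open Balanced B

    private
      waiting-stat : final (waiting* v) (map kindXY v) ≡ waiting* v
      waiting-stat = stationary (map kindXY v) (<⇒≤ X<Y)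

      first-lt : ∀ {e} → final e (map kindXY v) ≡ e → arrivals (firstKinds e v) < services (firstKinds e v)
      first-lt {e} st = subst₂ _<_
        (sym (trans (firstKinds-arrivals e v) (served-count-stationary e (map kindXY v) st)))
        (sym (firstKinds-services e v))
        (<-trans X<Y (subst (_< services (map kindYZ v)) (sym (services≡arrivals v)) Y<Z))

      some-Z : 0 < services (map kindYZ v)
      some-Z = ≤-<-trans z≤n Y<Z

    warm-waiting : waiting (warm v) ≡ waiting* v
    warm-waiting = trans (waiting-run v (waiting* v) 0 0 false) waiting-stat

    warm-first : first (warm v) ≡ first* v
    warm-first = first-run v (waiting* v) 0 0 false

    warm-total : first (warm v) + second (warm v) ≡ total* v
    warm-total = total-run v (waiting* v) 0 0 false

    private
      same-counts : ∀ e f s m → waiting* v ≡ e → first* v ≡ f → total* v ≡ f + s →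
        let σ = run t (state e f s m) v in waiting σ ≡ e × first σ ≡ f × second σ ≡ s
      same-counts e f s m refl refl eq = w≡ , f≡ , +-cancelˡ-≡ f _ _
          (trans (cong (_+ second σ) (sym f≡)) (trans (total-run v e f s m)
            (trans (cong (λ q → final q (map kindYZ v)) (sym eq)) (trans (stationary (map kindYZ v) (<⇒≤ Y<Z)) eq))))
        where
        σ = run t (state e f s m) v
        w≡ = trans (waiting-run v e f s m) waiting-stat
        f≡ = trans (first-run v e f s m) (stationary (firstKinds e v) (<⇒≤ (first-lt waiting-stat)))

      rebuild : ∀ σ {e f s} → waiting σ ≡ e × first σ ≡ f × second σ ≡ s → σ ≡ state e f s (flag σ)
      rebuild (state e f s m) (refl , refl , refl) = refl

    canonical-stationary : Stationary v (canonical v)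
    canonical-stationary = trans (cong (λ σ → run t σ v) canonical≡)
      (trans (flag-irrelevant v (waiting* v) (first* v) s₀ _ _ some-Z) (cong (λ σ → run t σ v) (sym warm≡)))
      where
      s₀ = second (warm v)
      warm≡ : warm v ≡ state (waiting* v) (first* v) s₀ (flag (warm v))
      warm≡ = rebuild (warm v) (warm-waiting , warm-first , refl)
      canonical≡ : canonical v ≡ state (waiting* v) (first* v) s₀ (flag (canonical v))
      canonical≡ = rebuild (canonical v) (subst (λ σ → waiting (run t σ v) ≡ waiting* v × first (run t σ v) ≡ first* v × second (run t σ v) ≡ s₀)
        (sym warm≡) (same-counts (waiting* v) (first* v) s₀ (flag (warm v)) refl refl
          (trans (sym warm-total) (cong (_+ s₀) warm-first))))

    stationary-counts : ∀ {e f s m} → Stationary v (state e f s m) → e ≡ waiting* v × f ≡ first* v × f + s ≡ total* v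
    stationary-counts {e} {f} {s} {m} st = e≡ , f≡ , τ≡
      where
      e-st : final e (map kindXY v) ≡ e
      e-st = trans (sym (waiting-run v e f s m)) (cong waiting st)
      e≡ = stationary-unique e (map kindXY v) X<Y e-st
      f≡ : f ≡ first* v
      f≡ = trans (stationary-unique f (firstKinds e v) (first-lt e-st) (trans (sym (first-run v e f s m)) (cong first st)))
             (cong (λ e → final 0 (firstKinds e v)) e≡)
      τ≡ = stationary-unique (f + s) (map kindYZ v) Y<Z
             (trans (sym (total-run v e f s m)) (cong (λ σ → first σ + second σ) st))

    -- The counts are forced by uniqueness for the first queue, for the first-class customers and
    -- for the total; the initial flag is forgotten because some Z occurs.
    stationary-state-unique : ∀ φ ψ → Stationary v φ → Stationary v ψ → φ ≡ ψ
    stationary-state-unique (state e f s m) (state e′ f′ s′ m′) p q with stationary-counts p | stationary-counts q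
    ... | refl , refl , eq | refl , refl , eq′ with +-cancelˡ-≡ (first* v) s s′ (trans eq (sym eq′))
    ...   | refl = trans (sym p) (trans (flag-irrelevant v e f s m m′ some-Z) q)

  output : Letter → State → ℕ
  output Z σ = done σ
  output X σ = 0
  output Y σ = 0
  output O σ = 0

  outputs : State → List Letter → ℕ
  outputs σ []      = 0
  outputs σ (c ∷ v) = output c σ + outputs (step t c σ) v

  cyclicOutputs firstOutput : List Letter → ℕ
  cyclicOutputs v = outputs (canonical v) v
  firstOutput []      = 0
  firstOutput (c ∷ v) = output c (canonical (c ∷ v))

  rotations : ℕ → List Letter → ℕ
  rotations zero    v = 0
  rotations (suc k) v = firstOutput v + rotations k (rotate v)

  -- By uniqueness the stationary state of the rotated word is the state one letter later, so
  -- following one turn amounts to looking at the first letter of each rotation.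
  rotations-outputs : ∀ u v → Balanced (u ++ v) → rotations (length u) (u ++ v) ≡ outputs (canonical (u ++ v)) u
  rotations-outputs []      v B = refl
  rotations-outputs (c ∷ u) v B = cong (output c φ +_) (begin
    rotations (length u) ((u ++ v) ++ [ c ])        ≡⟨ cong (rotations (length u)) (++-assoc u v [ c ]) ⟩
    rotations (length u) (u ++ (v ++ [ c ]))        ≡⟨ rotations-outputs u (v ++ [ c ]) B′ ⟩
    outputs (canonical (u ++ (v ++ [ c ]))) u       ≡⟨ cong (λ σ → outputs σ u) (stationary-state-unique B′ _ _ (canonical-stationary B′) st′) ⟩
    outputs (step t c φ) u                          ∎)
    where
    open ≡-Reasoning
    φ = canonical (c ∷ u ++ v)
    B′ : Balanced (u ++ (v ++ [ c ]))
    B′ = subst Balanced (++-assoc u v [ c ]) (balanced-rotate c (u ++ v) B)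
    st′ : Stationary (u ++ (v ++ [ c ])) (step t c φ)
    st′ = trans (cong (run t (step t c φ)) (sym (++-assoc u v [ c ])))
      (trans (run-++ t (step t c φ) (u ++ v) [ c ]) (cong (step t c) (canonical-stationary B)))

  cyclicOutputs-rotations : ∀ v → Balanced v → cyclicOutputs v ≡ rotations (length v) v
  cyclicOutputs-rotations v B = sym (subst (λ u → rotations (length v) u ≡ outputs (canonical u) v) (++-identityʳ v)
    (rotations-outputs v [] (subst Balanced (sym (++-identityʳ v)) B)))

  ∑W-rotations : ∀ k N x y z → ∑W N x y z (rotations k) ≡ k * ∑W N x y z firstOutput
  ∑W-rotations zero    N x y z = ∑W-zero N x y z
  ∑W-rotations (suc k) N x y z = trans (∑W-+ N x y z firstOutput (rotations k ∘ rotate))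
    (cong (∑W N x y z firstOutput +_) (trans (∑W-rotate N x y z (rotations k)) (∑W-rotations k N x y z)))

  ∑W-cyclicOutputs : ∀ N x y z → x < y → y < z → ∑W N x y z cyclicOutputs ≡ N * ∑W N x y z firstOutput
  ∑W-cyclicOutputs N x y z x<y y<z = trans
    (∑W-cong N x y z (λ v s → trans (cyclicOutputs-rotations v (shuffle-balanced x<y y<z s))
      (cong (λ k → rotations k v) (proj₂ (proj₂ (proj₂ (proj₂ (shuffle-counts s))))))))
    (∑W-rotations N N x y z)

  -- Two runs with the same total in the second queue merge once the last second-class customer that the first one creates is gone.
  couple-late : ∀ v e f₁ s₁ m₁ f₂ s₂ m₂ → f₁ + s₁ ≡ f₂ + s₂ → f₂ ≤ f₁ → 0 < s₁ →
    0 < second (run t (state e f₁ s₁ m₁) v) ⊎ run t (state e f₁ s₁ m₁) v ≡ run t (state e f₂ s₂ m₂) v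
  couple-late [] e f₁ s₁ m₁ f₂ s₂ m₂ eq le p = inj₁ p
  couple-late (X ∷ v) e f₁ s₁ m₁ f₂ s₂ m₂ eq le p = couple-late v (suc e) f₁ s₁ m₁ f₂ s₂ m₂ eq le p
  couple-late (Y ∷ v) zero f₁ s₁ m₁ f₂ s₂ m₂ eq le p =
    couple-late v zero f₁ (suc s₁) m₁ f₂ (suc s₂) m₂ (trans (+-suc f₁ s₁) (trans (cong suc eq) (sym (+-suc f₂ s₂)))) le (s≤s z≤n)
  couple-late (Y ∷ v) (suc e) f₁ s₁ m₁ f₂ s₂ m₂ eq le p = couple-late v e (suc f₁) s₁ m₁ (suc f₂) s₂ m₂ (cong suc eq) (s≤s le) p
  couple-late (Z ∷ v) e zero s₁ m₁ zero .s₁ m₂ refl le p = inj₂ refl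
  couple-late (Z ∷ v) e (suc f₁) s₁ m₁ zero s₂ m₂ eq le p = couple-late v e f₁ s₁ true zero (pred s₂) _ (cong pred eq) z≤n p
  couple-late (Z ∷ v) e (suc f₁) s₁ m₁ (suc f₂) s₂ m₂ eq le p = couple-late v e f₁ s₁ true f₂ s₂ true (suc-injective eq) (s≤s⁻¹ le) p
  couple-late (O ∷ v) e f₁ s₁ m₁ f₂ s₂ m₂ eq le p = couple-late v e f₁ s₁ m₁ f₂ s₂ m₂ eq le p

  -- As long as the longer first queue never idles, its length obeys the balance of the first
  -- alternative. When it idles, the shorter one is empty too; both first queues agree from then on,
  -- a second-class customer has just been created, and `couple-late` applies.
  couple : ∀ v e₁ f₁ s₁ m₁ e₂ f₂ s₂ m₂ → e₂ ≤ e₁ → f₁ + s₁ ≡ f₂ + s₂ → f₂ ≤ f₁ →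
    waiting (run t (state e₁ f₁ s₁ m₁) v) + services (map kindXY v) ≡ e₁ + arrivals (map kindXY v)
    ⊎ (0 < second (run t (state e₁ f₁ s₁ m₁) v) ⊎ run t (state e₁ f₁ s₁ m₁) v ≡ run t (state e₂ f₂ s₂ m₂) v)
  couple [] e₁ f₁ s₁ m₁ e₂ f₂ s₂ m₂ le eq le′ = inj₁ refl
  couple (X ∷ v) e₁ f₁ s₁ m₁ e₂ f₂ s₂ m₂ le eq le′ with couple v (suc e₁) f₁ s₁ m₁ (suc e₂) f₂ s₂ m₂ (s≤s le) eq le′
  ... | inj₁ p = inj₁ (trans p (sym (+-suc e₁ _)))
  ... | inj₂ p = inj₂ p
  couple (Y ∷ v) zero f₁ s₁ m₁ zero f₂ s₂ m₂ le eq le′ =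
    inj₂ (couple-late v zero f₁ (suc s₁) m₁ f₂ (suc s₂) m₂ (trans (+-suc f₁ s₁) (trans (cong suc eq) (sym (+-suc f₂ s₂)))) le′ (s≤s z≤n))
  couple (Y ∷ v) (suc e₁) f₁ s₁ m₁ zero f₂ s₂ m₂ le eq le′
    with couple v e₁ (suc f₁) s₁ m₁ zero f₂ (suc s₂) m₂ z≤n (trans (cong suc eq) (sym (+-suc f₂ s₂))) (m≤n⇒m≤1+n le′)
  ... | inj₁ p = inj₁ (trans (+-suc _ _) (cong suc p))
  ... | inj₂ p = inj₂ p
  couple (Y ∷ v) (suc e₁) f₁ s₁ m₁ (suc e₂) f₂ s₂ m₂ le eq le′
    with couple v e₁ (suc f₁) s₁ m₁ e₂ (suc f₂) s₂ m₂ (s≤s⁻¹ le) (cong suc eq) (s≤s le′)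
  ... | inj₁ p = inj₁ (trans (+-suc _ _) (cong suc p))
  ... | inj₂ p = inj₂ p
  couple (Z ∷ v) e₁ zero s₁ m₁ e₂ zero .s₁ m₂ le refl le′ = couple v e₁ zero (pred s₁) _ e₂ zero (pred s₁) _ le refl z≤n
  couple (Z ∷ v) e₁ (suc f₁) s₁ m₁ e₂ zero s₂ m₂ le eq le′ = couple v e₁ f₁ s₁ true e₂ zero (pred s₂) _ le (cong pred eq) z≤n
  couple (Z ∷ v) e₁ (suc f₁) s₁ m₁ e₂ (suc f₂) s₂ m₂ le eq le′ = couple v e₁ f₁ s₁ true e₂ f₂ s₂ true le (suc-injective eq) (s≤s⁻¹ le′)
  couple (O ∷ v) e₁ f₁ s₁ m₁ e₂ f₂ s₂ m₂ le eq le′ = couple v e₁ f₁ s₁ m₁ e₂ f₂ s₂ m₂ le eq le′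

  done-busy : ∀ σ → first σ + second σ ≢ 0 → done σ ≡ 0
  done-busy (state e zero zero m) p = ⊥-elim (p refl)
  done-busy (state e zero (suc s) m) p = refl
  done-busy (state e (suc f) s m) p = refl

  -- If the second queue is empty before the leading Z, the stationary run is coupled with the run
  -- from `start`. The balance alternative would force as many X as Y, against strict inequality,
  -- and no second-class customer can remain because the run returns to an empty second queue; so
  -- the runs merge. If the second queue is not empty, both sides vanish, as the total length does
  -- not depend on the first queue.
  firstOutput-linear : ∀ v → Balanced (Z ∷ v) → firstOutput (Z ∷ v) ≡ done (run t start v)
  firstOutput-linear v B = by-cases (canonical (Z ∷ v)) (canonical-stationary B)
    where
    by-cases : ∀ φ → Stationary (Z ∷ v) φ → done φ ≡ done (run t start v)
    by-cases φ@(state e zero zero m) st = cong done merged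
      where
      st′ : run t (state e 0 0 false) v ≡ φ
      st′ = trans (cong (λ b → run t (state e 0 0 b) v) (sym (idle t))) st
        where
        idle : ∀ t → (if t then false else false) ≡ false
        idle true  = refl
        idle false = refl
      merged : φ ≡ run t start v
      merged with couple v e 0 0 false 0 0 0 false z≤n refl z≤n
      ... | inj₁ p = ⊥-elim (<-irrefl (sym (+-cancelˡ-≡ e _ _ (trans (cong (λ σ → waiting σ + services (map kindXY v)) (sym st′)) p))) (Balanced.X<Y B))
      ... | inj₂ (inj₁ p) = ⊥-elim (<-irrefl refl (subst (0 <_) (cong second st′) p))
      ... | inj₂ (inj₂ p) = trans (sym st′) p
    by-cases φ@(state e zero (suc s) m) st = sym (done-busy (run t start v)
      (λ z → 1+n≢0 (trans (proj₂ (proj₂ (stationary-counts B st))) (trans (sym (total-run v 0 0 0 false)) z))))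
    by-cases φ@(state e (suc f) s m) st = sym (done-busy (run t start v)
      (λ z → 1+n≢0 (trans (proj₂ (proj₂ (stationary-counts B st))) (trans (sym (total-run v 0 0 0 false)) z))))

  ∑W-firstOutput : ∀ N x y z → x < y → y < suc z → ∑W (suc N) x y (suc z) firstOutput ≡ count t done N x y z
  ∑W-firstOutput N x y z x<y y<z = cong₂ _+_
    (cong₂ _+_ (below-zero x (λ k → ∑W-zero N k y (suc z))) (below-zero y (λ k → ∑W-zero N x k (suc z))))
    (∑W-cong N x y z (λ v s → firstOutput-linear v (shuffle-balanced x<y y<z (Z∷ s))))

-- Discarding letters

∑-zero : {A : Set} (xs : List A) → ∑ xs (λ _ → 0) ≡ 0
∑-zero []       = refl
∑-zero (x ∷ xs) = ∑-zero xs

∑-+ : {A : Set} (xs : List A) (f g : A → ℕ) → ∑ xs (λ x → f x + g x) ≡ ∑ xs f + ∑ xs g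
∑-+ []       f g = refl
∑-+ (x ∷ xs) f g = trans (cong ((f x + g x) +_) (∑-+ xs f g))
  (solve 4 (λ a b c d → (a :+ b) :+ (c :+ d) := (a :+ c) :+ (b :+ d)) refl (f x) (g x) (∑ xs f) (∑ xs g))
  where open +-*-Solver

∑-* : {A : Set} (xs : List A) (f : A → ℕ) (v : ℕ) → ∑ xs (λ x → f x * v) ≡ ∑ xs f * v
∑-* []       f v = refl
∑-* (x ∷ xs) f v = trans (cong (f x * v +_) (∑-* xs f v)) (sym (*-distribʳ-+ v (f x) (∑ xs f)))

∑-exchange : {A B : Set} (xs : List A) (ys : List B) (f : A → B → ℕ) →
  ∑ xs (λ x → ∑ ys (f x)) ≡ ∑ ys (λ y → ∑ xs (λ x → f x y))
∑-exchange []       ys f = sym (∑-zero ys)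
∑-exchange (x ∷ xs) ys f = trans (cong (∑ ys (f x) +_) (∑-exchange xs ys f)) (sym (∑-+ ys (f x) _))

∑-concatMap : {A B : Set} (g : A → List B) (xs : List A) (f : B → ℕ) → ∑ (concatMap g xs) f ≡ ∑ xs (λ x → ∑ (g x) f)
∑-concatMap g []       f = refl
∑-concatMap g (x ∷ xs) f = trans (∑-++ (g x) (concatMap g xs) f) (cong (∑ (g x) f +_) (∑-concatMap g xs f))

∑-map : {A B : Set} (g : A → B) (xs : List A) (f : B → ℕ) → ∑ (map g xs) f ≡ ∑ xs (f ∘ g)
∑-map g xs f = cong sum (sym (map-∘ xs))

∑-bfilter : {A : Set} (p : A → Bool) (xs : List A) (f : A → ℕ) → ∑ (bfilter p xs) f ≡ ∑ xs (λ x → 𝟙 (p x) * f x)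
∑-bfilter p []       f = refl
∑-bfilter p (x ∷ xs) f with p x
... | true  = cong₂ _+_ (sym (+-identityʳ (f x))) (∑-bfilter p xs f)
... | false = ∑-bfilter p xs f

∑-single : (xs : List ℕ) {a : ℕ} (v : ℕ) → Unique xs → a ∈ xs → ∑ xs (λ r → if r ≡ᵇ a then v else 0) ≡ v
∑-single (x ∷ xs) v (x∉ ∷ u) (here refl) rewrite ≡ᵇ-refl x = trans (cong (v +_)
  (trans (∑-cong xs (λ y y∈ → cong (λ b → if b then v else 0) (≢⇒≡ᵇ-false (≢-sym (All.lookup x∉ y∈))))) (∑-zero xs))) (+-identityʳ v)
∑-single (x ∷ xs) {a} v (x∉ ∷ u) (there a∈) rewrite ≢⇒≡ᵇ-false (All.lookup x∉ a∈) = ∑-single xs v u a∈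

set : (ℕ → ℕ) → ℕ → ℕ → ℕ → ℕ
set c r k r′ = if r′ ≡ᵇ r then k else c r′

set-same : ∀ c r k → set c r k r ≡ k
set-same c r k rewrite ≡ᵇ-refl r = refl

set-other : ∀ c r k {r′} → r′ ≢ r → set c r k r′ ≡ c r′
set-other c r k p rewrite ≢⇒≡ᵇ-false p = refl

hide : Bool → Letter → Letter
hide true  x = x
hide false X = O
hide false Y = Y
hide false Z = Z
hide false O = O

hide-Y : ∀ t → hide t Y ≡ Y
hide-Y true  = refl
hide-Y false = refl

hide-Z : ∀ t → hide t Z ≡ Z
hide-Z true  = refl
hide-Z false = refl

hide-O : ∀ t → hide t O ≡ O
hide-O true  = refl
hide-O false = refl

strip : List Letter → List Letter
strip []      = []
strip (X ∷ w) = X ∷ strip w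
strip (Y ∷ w) = Y ∷ strip w
strip (Z ∷ w) = Z ∷ strip w
strip (O ∷ w) = strip w

all-cong : {A : Set} {p q : A → Bool} (xs : List A) → (∀ x → x ∈ xs → p x ≡ q x) → all p xs ≡ all q xs
all-cong []       eq = refl
all-cong (x ∷ xs) eq = cong₂ _∧_ (eq x (here refl)) (all-cong xs (λ y p → eq y (there p)))

all-false : {A : Set} (p : A → Bool) (xs : List A) {x : A} → x ∈ xs → p x ≡ false → all p xs ≡ false
all-false p (x ∷ xs) (here refl) px rewrite px = refl
all-false p (y ∷ xs) (there x∈) px rewrite all-false p xs x∈ px with p y
... | true  = refl
... | false = refl

hasContent-∷ : ∀ {n} c r w → r ∈ oneTo n → 𝟙 (hasContent n c (r ∷ w)) ≡ below (c r) (λ k → 𝟙 (hasContent n (set c r k) w))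
hasContent-∷ {n} c r w r∈ with c r in eq
... | zero  = cong 𝟙 (all-false _ (oneTo n) r∈ (trans (cong₂ _≡ᵇ_ (trans (count-∷ r r w) (cong (λ b → (if b then 1 else 0) + countOcc r w) (≡ᵇ-refl r))) eq) refl))
... | suc k = cong 𝟙 (all-cong (oneTo n) pointwise)
  where
  pointwise : ∀ r′ → r′ ∈ oneTo n → (countOcc r′ (r ∷ w) ≡ᵇ c r′) ≡ (countOcc r′ w ≡ᵇ set c r k r′)
  pointwise r′ _ with r′ ≟ r
  ... | yes refl rewrite eq | ≡ᵇ-refl r = refl
  ... | no r′≢r rewrite ≢⇒≡ᵇ-false r′≢r | ≢⇒≡ᵇ-false (≢-sym r′≢r) = refl

below-* : ∀ k (f : ℕ → ℕ) v → below k (λ j → f j * v) ≡ below k f * v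
below-* zero    f v = refl
below-* (suc k) f v = refl

∑-below : {A : Set} (xs : List A) (k : ℕ) (f : ℕ → A → ℕ) → ∑ xs (λ x → below k (λ j → f j x)) ≡ below k (λ j → ∑ xs (f j))
∑-below xs zero    f = ∑-zero xs
∑-below xs (suc k) f = refl

isO : Letter → Bool
isO X = false
isO Y = false
isO Z = false
isO O = true

-- Words over the rows 1, …, p + 2; the last three rows are called X, Y, Z, where X is ignored unless t is true.
module Stripping (t : Bool) (p : ℕ) (1≤p : t ≡ true → 1 ≤ p) where

  n : ℕ
  n = suc (suc p)

  class : ℕ → Letter
  class r = hide t (letter p r)

  project : List ℕ → List Letter
  project w = strip (map class w)

  countX : (ℕ → ℕ) → ℕ
  countX c = if t then c p else 0

  countAll : (ℕ → ℕ) → ℕ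
  countAll c = countX c + c (suc p) + c (suc (suc p))

  ∑project : ℕ → (ℕ → ℕ) → (List Letter → ℕ) → ℕ
  ∑project L c Ψ = ∑ (words n L) (λ w → 𝟙 (hasContent n c w) * Ψ (project w))

  -- Number of ways of inserting the other letters, with multiplicities c, into a word of length s.
  insertions : ℕ → (ℕ → ℕ) → ℕ → ℕ
  insertions zero    c s = 𝟙 (all (λ r → not (isO (class r)) ∨ (0 ≡ᵇ c r)) (oneTo n) ∧ (0 ≡ᵇ s))
  insertions (suc L) c s = ∑ (oneTo n) (λ r → if isO (class r) then below (c r) (λ k → insertions L (set c r k) s) else 0)
                         + below s (λ s′ → insertions L c s′)

  insertions-cong : ∀ L {c c′} s → (∀ r → isO (class r) ≡ true → c r ≡ c′ r) → insertions L c s ≡ insertions L c′ s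
  insertions-cong zero {c} {c′} s eq = cong (λ b → 𝟙 (b ∧ (0 ≡ᵇ s))) (all-cong (oneTo n) pointwise)
    where
    pointwise : ∀ r → r ∈ oneTo n → not (isO (class r)) ∨ (0 ≡ᵇ c r) ≡ not (isO (class r)) ∨ (0 ≡ᵇ c′ r)
    pointwise r _ with isO (class r) in eqO
    ... | true  = cong (0 ≡ᵇ_) (eq r eqO)
    ... | false = refl
  insertions-cong (suc L) {c} {c′} s eq = cong₂ _+_ (∑-cong (oneTo n) (λ r _ → pointwise r))
    (below-cong s (λ s′ _ → insertions-cong L s′ eq))
    where
    pointwise : ∀ r → (if isO (class r) then below (c r) (λ k → insertions L (set c r k) s) else 0)
                    ≡ (if isO (class r) then below (c′ r) (λ k → insertions L (set c′ r k) s) else 0)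
    pointwise r with isO (class r) in eqO
    ... | false = refl
    ... | true rewrite eq r eqO = below-cong (c′ r) (λ k _ → insertions-cong L s (λ r′ o → agree r′ o k))
      where
      agree : ∀ r′ → isO (class r′) ≡ true → ∀ k → set c r k r′ ≡ set c′ r k r′
      agree r′ o k with r′ ≡ᵇ r
      ... | true  = refl
      ... | false = eq r′ o

  class-X : t ≡ true → class p ≡ X
  class-X eq = trans (cong (λ b → hide b (letter p p)) eq) (letter-X p)

  class-Y : class (suc p) ≡ Y
  class-Y = trans (cong (hide t) (letter-Y p)) (hide-Y t)

  class-Z : class (suc (suc p)) ≡ Z
  class-Z = trans (cong (hide t) (letter-Z p)) (hide-Z t)

  class-O : ∀ {r} → r ≢ p → r ≢ suc p → r ≢ suc (suc p) → class r ≡ O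
  class-O a b c = trans (cong (hide t) (letter-O a b c)) (hide-O t)

  class-p-hidden : t ≡ false → class p ≡ O
  class-p-hidden eq = trans (cong (λ b → hide b (letter p p)) eq) (cong (hide false) (letter-X p))

  ∑project-step : ∀ L c Ψ → ∑project (suc L) c Ψ ≡
    ∑ (oneTo n) (λ r → below (c r) (λ k → ∑project L (set c r k) (λ v → Ψ (strip (class r ∷ []) ++ v))))
  ∑project-step L c Ψ = begin
    ∑ (words n (suc L)) F
      ≡⟨ ∑-concatMap (λ w → map (λ r → r ∷ w) (oneTo n)) (words n L) F ⟩
    ∑ (words n L) (λ w → ∑ (map (λ r → r ∷ w) (oneTo n)) F)
      ≡⟨ ∑-cong (words n L) (λ w _ → ∑-map (λ r → r ∷ w) (oneTo n) F) ⟩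
    ∑ (words n L) (λ w → ∑ (oneTo n) (λ r → F (r ∷ w)))
      ≡⟨ ∑-exchange (words n L) (oneTo n) (λ w r → F (r ∷ w)) ⟩
    ∑ (oneTo n) (λ r → ∑ (words n L) (λ w → F (r ∷ w)))
      ≡⟨ ∑-cong (oneTo n) (λ r r∈ → trans (∑-cong (words n L) (λ w _ → letter-step r w r∈))
           (∑-below (words n L) (c r) (λ k w → 𝟙 (hasContent n (set c r k) w) * Ψ (strip (class r ∷ []) ++ project w)))) ⟩
    ∑ (oneTo n) (λ r → below (c r) (λ k → ∑project L (set c r k) (λ v → Ψ (strip (class r ∷ []) ++ v)))) ∎
    where
    open ≡-Reasoning
    F : List ℕ → ℕ
    F w = 𝟙 (hasContent n c w) * Ψ (project w)
    strip-∷ : ∀ x w → strip (x ∷ w) ≡ strip (x ∷ []) ++ strip w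
    strip-∷ X w = refl
    strip-∷ Y w = refl
    strip-∷ Z w = refl
    strip-∷ O w = refl
    letter-step : ∀ r w → r ∈ oneTo n → F (r ∷ w) ≡ below (c r) (λ k → 𝟙 (hasContent n (set c r k) w) * Ψ (strip (class r ∷ []) ++ project w))
    letter-step r w r∈ = trans (cong₂ _*_ (hasContent-∷ c r w r∈) (cong Ψ (strip-∷ (class r) (map class w))))
      (sym (below-* (c r) (λ k → 𝟙 (hasContent n (set c r k) w)) _))

  p∈ : t ≡ true → p ∈ oneTo n
  p∈ eq = ∈-oneTo⁺ (1≤p eq) (m≤n⇒m≤1+n (n≤1+n p))
  y∈ : suc p ∈ oneTo n
  y∈ = ∈-oneTo⁺ (s≤s z≤n) (n≤1+n (suc p))
  z∈ : suc (suc p) ∈ oneTo n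
  z∈ = ∈-oneTo⁺ (s≤s z≤n) ≤-refl

  ∑-class : ∀ (g : ℕ → ℕ) vx vy vz → (∀ r → isO (class r) ≡ true → g r ≡ 0) → (t ≡ true → g p ≡ vx) → (t ≡ false → vx ≡ 0) →
    g (suc p) ≡ vy → g (suc (suc p)) ≡ vz → ∑ (oneTo n) g ≡ vx + vy + vz
  ∑-class g vx vy vz go gx gx′ gy gz = begin
    ∑ (oneTo n) g
      ≡⟨ ∑-cong (oneTo n) (λ r _ → pointwise r) ⟩
    ∑ (oneTo n) (λ r → δ p vx r + δ (suc p) vy r + δ (suc (suc p)) vz r)
      ≡⟨ trans (∑-+ (oneTo n) (λ r → δ p vx r + δ (suc p) vy r) (δ (suc (suc p)) vz))
           (cong₂ _+_ (∑-+ (oneTo n) (δ p vx) (δ (suc p) vy)) refl) ⟩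
    ∑ (oneTo n) (δ p vx) + ∑ (oneTo n) (δ (suc p) vy) + ∑ (oneTo n) (δ (suc (suc p)) vz)
      ≡⟨ cong₂ _+_ (cong₂ _+_ sumX (∑-single (oneTo n) vy (oneTo-unique n) y∈)) (∑-single (oneTo n) vz (oneTo-unique n) z∈) ⟩
    vx + vy + vz ∎
    where
    open ≡-Reasoning
    δ : ℕ → ℕ → ℕ → ℕ
    δ a v r = if r ≡ᵇ a then v else 0
    δ-same : ∀ a v → δ a v a ≡ v
    δ-same a v rewrite ≡ᵇ-refl a = refl
    δ-other : ∀ {a r} v → r ≢ a → δ a v r ≡ 0
    δ-other v r≢a rewrite ≢⇒≡ᵇ-false r≢a = refl
    gp : ∀ b → t ≡ b → g p ≡ vx
    gp true  eq = gx eq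
    gp false eq = trans (go p (cong isO (class-p-hidden eq))) (sym (gx′ eq))
    sumX : ∑ (oneTo n) (δ p vx) ≡ vx
    sumX = by t refl
      where
      by : ∀ b → t ≡ b → ∑ (oneTo n) (δ p vx) ≡ vx
      by true  eq = ∑-single (oneTo n) vx (oneTo-unique n) (p∈ eq)
      by false eq rewrite gx′ eq = trans (∑-cong (oneTo n) (λ r _ → if-same (r ≡ᵇ p))) (∑-zero (oneTo n))
        where
        if-same : ∀ b → (if b then 0 else 0) ≡ 0
        if-same true  = refl
        if-same false = refl
    pointwise : ∀ r → g r ≡ δ p vx r + δ (suc p) vy r + δ (suc (suc p)) vz r
    pointwise r with view₃ p r
    ... | theX = trans (gp t refl) (sym (trans (cong₂ _+_ (cong₂ _+_ (δ-same p vx) (δ-other {suc r} {r} vy k≢1+k)) (δ-other {suc (suc r)} {r} vz (≢-sym 2+k≢k)))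
                   (trans (+-identityʳ _) (+-identityʳ _))))
    ... | theY = trans gy (sym (trans (cong₂ _+_ (cong₂ _+_ (δ-other {p} vx 1+n≢n) (δ-same (suc p) vy)) (δ-other {suc (suc p)} vz k≢1+k)) (+-identityʳ _)))
    ... | theZ = trans gz (sym (cong₂ _+_ (cong₂ _+_ (δ-other {p} vx 2+k≢k) (δ-other {suc p} vy 1+n≢n)) (δ-same (suc (suc p)) vz)))
    ... | theO a b c = trans (go r (cong isO (class-O a b c))) (sym (cong₂ _+_ (cong₂ _+_ (δ-other vx a) (δ-other vy b)) (δ-other vz c)))

  countX-true : t ≡ true → ∀ c → countX c ≡ c p
  countX-true eq c rewrite eq = refl

  countX-false : t ≡ false → ∀ c → countX c ≡ 0
  countX-false eq c rewrite eq = refl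

  O≢X : ∀ {r} → isO (class r) ≡ true → t ≡ true → r ≢ p
  O≢X o eq refl with trans (sym o) (cong isO (class-X eq))
  ... | ()

  O≢Y : ∀ {r} → isO (class r) ≡ true → r ≢ suc p
  O≢Y o refl with trans (sym o) (cong isO class-Y)
  ... | ()

  O≢Z : ∀ {r} → isO (class r) ≡ true → r ≢ suc (suc p)
  O≢Z o refl with trans (sym o) (cong isO class-Z)
  ... | ()

  countX-set-other : ∀ c r k → (t ≡ true → p ≢ r) → countX (set c r k) ≡ countX c
  countX-set-other c r k p≢r = by t refl
    where
    by : ∀ b → t ≡ b → countX (set c r k) ≡ countX c
    by true  eq = trans (countX-true eq (set c r k)) (trans (set-other c r k (p≢r eq)) (sym (countX-true eq c)))
    by false eq = trans (countX-false eq (set c r k)) (sym (countX-false eq c))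

  WΣ : (ℕ → ℕ) → (List Letter → ℕ) → ℕ
  WΣ c = ∑W (countAll c) (countX c) (c (suc p)) (c (suc (suc p)))

  ∑project-base : ∀ c Ψ → ∑project 0 c Ψ ≡ insertions 0 c (countAll c) * WΣ c Ψ
  ∑project-base c Ψ = trans (+-identityʳ _) (by (countX c) (c (suc p)) (c (suc (suc p))) refl refl refl)
    where
    impossible : ∀ {r k} s → r ∈ oneTo n → c r ≡ suc k → countAll c ≡ suc s →
      𝟙 (hasContent n c []) * Ψ [] ≡ insertions 0 c (countAll c) * WΣ c Ψ
    impossible s r∈ cr eq = trans (cong (λ b → 𝟙 b * Ψ []) (all-false (λ r → countOcc r [] ≡ᵇ c r) (oneTo n) r∈ (cong (0 ≡ᵇ_) cr)))
      (sym (cong (_* WΣ c Ψ) (trans (cong (insertions 0 c) eq) (cong 𝟙 (∧-zeroʳ _)))))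
    by : ∀ x y z → countX c ≡ x → c (suc p) ≡ y → c (suc (suc p)) ≡ z →
      𝟙 (hasContent n c []) * Ψ [] ≡ insertions 0 c (countAll c) * WΣ c Ψ
    by zero zero zero ex ey ez = cong₂ _*_
      (trans (cong 𝟙 (trans (all-cong (oneTo n) pointwise) (sym (∧-identityʳ _))))
        (cong (insertions 0 c) (sym all≡)))
      (sym (trans (cong (λ s → ∑W s (countX c) (c (suc p)) (c (suc (suc p))) Ψ) all≡) (go ex ey ez)))
      where
      all≡ : countAll c ≡ 0
      all≡ = cong₂ _+_ (cong₂ _+_ ex ey) ez
      go : ∀ {x y z} → x ≡ 0 → y ≡ 0 → z ≡ 0 → ∑W 0 x y z Ψ ≡ Ψ []
      go refl refl refl = refl
      zeroAt : ∀ r → isO (class r) ≡ false → c r ≡ 0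
      zeroAt r o with view₃ p r
      ... | theX = atX t refl
        where
        atX : ∀ b → t ≡ b → c r ≡ 0
        atX true  eq = trans (sym (countX-true eq c)) ex
        atX false eq with trans (sym o) (cong isO (class-p-hidden eq))
        ... | ()
      ... | theY = ey
      ... | theZ = ez
      ... | theO a b d with trans (sym o) (cong isO (class-O a b d))
      ...   | ()
      pointwise : ∀ r → r ∈ oneTo n → (countOcc r [] ≡ᵇ c r) ≡ not (isO (class r)) ∨ (0 ≡ᵇ c r)
      pointwise r _ with isO (class r) in o
      ... | true  = refl
      ... | false = cong (0 ≡ᵇ_) (zeroAt r o)
    by (suc x) y z ex ey ez = atX t refl
      where
      atX : ∀ b → t ≡ b → 𝟙 (hasContent n c []) * Ψ [] ≡ insertions 0 c (countAll c) * WΣ c Ψ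
      atX true  eq = impossible _ (p∈ eq) (trans (sym (countX-true eq c)) ex) (cong₂ _+_ (cong₂ _+_ ex ey) ez)
      atX false eq with trans (sym ex) (countX-false eq c)
      ... | ()
    by zero (suc y) z ex ey ez = impossible _ y∈ ey (cong₂ _+_ (cong₂ _+_ ex ey) ez)
    by zero zero (suc z) ex ey ez = impossible _ z∈ ez (cong₂ _+_ (cong₂ _+_ ex ey) ez)

  -- How many words have a given projection depends on the content alone, so the sum factorises. A
  -- hidden first letter is accounted for by `insertions`, and a visible one is the first letter of
  -- the projection.
  ∑project-strip : ∀ L c Ψ → ∑project L c Ψ ≡ insertions L c (countAll c) * WΣ c Ψ
  ∑project-strip zero    c Ψ = ∑project-base c Ψ
  ∑project-strip (suc L) c Ψ = begin
    ∑project (suc L) c Ψ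
      ≡⟨ ∑project-step L c Ψ ⟩
    ∑ (oneTo n) g
      ≡⟨ ∑-cong (oneTo n) (λ r _ → split (isO (class r)) (g r)) ⟩
    ∑ (oneTo n) (λ r → gO r + gN r)
      ≡⟨ ∑-+ (oneTo n) gO gN ⟩
    ∑ (oneTo n) gO + ∑ (oneTo n) gN
      ≡⟨ cong₂ _+_ (trans (∑-cong (oneTo n) (λ r _ → hidden r)) (∑-* (oneTo n) I (WΣ c Ψ))) (visible (countAll c) refl) ⟩
    ∑ (oneTo n) I * WΣ c Ψ + below (countAll c) (λ s → insertions L c s) * WΣ c Ψ
      ≡⟨ sym (*-distribʳ-+ (WΣ c Ψ) (∑ (oneTo n) I) _) ⟩
    insertions (suc L) c (countAll c) * WΣ c Ψ ∎
    where
    open ≡-Reasoning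
    g gO gN I : ℕ → ℕ
    g r = below (c r) (λ k → ∑project L (set c r k) (λ v → Ψ (strip (class r ∷ []) ++ v)))
    gO r = if isO (class r) then g r else 0
    gN r = if isO (class r) then 0 else g r
    I r = if isO (class r) then below (c r) (λ k → insertions L (set c r k) (countAll c)) else 0
    x = countX c
    y = c (suc p)
    z = c (suc (suc p))

    split : ∀ b v → v ≡ (if b then v else 0) + (if b then 0 else v)
    split true  v = sym (+-identityʳ v)
    split false v = refl

    hidden : ∀ r → gO r ≡ I r * WΣ c Ψ
    hidden r with class r in eq
    ... | X = refl
    ... | Y = refl
    ... | Z = refl
    ... | O = trans (below-cong (c r) (λ k _ → trans (∑project-strip L (set c r k) Ψ) (unchanged k))) (below-* (c r) _ (WΣ c Ψ))
      where
      o : isO (class r) ≡ true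
      o = cong isO eq
      unchanged : ∀ k → insertions L (set c r k) (countAll (set c r k)) * WΣ (set c r k) Ψ ≡ insertions L (set c r k) (countAll c) * WΣ c Ψ
      unchanged k rewrite countX-set-other c r k (λ e → ≢-sym (O≢X o e))
                        | set-other c r k (≢-sym (O≢Y o)) | set-other c r k (≢-sym (O≢Z o)) = refl

    vX vY vZ : ℕ → ℕ
    vX s = insertions L c s * below x (λ x′ → ∑W s x′ y z (Ψ ∘ (X ∷_)))
    vY s = insertions L c s * below y (λ y′ → ∑W s x y′ z (Ψ ∘ (Y ∷_)))
    vZ s = insertions L c s * below z (λ z′ → ∑W s x y z′ (Ψ ∘ (Z ∷_)))

    gN-O : ∀ r → isO (class r) ≡ true → gN r ≡ 0
    gN-O r o = cong (λ b → if b then 0 else g r) o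

    gN-kept : ∀ {r ℓ} → class r ≡ ℓ → isO ℓ ≡ false → gN r ≡ below (c r) (λ k → ∑project L (set c r k) (λ v → Ψ (strip (ℓ ∷ []) ++ v)))
    gN-kept refl o rewrite o = refl

    insert≡ : ∀ r k s → (∀ r′ → isO (class r′) ≡ true → r′ ≢ r) → insertions L (set c r k) s ≡ insertions L c s
    insert≡ r k s ne = insertions-cong L s (λ r′ o → set-other c r k (ne r′ o))

    pull : ∀ a k (f : ℕ → ℕ) → below k (λ j → a * f j) ≡ a * below k f
    pull a zero    f = sym (*-zeroʳ a)
    pull a (suc k) f = refl

    visible : ∀ s → countAll c ≡ s → ∑ (oneTo n) gN ≡ below s (λ s → insertions L c s) * ∑W s x y z Ψ
    visible zero eq = trans (∑-class gN 0 0 0 gN-O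
        (λ e → trans (gN-kept (class-X e) refl) (vanishes (trans (sym (countX-true e c)) x≡0)))
        (λ _ → refl) (trans (gN-kept class-Y refl) (vanishes y≡0)) (trans (gN-kept class-Z refl) (vanishes z≡0))) refl
      where
      vanishes : ∀ {k} {f : ℕ → ℕ} → k ≡ 0 → below k f ≡ 0
      vanishes refl = refl
      xy≡0 : x + y ≡ 0
      xy≡0 = m+n≡0⇒m≡0 (x + y) eq
      x≡0 : x ≡ 0
      x≡0 = m+n≡0⇒m≡0 x xy≡0
      y≡0 : y ≡ 0
      y≡0 = m+n≡0⇒n≡0 x xy≡0
      z≡0 : z ≡ 0
      z≡0 = m+n≡0⇒n≡0 (x + y) eq
    visible (suc s) eq = trans (∑-class gN (vX s) (vY s) (vZ s) gN-O caseX
        (λ e → trans (cong (λ k → insertions L c s * below k (λ x′ → ∑W s x′ y z (Ψ ∘ (X ∷_)))) (countX-false e c)) (*-zeroʳ (insertions L c s)))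
        caseY caseZ)
      (sym (trans (*-distribˡ-+ (insertions L c s) _ _) (cong (_+ vZ s) (*-distribˡ-+ (insertions L c s) _ _))))
      where
      caseX : t ≡ true → gN p ≡ vX s
      caseX e = trans (gN-kept (class-X e) refl) (trans (below-cong (c p) each)
        (trans (pull (insertions L c s) (c p) _) (cong (λ k → insertions L c s * below k (λ x′ → ∑W s x′ y z (Ψ ∘ (X ∷_)))) (sym (countX-true e c)))))
        where
        each : ∀ k → c p ≡ suc k → ∑project L (set c p k) (Ψ ∘ (X ∷_)) ≡ insertions L c s * ∑W s k y z (Ψ ∘ (X ∷_))
        each k cp = trans (∑project-strip L (set c p k) (Ψ ∘ (X ∷_))) (cong₂ _*_
            (trans (cong (insertions L (set c p k)) s≡) (insert≡ p k s (λ r′ o → O≢X o e)))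
            (trans (cong (λ s → ∑W s (countX (set c p k)) _ _ _) s≡)
              (cong₃ (λ a b d → ∑W s a b d (Ψ ∘ (X ∷_))) x≡ y≡ z≡)))
          where
          x≡ : countX (set c p k) ≡ k
          x≡ = trans (countX-true e (set c p k)) (set-same c p k)
          y≡ : set c p k (suc p) ≡ y
          y≡ = set-other c p k 1+n≢n
          z≡ : set c p k (suc (suc p)) ≡ z
          z≡ = set-other c p k 2+k≢k
          s≡ : countAll (set c p k) ≡ s
          s≡ = trans (cong₂ _+_ (cong₂ _+_ x≡ y≡) z≡)
            (suc-injective (trans (cong (λ x → x + y + z) (sym (trans (countX-true e c) cp))) eq))
      caseY : gN (suc p) ≡ vY s
      caseY = trans (gN-kept class-Y refl) (trans (below-cong y each) (pull (insertions L c s) y _))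
        where
        each : ∀ k → y ≡ suc k → ∑project L (set c (suc p) k) (Ψ ∘ (Y ∷_)) ≡ insertions L c s * ∑W s x k z (Ψ ∘ (Y ∷_))
        each k cp = trans (∑project-strip L (set c (suc p) k) (Ψ ∘ (Y ∷_))) (cong₂ _*_
            (trans (cong (insertions L (set c (suc p) k)) s≡) (insert≡ (suc p) k s (λ r′ o → O≢Y o)))
            (trans (cong (λ s → ∑W s (countX (set c (suc p) k)) _ _ _) s≡)
              (cong₃ (λ a b d → ∑W s a b d (Ψ ∘ (Y ∷_))) x≡ y≡ z≡)))
          where
          x≡ : countX (set c (suc p) k) ≡ x
          x≡ = countX-set-other c (suc p) k (λ _ → k≢1+k)
          y≡ : set c (suc p) k (suc p) ≡ k
          y≡ = set-same c (suc p) k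
          z≡ : set c (suc p) k (suc (suc p)) ≡ z
          z≡ = set-other c (suc p) k 1+n≢n
          s≡ : countAll (set c (suc p) k) ≡ s
          s≡ = trans (cong₂ _+_ (cong₂ _+_ x≡ y≡) z≡)
            (suc-injective (trans (cong (_+ z) (trans (sym (+-suc x k)) (cong (x +_) (sym cp)))) eq))
      caseZ : gN (suc (suc p)) ≡ vZ s
      caseZ = trans (gN-kept class-Z refl) (trans (below-cong z each) (pull (insertions L c s) z _))
        where
        each : ∀ k → z ≡ suc k → ∑project L (set c (suc (suc p)) k) (Ψ ∘ (Z ∷_)) ≡ insertions L c s * ∑W s x y k (Ψ ∘ (Z ∷_))
        each k cp = trans (∑project-strip L (set c (suc (suc p)) k) (Ψ ∘ (Z ∷_))) (cong₂ _*_
            (trans (cong (insertions L (set c (suc (suc p)) k)) s≡) (insert≡ (suc (suc p)) k s (λ r′ o → O≢Z o)))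
            (trans (cong (λ s → ∑W s (countX (set c (suc (suc p)) k)) _ _ _) s≡)
              (cong₃ (λ a b d → ∑W s a b d (Ψ ∘ (Z ∷_))) x≡ y≡ z≡)))
          where
          x≡ : countX (set c (suc (suc p)) k) ≡ x
          x≡ = countX-set-other c (suc (suc p)) k (λ _ → ≢-sym 2+k≢k)
          y≡ : set c (suc (suc p)) k (suc p) ≡ y
          y≡ = set-other c (suc (suc p)) k k≢1+k
          z≡ : set c (suc (suc p)) k (suc (suc p)) ≡ k
          z≡ = set-same c (suc (suc p)) k
          s≡ : countAll (set c (suc (suc p)) k) ≡ s
          s≡ = trans (cong₂ _+_ (cong₂ _+_ x≡ y≡) z≡)
            (suc-injective (trans (trans (sym (+-suc (x + y) k)) (cong (x + y +_) (sym cp))) eq))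

  ∑wordsOf-strip : ∀ L c Ψ → ∑ (wordsOf n L c) (Ψ ∘ project) ≡ insertions L c (countAll c) * WΣ c Ψ
  ∑wordsOf-strip L c Ψ = trans (∑-bfilter (hasContent n c) (words n L) (Ψ ∘ project)) (∑project-strip L c Ψ)

-- Adjacent classes

lastFlag : Bool → List (Bool × Bool) → Bool
lastFlag m []            = m
lastFlag m ((a , b) ∷ l) = lastFlag a l

adjacent : Bool → List (Bool × Bool) → ℕ
adjacent m []            = 0
adjacent m ((a , b) ∷ l) = 𝟙 (m ∧ not b) + adjacent a l

-- Number of cyclically consecutive entries (a , b), (a′ , b′) with a and not b′.
cyclicAdjacent : List (Bool × Bool) → ℕ
cyclicAdjacent l = adjacent (lastFlag false l) l

-- For each entry of the last row: whether its label is at most `i` (it sets the flag) and whether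
-- it is at most `j` (it serves any customer at all).
pairs : Bool → State → List Letter → List (Bool × Bool)
pairs t σ []      = []
pairs t σ (X ∷ v) = pairs t (step t X σ) v
pairs t σ (Y ∷ v) = pairs t (step t Y σ) v
pairs t σ (Z ∷ v) = (flag (step t Z σ) , positive (first σ + second σ)) ∷ pairs t (step t Z σ) v
pairs t σ (O ∷ v) = pairs t σ v

flag-XY : ∀ t σ → flag (step t X σ) ≡ flag σ × flag (step t Y σ) ≡ flag σ
flag-XY t (state zero f s m)    = refl , refl
flag-XY t (state (suc e) f s m) = refl , refl

done-adjacent : ∀ σ → done σ ≡ 𝟙 (flag σ ∧ not (positive (first σ + second σ)))
done-adjacent (state e zero zero true)     = refl
done-adjacent (state e zero zero false)    = refl
done-adjacent (state e zero (suc s) true)  = refl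
done-adjacent (state e zero (suc s) false) = refl
done-adjacent (state e (suc f) s true)     = refl
done-adjacent (state e (suc f) s false)    = refl

outputs-adjacent : ∀ t σ v → outputs t σ v ≡ adjacent (flag σ) (pairs t σ v)
outputs-adjacent t σ []      = refl
outputs-adjacent t σ (X ∷ v) = trans (outputs-adjacent t (step t X σ) v) (cong (λ m → adjacent m (pairs t (step t X σ) v)) (proj₁ (flag-XY t σ)))
outputs-adjacent t σ (Y ∷ v) = trans (outputs-adjacent t (step t Y σ) v) (cong (λ m → adjacent m (pairs t (step t Y σ) v)) (proj₂ (flag-XY t σ)))
outputs-adjacent t σ (Z ∷ v) = cong₂ _+_ (done-adjacent σ) (outputs-adjacent t (step t Z σ) v)
outputs-adjacent t σ (O ∷ v) = outputs-adjacent t σ v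

flag-run : ∀ t σ v → flag (run t σ v) ≡ lastFlag (flag σ) (pairs t σ v)
flag-run t σ []      = refl
flag-run t σ (X ∷ v) = trans (flag-run t (step t X σ) v) (cong (λ m → lastFlag m (pairs t (step t X σ) v)) (proj₁ (flag-XY t σ)))
flag-run t σ (Y ∷ v) = trans (flag-run t (step t Y σ) v) (cong (λ m → lastFlag m (pairs t (step t Y σ) v)) (proj₂ (flag-XY t σ)))
flag-run t σ (Z ∷ v) = flag-run t (step t Z σ) v
flag-run t σ (O ∷ v) = flag-run t σ v

-- Stationarity closes the cycle: the flag before the first letter is the one left by the last Z.
cyclicOutputs-adjacent : ∀ t v → Balanced v → cyclicOutputs t v ≡ cyclicAdjacent (pairs t (canonical t v) v)
cyclicOutputs-adjacent t v B = begin
  outputs t φ v                               ≡⟨ outputs-adjacent t φ v ⟩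
  adjacent (flag φ) l                         ≡⟨ cong (λ m → adjacent m l) (trans (cong flag (sym (canonical-stationary t B))) (flag-run t φ v)) ⟩
  adjacent (lastFlag (flag φ) l) l            ≡⟨ first-irrelevant (flag φ) l ⟩
  cyclicAdjacent l                            ∎
  where
  open ≡-Reasoning
  φ = canonical t v
  l = pairs t φ v
  first-irrelevant : ∀ m l → adjacent (lastFlag m l) l ≡ cyclicAdjacent l
  first-irrelevant m []      = refl
  first-irrelevant m (_ ∷ l) = refl

classes : Statistic
classes R A B = cyclicAdjacent (zip (select R A) (select R B))

-- First-class customers alone see the second of two queues in series; both classes together form
-- the queue fed by every Y. A single run with priorities therefore follows both departure processes
-- at once.
pairs-true : ∀ ℓ e f s m → zip (select (map isZ ℓ) (served f (map kindYZ (relabelXY e ℓ))))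
                               (select (map isZ ℓ) (served (f + s) (map kindYZ ℓ))) ≡ pairs true (state e f s m) (strip ℓ)
pairs-true []      e f s m             = refl
pairs-true (X ∷ ℓ) e f s m             = pairs-true ℓ (suc e) f s m
pairs-true (Y ∷ ℓ) zero f s m rewrite sym (+-suc f s) = pairs-true ℓ zero f (suc s) m
pairs-true (Y ∷ ℓ) (suc e) f s m       = pairs-true ℓ e (suc f) s m
pairs-true (Z ∷ ℓ) e zero s m          = cong (_ ∷_) (pairs-true ℓ e zero (pred s) false)
pairs-true (Z ∷ ℓ) e (suc f) s m       = cong (_ ∷_) (pairs-true ℓ e f s true)
pairs-true (O ∷ ℓ) e f s m             = pairs-true ℓ e f s m

-- With X hidden the first queue stays empty and every customer is second-class, which is why the
-- flag has to accept any service.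
pairs-false : ∀ ℓ s m → zip (select (map isZ ℓ) (served s (map kindYZ ℓ))) (select (map isZ ℓ) (served s (map kindYZ ℓ)))
                        ≡ pairs false (state 0 0 s m) (strip (map (hide false) ℓ))
pairs-false []      s m = refl
pairs-false (X ∷ ℓ) s m = pairs-false ℓ s m
pairs-false (Y ∷ ℓ) s m = pairs-false ℓ (suc s) m
pairs-false (Z ∷ ℓ) s m = cong (_ ∷_) (pairs-false ℓ (pred s) (positive s))
pairs-false (O ∷ ℓ) s m = pairs-false ℓ s m

module _ (k : Letter → Kind) (kO : k O ≡ oth) where

  final-strip : ∀ q ℓ → final q (map k (strip ℓ)) ≡ final q (map k ℓ)
  final-strip q []      = refl
  final-strip q (X ∷ ℓ) = final-strip _ ℓ
  final-strip q (Y ∷ ℓ) = final-strip _ ℓ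
  final-strip q (Z ∷ ℓ) = final-strip _ ℓ
  final-strip q (O ∷ ℓ) rewrite kO = final-strip q ℓ

  arrivals-strip : ∀ ℓ → arrivals (map k (strip ℓ)) ≡ arrivals (map k ℓ)
  arrivals-strip [] = refl
  arrivals-strip (X ∷ ℓ) = trans (arrivals-∷ (k X) _) (trans (cong (_+ arrivals [ k X ]) (arrivals-strip ℓ)) (sym (arrivals-∷ (k X) _)))
  arrivals-strip (Y ∷ ℓ) = trans (arrivals-∷ (k Y) _) (trans (cong (_+ arrivals [ k Y ]) (arrivals-strip ℓ)) (sym (arrivals-∷ (k Y) _)))
  arrivals-strip (Z ∷ ℓ) = trans (arrivals-∷ (k Z) _) (trans (cong (_+ arrivals [ k Z ]) (arrivals-strip ℓ)) (sym (arrivals-∷ (k Z) _)))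
  arrivals-strip (O ∷ ℓ) rewrite kO = arrivals-strip ℓ

  services-strip : ∀ ℓ → services (map k (strip ℓ)) ≡ services (map k ℓ)
  services-strip [] = refl
  services-strip (X ∷ ℓ) = trans (services-∷ (k X) _) (trans (cong (_+ services [ k X ]) (services-strip ℓ)) (sym (services-∷ (k X) _)))
  services-strip (Y ∷ ℓ) = trans (services-∷ (k Y) _) (trans (cong (_+ services [ k Y ]) (services-strip ℓ)) (sym (services-∷ (k Y) _)))
  services-strip (Z ∷ ℓ) = trans (services-∷ (k Z) _) (trans (cong (_+ services [ k Z ]) (services-strip ℓ)) (sym (services-∷ (k Z) _)))
  services-strip (O ∷ ℓ) rewrite kO = services-strip ℓ

first-strip : ∀ e f ℓ → final f (firstKinds e (strip ℓ)) ≡ final f (map kindYZ (relabelXY e ℓ))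
first-strip e f []            = refl
first-strip e f (X ∷ ℓ)       = first-strip (suc e) f ℓ
first-strip zero f (Y ∷ ℓ)    = first-strip zero f ℓ
first-strip (suc e) f (Y ∷ ℓ) = first-strip e (suc f) ℓ
first-strip e f (Z ∷ ℓ)       = first-strip e (pred f) ℓ
first-strip e f (O ∷ ℓ)       = first-strip e f ℓ

hidden-XY : ∀ ℓ → final 0 (map kindXY (map (hide false) ℓ)) ≡ 0 × arrivals (map kindXY (map (hide false) ℓ)) ≡ 0
hidden-XY []      = refl , refl
hidden-XY (X ∷ ℓ) = hidden-XY ℓ
hidden-XY (Y ∷ ℓ) = hidden-XY ℓ
hidden-XY (Z ∷ ℓ) = hidden-XY ℓ
hidden-XY (O ∷ ℓ) = hidden-XY ℓ

hidden-first : ∀ ℓ → final 0 (firstKinds 0 (strip (map (hide false) ℓ))) ≡ 0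
hidden-first []      = refl
hidden-first (X ∷ ℓ) = hidden-first ℓ
hidden-first (Y ∷ ℓ) = hidden-first ℓ
hidden-first (Z ∷ ℓ) = hidden-first ℓ
hidden-first (O ∷ ℓ) = hidden-first ℓ

hidden-YZ : ∀ ℓ → map kindYZ (map (hide false) ℓ) ≡ map kindYZ ℓ
hidden-YZ []      = refl
hidden-YZ (X ∷ ℓ) = cong (oth ∷_) (hidden-YZ ℓ)
hidden-YZ (Y ∷ ℓ) = cong (arr ∷_) (hidden-YZ ℓ)
hidden-YZ (Z ∷ ℓ) = cong (srv ∷_) (hidden-YZ ℓ)
hidden-YZ (O ∷ ℓ) = cong (oth ∷_) (hidden-YZ ℓ)

module _ (p : ℕ) (w : List ℕ) where

  private
    n = suc (suc p)
    ℓ = map (letter p) w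

  arrivals-XY : arrivals (map kindXY ℓ) ≡ countOcc p w
  arrivals-XY = trans (cong arrivals (sym (kinds-XY p w))) (arrivals-kind k≢1+k w)
  services-XY : services (map kindXY ℓ) ≡ countOcc (suc p) w
  services-XY = trans (cong services (sym (kinds-XY p w))) (services-kind k≢1+k w)
  arrivals-YZ : arrivals (map kindYZ ℓ) ≡ countOcc (suc p) w
  arrivals-YZ = trans (cong arrivals (sym (kinds-YZ p w))) (arrivals-kind k≢1+k w)
  services-YZ : services (map kindYZ ℓ) ≡ countOcc (suc (suc p)) w
  services-YZ = trans (cong services (sym (kinds-YZ p w))) (services-kind k≢1+k w)

  private
    B≡ : mask n (descend 1 (suc p) w) ≡ served (final 0 (map kindYZ ℓ)) (map kindYZ ℓ)
    B≡ = trans (mask-relabel k≢1+k _ w) (cong (λ K → served (final 0 K) K) (kinds-YZ p w))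

  classes-true : (Y<Z : countOcc (suc p) w < countOcc (suc (suc p)) w) → countOcc p w < countOcc (suc p) w →
    classes (mask n w) (mask n (descend 2 p w)) (mask n (descend 1 (suc p) w)) ≡ cyclicOutputs true (strip ℓ)
  classes-true Y<Z X<Y = begin
    classes (mask n w) (mask n (descend 2 p w)) (mask n (descend 1 (suc p) w))
      ≡⟨ cong₃ classes (mask-letter p w) A≡ B≡ ⟩
    cyclicAdjacent (zip (select (map isZ ℓ) (served f (map kindYZ (relabelXY e ℓ)))) (select (map isZ ℓ) (served τ (map kindYZ ℓ))))
      ≡⟨ cong cyclicAdjacent (at-canonical (canonical true v) (canonical-stationary true bal)) ⟩
    cyclicAdjacent (pairs true (canonical true v) v)
      ≡⟨ sym (cyclicOutputs-adjacent true v bal) ⟩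
    cyclicOutputs true v ∎
    where
    open ≡-Reasoning
    v = strip ℓ
    e = final 0 (map kindXY ℓ)
    f = final 0 (map kindYZ (relabelXY e ℓ))
    τ = final 0 (map kindYZ ℓ)
    bal : Balanced v
    bal = balanced
      (subst₂ _<_ (sym (trans (arrivals-strip kindXY refl ℓ) arrivals-XY)) (sym (trans (services-strip kindXY refl ℓ) services-XY)) X<Y)
      (subst₂ _<_ (sym (trans (arrivals-strip kindYZ refl ℓ) arrivals-YZ)) (sym (trans (services-strip kindYZ refl ℓ) services-YZ)) Y<Z)
    K≡ : kinds (suc p) (swap p w) ≡ map kindYZ (relabelXY e ℓ)
    K≡ = trans (kinds-YZ p (swap p w)) (cong (map kindYZ) (trans (letters-relabelXY p _ w) (cong (λ K → relabelXY (final 0 K) ℓ) (kinds-XY p w))))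
    A≡ : mask n (descend 2 p w) ≡ served f (map kindYZ (relabelXY e ℓ))
    A≡ = trans (mask-relabel k≢1+k _ (swap p w)) (cong (λ K → served (final 0 K) K) K≡)
    at-canonical : ∀ φ → Stationary true v φ →
      zip (select (map isZ ℓ) (served f (map kindYZ (relabelXY e ℓ)))) (select (map isZ ℓ) (served τ (map kindYZ ℓ))) ≡ pairs true φ v
    at-canonical (state e′ f′ s′ m′) st with stationary-counts true bal st
    ... | e≡ , f≡ , τ≡ = trans (cong₃ (λ e f τ → zip (select (map isZ ℓ) (served f (map kindYZ (relabelXY e ℓ)))) (select (map isZ ℓ) (served τ (map kindYZ ℓ))))
        (sym e″) (sym (trans f≡ (trans (cong (λ e → final 0 (firstKinds e v)) (final-strip kindXY refl 0 ℓ)) (first-strip e 0 ℓ))))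
        (sym (trans τ≡ (final-strip kindYZ refl 0 ℓ)))) (pairs-true ℓ e′ f′ s′ m′)
      where
      e″ : e′ ≡ e
      e″ = trans e≡ (final-strip kindXY refl 0 ℓ)

  classes-false : (Y<Z : countOcc (suc p) w < countOcc (suc (suc p)) w) → 0 < countOcc (suc p) w →
    classes (mask n w) (mask n (descend 1 (suc p) w)) (mask n (descend 1 (suc p) w)) ≡ cyclicOutputs false (strip (map (hide false) ℓ))
  classes-false Y<Z 0<Y = begin
    classes (mask n w) (mask n (descend 1 (suc p) w)) (mask n (descend 1 (suc p) w))
      ≡⟨ cong₃ classes (mask-letter p w) B≡ B≡ ⟩
    cyclicAdjacent (zip (select (map isZ ℓ) (served τ (map kindYZ ℓ))) (select (map isZ ℓ) (served τ (map kindYZ ℓ))))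
      ≡⟨ cong cyclicAdjacent (at-canonical (canonical false v) (canonical-stationary false bal)) ⟩
    cyclicAdjacent (pairs false (canonical false v) v)
      ≡⟨ sym (cyclicOutputs-adjacent false v bal) ⟩
    cyclicOutputs false v ∎
    where
    open ≡-Reasoning
    ℓ′ = map (hide false) ℓ
    v = strip ℓ′
    τ = final 0 (map kindYZ ℓ)
    arrYZ : arrivals (map kindYZ v) ≡ countOcc (suc p) w
    arrYZ = trans (arrivals-strip kindYZ refl ℓ′) (trans (cong arrivals (hidden-YZ ℓ)) arrivals-YZ)
    bal : Balanced v
    bal = balanced
      (subst₂ _<_ (sym (trans (arrivals-strip kindXY refl ℓ′) (proj₂ (hidden-XY ℓ)))) (sym (trans (services≡arrivals v) arrYZ)) 0<Y)
      (subst₂ _<_ (sym arrYZ) (sym (trans (services-strip kindYZ refl ℓ′) (trans (cong services (hidden-YZ ℓ)) services-YZ))) Y<Z)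
    at-canonical : ∀ φ → Stationary false v φ →
      zip (select (map isZ ℓ) (served τ (map kindYZ ℓ))) (select (map isZ ℓ) (served τ (map kindYZ ℓ))) ≡ pairs false φ v
    at-canonical (state e f s m) st with stationary-counts false bal st
    ... | e≡ , f≡ , τ≡ = trans (cong (λ τ → zip (select (map isZ ℓ) (served τ (map kindYZ ℓ))) (select (map isZ ℓ) (served τ (map kindYZ ℓ))))
        (sym (trans (trans (cong (_+ s) (sym f≡0)) τ≡) (trans (final-strip kindYZ refl 0 ℓ′) (cong (final 0) (hidden-YZ ℓ))))))
        (trans (pairs-false ℓ s m) (sym (cong₂ (λ e f → pairs false (state e f s m) v) e≡0 f≡0)))
      where
      w≡0 : waiting* v ≡ 0
      w≡0 = trans (final-strip kindXY refl 0 ℓ′) (proj₁ (hidden-XY ℓ))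
      e≡0 : e ≡ 0
      e≡0 = trans e≡ w≡0
      f≡0 : f ≡ 0
      f≡0 = trans f≡ (trans (cong (λ e → final 0 (firstKinds e v)) w≡0) (hidden-first ℓ))

-- Rotation contributes the factor `suc N`. Absorbing the leading Z turns `suc N` times the shorter
-- words into `suc z` times all words, and this `suc z` cancels one denominator of `count-done`.
∑W-cyclicOutputs-true : ∀ x y z g → x < y → z ≡ y + g →
  (suc z + y) * ∑W (x + y + suc z) x y (suc z) (cyclicOutputs true) ≡ x * suc g * shuffles (x + y + suc z) x y (suc z)
∑W-cyclicOutputs-true x y z g x<y z≡ rewrite +-suc (x + y) z = *-cancelˡ-≡ _ _ (suc z) (begin
  suc z * ((suc z + y) * ∑W (suc N) x y (suc z) (cyclicOutputs true))
    ≡⟨ cong (λ s → suc z * ((suc z + y) * s)) (trans (∑W-cyclicOutputs true (suc N) x y (suc z) x<y y<z)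
         (cong (suc N *_) (∑W-firstOutput true N x y z x<y y<z))) ⟩
  suc z * ((suc z + y) * (suc N * Q))
    ≡⟨ solve 4 (λ z y n q → (con 1 :+ z) :* ((con 1 :+ z :+ y) :* (n :* q)) := n :* ((con 1 :+ z) :* (con 1 :+ (y :+ z)) :* q)) refl z y (suc N) Q ⟩
  suc N * (suc z * suc (y + z) * Q)
    ≡⟨ cong (suc N *_) (count-done N x y z g refl (<⇒≤ x<y) z≡) ⟩
  suc N * (x * suc g * M)
    ≡⟨ solve 4 (λ n x g m → n :* (x :* g :* m) := x :* g :* (n :* m)) refl (suc N) x (suc g) M ⟩
  x * suc g * (suc N * M)
    ≡⟨ cong (x * suc g *_) (sym (absorb-z N x y z refl)) ⟩
  x * suc g * (suc z * shuffles (suc N) x y (suc z))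
    ≡⟨ solve 4 (λ z x g m → x :* g :* (z :* m) := z :* (x :* g :* m)) refl (suc z) x (suc g) (shuffles (suc N) x y (suc z)) ⟩
  suc z * (x * suc g * shuffles (suc N) x y (suc z)) ∎)
  where
  open ≡-Reasoning
  open +-*-Solver
  N = x + y + z
  Q = count true done N x y z
  M = shuffles N x y z
  y<z : y < suc z
  y<z = s≤s (≤-trans (m≤m+n y g) (≤-reflexive (sym z≡)))

∑W-cyclicOutputs-false : ∀ y z g → suc z ≡ suc y + g →
  (suc (suc z) + y) * ∑W (suc y + suc (suc z)) 0 (suc y) (suc (suc z)) (cyclicOutputs false)
  ≡ suc y * suc (suc g) * shuffles (suc y + suc (suc z)) 0 (suc y) (suc (suc z))
∑W-cyclicOutputs-false y z g z≡ rewrite +-suc y (suc z) = *-cancelˡ-≡ _ _ (suc (suc z)) (begin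
  suc (suc z) * ((suc (suc z) + y) * ∑W (suc (suc N)) 0 (suc y) (suc (suc z)) (cyclicOutputs false))
    ≡⟨ cong (λ s → suc (suc z) * ((suc (suc z) + y) * s)) (trans (∑W-cyclicOutputs false (suc (suc N)) 0 (suc y) (suc (suc z)) (s≤s z≤n) y<z)
         (cong (suc (suc N) *_) (∑W-firstOutput false (suc N) 0 (suc y) (suc z) (s≤s z≤n) y<z))) ⟩
  suc (suc z) * ((suc (suc z) + y) * (suc (suc N) * Q))
    ≡⟨ cong (λ k → suc (suc z) * (k * (suc (suc N) * Q))) N≡ ⟩
  suc (suc z) * (suc N * (suc (suc N) * Q))
    ≡⟨ solve 4 (λ z n m q → z :* (n :* (m :* q)) := n :* (m :* (z :* q))) refl (suc (suc z)) (suc N) (suc (suc N)) Q ⟩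
  suc N * (suc (suc N) * (suc (suc z) * Q))
    ≡⟨ cong (λ v → suc N * (suc (suc N) * v)) (count-done′ N y z g refl z≡) ⟩
  suc N * (suc (suc N) * (suc (suc g) * M))
    ≡⟨ solve 4 (λ n m g v → n :* (m :* (g :* v)) := m :* (g :* (n :* v))) refl (suc N) (suc (suc N)) (suc (suc g)) M ⟩
  suc (suc N) * (suc (suc g) * (suc N * M))
    ≡⟨ cong (λ v → suc (suc N) * (suc (suc g) * v)) (sym (absorb-z N 0 y (suc z) refl)) ⟩
  suc (suc N) * (suc (suc g) * (suc (suc z) * M₁))
    ≡⟨ solve 4 (λ m g z v → m :* (g :* (z :* v)) := z :* (g :* (m :* v))) refl (suc (suc N)) (suc (suc g)) (suc (suc z)) M₁ ⟩
  suc (suc z) * (suc (suc g) * (suc (suc N) * M₁))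
    ≡⟨ cong (λ v → suc (suc z) * (suc (suc g) * v)) (sym (absorb-y (suc N) 0 y (suc (suc z)) (+-suc y (suc z)))) ⟩
  suc (suc z) * (suc (suc g) * (suc y * M₂))
    ≡⟨ solve 4 (λ z g y v → z :* (g :* (y :* v)) := z :* (y :* g :* v)) refl (suc (suc z)) (suc (suc g)) (suc y) M₂ ⟩
  suc (suc z) * (suc y * suc (suc g) * M₂) ∎)
  where
  open ≡-Reasoning
  open +-*-Solver
  N = y + suc z
  Q = count false done (suc N) 0 (suc y) (suc z)
  M = shuffles N 0 y (suc z)
  M₁ = shuffles (suc N) 0 y (suc (suc z))
  M₂ = shuffles (suc (suc N)) 0 (suc y) (suc (suc z))
  y<z : suc y < suc (suc z)
  y<z = s≤s (≤-trans (m≤m+n (suc y) g) (≤-reflexive (sym z≡)))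
  N≡ : suc (suc z) + y ≡ suc N
  N≡ = cong suc (+-comm (suc z) y)

number : ℕ → ℕ → (ℕ → ℕ) → ℕ
number n L c = ∑ (wordsOf n L c) (λ _ → 1)

total-true : ∀ L p c {x y z} g → 1 ≤ p → c p ≡ x → c (suc p) ≡ y → c (suc (suc p)) ≡ suc z → x < y → z ≡ y + g →
  (suc z + y) * total (suc (suc p)) L c classes 2 p 1 (suc p) ≡ x * suc g * number (suc (suc p)) L c
total-true L p c {x} {y} {z} g 1≤p cx cy cz x<y z≡ = begin
  (suc z + y) * total n L c classes 2 p 1 (suc p)
    ≡⟨ cong ((suc z + y) *_) (trans (∑-cong (wordsOf n L c) pointwise) (∑wordsOf-strip L c (cyclicOutputs true))) ⟩
  (suc z + y) * (I * WΣ c (cyclicOutputs true))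
    ≡⟨ solve 3 (λ k i s → k :* (i :* s) := i :* (k :* s)) refl (suc z + y) I (WΣ c (cyclicOutputs true)) ⟩
  I * ((suc z + y) * WΣ c (cyclicOutputs true))
    ≡⟨ cong (λ s → I * ((suc z + y) * s)) (counts (cyclicOutputs true)) ⟩
  I * ((suc z + y) * ∑W (x + y + suc z) x y (suc z) (cyclicOutputs true))
    ≡⟨ cong (I *_) (∑W-cyclicOutputs-true x y z g x<y z≡) ⟩
  I * (x * suc g * shuffles (x + y + suc z) x y (suc z))
    ≡⟨ cong (λ s → I * (x * suc g * s)) (sym (counts (λ _ → 1))) ⟩
  I * (x * suc g * WΣ c (λ _ → 1))
    ≡⟨ solve 3 (λ i k s → i :* (k :* s) := k :* (i :* s)) refl I (x * suc g) (WΣ c (λ _ → 1)) ⟩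
  x * suc g * (I * WΣ c (λ _ → 1))
    ≡⟨ cong (x * suc g *_) (sym (∑wordsOf-strip L c (λ _ → 1))) ⟩
  x * suc g * number n L c ∎
  where
  open ≡-Reasoning
  open +-*-Solver
  open Stripping true p (λ _ → 1≤p)
  I = insertions L c (countAll c)
  counts : ∀ Ψ → WΣ c Ψ ≡ ∑W (x + y + suc z) x y (suc z) Ψ
  counts Ψ rewrite cx | cy | cz = refl
  pointwise : ∀ w → w ∈ wordsOf n L c →
    classes (mask n w) (mask n (descend 2 p w)) (mask n (descend 1 (suc p) w)) ≡ cyclicOutputs true (project w)
  pointwise w w∈ = classes-true p w
    (subst₂ _<_ (sym (trans (Word.content W (suc p) (s≤s z≤n) (n≤1+n (suc p))) cy)) (sym (trans (Word.content W n (s≤s z≤n) ≤-refl) cz))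
      (s≤s (≤-trans (m≤m+n y g) (≤-reflexive (sym z≡)))))
    (subst₂ _<_ (sym (trans (Word.content W p 1≤p (m≤n⇒m≤1+n (n≤1+n p))) cx)) (sym (trans (Word.content W (suc p) (s≤s z≤n) (n≤1+n (suc p))) cy)) x<y)
    where
    W : Word n L c w
    W = ∈-wordsOf⁻ {n} {L} {c} w∈

total-false : ∀ L p c {y z} g → c (suc p) ≡ suc y → c (suc (suc p)) ≡ suc (suc z) → suc z ≡ suc y + g →
  (suc (suc z) + y) * total (suc (suc p)) L c (λ R A _ → classes R A A) 1 (suc p) 0 (suc (suc p))
  ≡ suc y * suc (suc g) * number (suc (suc p)) L c
total-false L p c {y} {z} g cy cz z≡ = begin
  k * total n L c (λ R A _ → classes R A A) 1 (suc p) 0 (suc (suc p))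
    ≡⟨ cong (k *_) (trans (∑-cong (wordsOf n L c) pointwise) (∑wordsOf-strip L c (cyclicOutputs false))) ⟩
  k * (I * WΣ c (cyclicOutputs false))
    ≡⟨ solve 3 (λ k i s → k :* (i :* s) := i :* (k :* s)) refl k I (WΣ c (cyclicOutputs false)) ⟩
  I * (k * WΣ c (cyclicOutputs false))
    ≡⟨ cong (λ s → I * (k * s)) (counts (cyclicOutputs false)) ⟩
  I * (k * ∑W (suc y + suc (suc z)) 0 (suc y) (suc (suc z)) (cyclicOutputs false))
    ≡⟨ cong (I *_) (∑W-cyclicOutputs-false y z g z≡) ⟩
  I * (l * shuffles (suc y + suc (suc z)) 0 (suc y) (suc (suc z)))
    ≡⟨ cong (λ s → I * (l * s)) (sym (counts (λ _ → 1))) ⟩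
  I * (l * WΣ c (λ _ → 1))
    ≡⟨ solve 3 (λ i k s → i :* (k :* s) := k :* (i :* s)) refl I l (WΣ c (λ _ → 1)) ⟩
  l * (I * WΣ c (λ _ → 1))
    ≡⟨ cong (l *_) (sym (∑wordsOf-strip L c (λ _ → 1))) ⟩
  l * number n L c ∎
  where
  open ≡-Reasoning
  open +-*-Solver
  open Stripping false p (λ ())
  k = suc (suc z) + y
  l = suc y * suc (suc g)
  I = insertions L c (countAll c)
  counts : ∀ Ψ → WΣ c Ψ ≡ ∑W (suc y + suc (suc z)) 0 (suc y) (suc (suc z)) Ψ
  counts Ψ rewrite cy | cz = refl
  pointwise : ∀ w → w ∈ wordsOf n L c →
    classes (mask n w) (mask n (descend 1 (suc p) w)) (mask n (descend 1 (suc p) w)) ≡ cyclicOutputs false (project w)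
  pointwise w w∈ = trans (classes-false p w
    (subst₂ _<_ (sym cY) (sym (trans (Word.content W n (s≤s z≤n) ≤-refl) cz)) (s≤s (≤-trans (m≤m+n (suc y) g) (≤-reflexive (sym z≡)))))
    (subst (0 <_) (sym cY) (s≤s z≤n))) (cong (cyclicOutputs false ∘ strip) (sym (map-∘ w)))
    where
    W : Word n L c w
    W = ∈-wordsOf⁻ {n} {L} {c} w∈
    cY : countOcc (suc p) w ≡ suc y
    cY = trans (Word.content W (suc p) (s≤s z≤n) (n≤1+n (suc p))) cy

-- Row `i` is brought next to row `j`, then the pair next to the last row. The same transport of the
-- constant 1 compares the numbers of words. Here `suc u` is `n - j`.
total-distinct : ∀ L i t u → 1 ≤ i →
  let k = i + t; j = suc k; n = suc (suc (k + u)) in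
  (n + j) * total n L (λ r → r) classes (t + suc (suc u)) i (suc u) j ≡ i * suc u * number n L (λ r → r)
total-distinct L i t u 1≤i
  with lower-row {suc (suc (i + t + u))} {L} {i} t i (suc (suc u)) (suc u) (suc (i + t)) (λ r → r) 1≤i ≤-refl ≤-refl
         (s≤s (m≤n⇒m≤1+n (m≤m+n (i + t) u))) (lowered refl (λ m _ → refl))
... | c₁ , lowered size₁ above₁ , eq₁
  with lower-pair {L} {i} {suc (i + t)} u (i + t) c₁ (≤-trans 1≤i (m≤m+n i t)) (s≤s (m≤m+n i t)) ≤-refl size₁
         (lowered (above₁ (suc (i + t)) ≤-refl) (λ m lt → above₁ m (<-trans (n<1+n (i + t)) lt)))
... | c₂ , size₂ , lowered size₃ above₂ , eq₂ = begin
  (n + j) * total n L (λ r → r) classes (t + suc (suc u)) i (suc u) j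
    ≡⟨ cong ((n + j) *_) (trans (eq₁ classes) (eq₂ classes)) ⟩
  (n + j) * total n L c₂ classes 2 (k + u) 1 (suc (k + u))
    ≡⟨ total-true L (k + u) c₂ u (≤-trans 1≤i (≤-trans (m≤m+n i t) (m≤m+n (i + t) u))) size₂ size₃ (above₂ n ≤-refl) (s≤s (m≤m+n i t)) refl ⟩
  i * suc u * number n L c₂
    ≡⟨ cong (i * suc u *_) (sym (trans (eq₁ (λ _ _ _ → 1)) (eq₂ (λ _ _ _ → 1)))) ⟩
  i * suc u * number n L (λ r → r) ∎
  where
  open ≡-Reasoning
  k = i + t
  j = suc k
  n = suc (suc (k + u))

-- A single row has to be moved next to the last one. Here `n + y` is `n + j - 1` and `suc (suc u)`
-- is `n - j + 1`.
total-equal : ∀ L y u →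
  let j = suc y; n = suc (j + u) in
  (n + y) * total n L (λ r → r) (λ R A _ → classes R A A) (u + 1) j 0 n ≡ j * suc (suc u) * number n L (λ r → r)
total-equal L y u
  with lower-row {suc (suc y + u)} {L} {suc y} u (suc y) 1 0 (suc (suc y + u)) (λ r → r) (s≤s z≤n) ≤-refl ≤-refl ≤-refl
         (lowered refl (λ m _ → refl))
... | c₁ , lowered size₁ above₁ , eq₁ = begin
  (n + y) * total n L (λ r → r) (λ R A _ → classes R A A) (u + 1) j 0 n
    ≡⟨ cong ((n + y) *_) (eq₁ (λ R A _ → classes R A A)) ⟩
  (n + y) * total n L c₁ (λ R A _ → classes R A A) 1 (suc y + u) 0 n
    ≡⟨ total-false L (y + u) c₁ u size₁ (above₁ n ≤-refl) refl ⟩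
  j * suc (suc u) * number n L c₁
    ≡⟨ cong (j * suc (suc u) *_) (sym (eq₁ (λ _ _ _ → 1))) ⟩
  j * suc (suc u) * number n L (λ r → r) ∎
  where
  open ≡-Reasoning
  j = suc y
  n = suc (j + u)

-- Adjacent letters of the projected word

cyclicPairs : List ℕ → List (ℕ × ℕ)
cyclicPairs ω = zip ω (drop 1 ω ++ take 1 ω)

cyclicAdjacent-pairs : ∀ (f : ℕ → Bool × Bool) ω →
  cyclicAdjacent (map f ω) ≡ ∑ (cyclicPairs ω) (λ ab → 𝟙 (proj₁ (f (proj₁ ab)) ∧ not (proj₂ (f (proj₂ ab)))))
cyclicAdjacent-pairs f []      = refl
cyclicAdjacent-pairs f (x ∷ l) = trans (+-comm (F (lastFlag (proj₁ (f x)) (map f l)) x) _) (sym (go x l x))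
  where
  F : Bool → ℕ → ℕ
  F m b = 𝟙 (m ∧ not (proj₂ (f b)))
  go : ∀ x l y → ∑ (zip (x ∷ l) (l ++ [ y ])) (λ ab → F (proj₁ (f (proj₁ ab))) (proj₂ ab))
    ≡ adjacent (proj₁ (f x)) (map f l) + F (lastFlag (proj₁ (f x)) (map f l)) y
  go x []      y = +-identityʳ _
  go x (z ∷ l) y = trans (cong (F (proj₁ (f x)) z +_) (go z l y)) (sym (+-assoc (F (proj₁ (f x)) z) _ _))

data Position (k m : ℕ) : Set where
  lower : (m ≡ᵇ suc k) ≡ false → (m ≤ᵇ k) ≡ true  → (m ≤ᵇ suc k) ≡ true  → Position k m
  equal : (m ≡ᵇ suc k) ≡ true  → (m ≤ᵇ k) ≡ false → (m ≤ᵇ suc k) ≡ true  → Position k m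
  upper : (m ≡ᵇ suc k) ≡ false → (m ≤ᵇ k) ≡ false → (m ≤ᵇ suc k) ≡ false → Position k m

position : ∀ k m → Position k m
position k m with <-cmp m (suc k)
... | tri< m<k m≢k _ = lower (≢⇒≡ᵇ-false m≢k) (≤ᵇ-true (s≤s⁻¹ m<k)) (≤ᵇ-true (<⇒≤ m<k))
... | tri≈ _ refl _  = equal (≡ᵇ-refl k) (≤ᵇ-false {suc k} ≤-refl) (≤ᵇ-true {suc k} ≤-refl)
... | tri> _ m≢k k<m = upper (≢⇒≡ᵇ-false m≢k) (≤ᵇ-false (<-trans (n<1+n k) k<m)) (≤ᵇ-false k<m)

-- The indicator of a pair is the mixed second difference of the indicator of `a ≤ i` and `b > j`;
-- the subtracted terms stand on the left.
inclusion : ∀ i j a b →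
  𝟙 ((a ≡ᵇ suc i) ∧ (b ≡ᵇ suc j)) + 𝟙 ((a ≤ᵇ i) ∧ not (b ≤ᵇ j)) + 𝟙 ((a ≤ᵇ suc i) ∧ not (b ≤ᵇ suc j))
  ≡ 𝟙 ((a ≤ᵇ suc i) ∧ not (b ≤ᵇ j)) + 𝟙 ((a ≤ᵇ i) ∧ not (b ≤ᵇ suc j))
inclusion i j a b with position i a | position j b
... | lower p q r | lower p′ q′ r′ rewrite p | q | r | q′ | r′ = refl
... | lower p q r | equal p′ q′ r′ rewrite p | q | r | q′ | r′ = refl
... | lower p q r | upper p′ q′ r′ rewrite p | q | r | q′ | r′ = refl
... | equal p q r | lower p′ q′ r′ rewrite p | q | r | p′ | q′ | r′ = refl
... | equal p q r | equal p′ q′ r′ rewrite p | q | r | p′ | q′ | r′ = refl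
... | equal p q r | upper p′ q′ r′ rewrite p | q | r | p′ | q′ | r′ = refl
... | upper p q r | _              rewrite p | q | r = refl

occurrence : ∀ i a → 𝟙 (a ≡ᵇ suc i) + 𝟙 (a ≤ᵇ i) ≡ 𝟙 (a ≤ᵇ suc i)
occurrence i a with position i a
... | lower p q r rewrite p | q | r = refl
... | equal p q r rewrite p | q | r = refl
... | upper p q r rewrite p | q | r = refl

any-∑ : {A : Set} (p : A → Bool) (xs : List A) → ∑ xs (𝟙 ∘ p) ≤ 1 → 𝟙 (any p xs) ≡ ∑ xs (𝟙 ∘ p)
any-∑ p []       le = refl
any-∑ p (x ∷ xs) le with p x
... | true  = cong suc (sym (n≤0⇒n≡0 (s≤s⁻¹ le)))
... | false = any-∑ p xs le

∑-mono : {A : Set} (xs : List A) {f g : A → ℕ} → (∀ x → f x ≤ g x) → ∑ xs f ≤ ∑ xs g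
∑-mono []       le = z≤n
∑-mono (x ∷ xs) le = +-mono-≤ (le x) (∑-mono xs le)

∑-zip : (xs ys : List ℕ) (f : ℕ → ℕ) → ∑ (zip xs ys) (f ∘ proj₁) ≤ ∑ xs f
∑-zip []       ys       f = z≤n
∑-zip (x ∷ xs) []       f = z≤n
∑-zip (x ∷ xs) (y ∷ ys) f = +-monoʳ-≤ (f x) (∑-zip xs ys f)

-- Cyclically consecutive letters a, b with a ≤ i and b > j.
crossings : ℕ → ℕ → List ℕ → ℕ
crossings i j ω = cyclicAdjacent (map (λ l → (l ≤ᵇ i) , (l ≤ᵇ j)) ω)

-- `cycAdj` asks for existence whereas crossings are counted. The two agree because the letter
-- `suc i` occurs at most once.
cycAdj-crossings : ∀ i j ω → ∑ ω (λ a → 𝟙 (a ≡ᵇ suc i)) ≤ 1 →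
  𝟙 (cycAdj (suc i) (suc j) ω) + crossings i j ω + crossings (suc i) (suc j) ω ≡ crossings (suc i) j ω + crossings i (suc j) ω
cycAdj-crossings i j ω once = begin
  𝟙 (cycAdj (suc i) (suc j) ω) + crossings i j ω + crossings (suc i) (suc j) ω
    ≡⟨ cong₂ _+_ (cong₂ _+_ (any-∑ _ P (≤-trans (∑-mono P (λ ab → ∧-≤ (proj₁ ab ≡ᵇ suc i) (proj₂ ab ≡ᵇ suc j))) (≤-trans (∑-zip ω _ (λ a → 𝟙 (a ≡ᵇ suc i))) once)))
         (cyclicAdjacent-pairs _ ω)) (cyclicAdjacent-pairs _ ω) ⟩
  ∑ P (λ ab → 𝟙 ((proj₁ ab ≡ᵇ suc i) ∧ (proj₂ ab ≡ᵇ suc j))) + ∑ P (f i j) + ∑ P (f (suc i) (suc j))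
    ≡⟨ sym (trans (∑-+ P _ (f (suc i) (suc j))) (cong (_+ ∑ P (f (suc i) (suc j))) (∑-+ P _ (f i j)))) ⟩
  ∑ P (λ ab → 𝟙 ((proj₁ ab ≡ᵇ suc i) ∧ (proj₂ ab ≡ᵇ suc j)) + f i j ab + f (suc i) (suc j) ab)
    ≡⟨ ∑-cong P (λ ab _ → inclusion i j (proj₁ ab) (proj₂ ab)) ⟩
  ∑ P (λ ab → f (suc i) j ab + f i (suc j) ab)
    ≡⟨ ∑-+ P (f (suc i) j) (f i (suc j)) ⟩
  ∑ P (f (suc i) j) + ∑ P (f i (suc j))
    ≡⟨ sym (cong₂ _+_ (cyclicAdjacent-pairs _ ω) (cyclicAdjacent-pairs _ ω)) ⟩
  crossings (suc i) j ω + crossings i (suc j) ω ∎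
  where
  open ≡-Reasoning
  P = cyclicPairs ω
  f : ℕ → ℕ → ℕ × ℕ → ℕ
  f i j ab = 𝟙 ((proj₁ ab ≤ᵇ i) ∧ not (proj₂ ab ≤ᵇ j))
  ∧-≤ : ∀ a b → 𝟙 (a ∧ b) ≤ 𝟙 a
  ∧-≤ true  true  = ≤-refl
  ∧-≤ true  false = z≤n
  ∧-≤ false b     = z≤n

∑-trues : (p : ℕ → Bool) (ω : List ℕ) → ∑ ω (𝟙 ∘ p) ≡ trues (map p ω)
∑-trues p [] = refl
∑-trues p (x ∷ ω) with p x
... | true  = cong suc (∑-trues p ω)
... | false = ∑-trues p ω

crossings-none : ∀ i j ω → (∀ a → a ∈ ω → ∀ b → b ∈ ω → (a ≤ᵇ i) ∧ not (b ≤ᵇ j) ≡ false) → crossings i j ω ≡ 0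
crossings-none i j ω never = trans (cyclicAdjacent-pairs _ ω) (trans (∑-cong (cyclicPairs ω) (λ ab ab∈ → let p , q = from-zip ω _ ab∈ in
    cong 𝟙 (never _ p _ (rotated ω q)))) (∑-zero (cyclicPairs ω)))
  where
  from-zip : ∀ (xs ys : List ℕ) {ab} → ab ∈ zip xs ys → proj₁ ab ∈ xs × proj₂ ab ∈ ys
  from-zip (x ∷ xs) (y ∷ ys) (here refl) = here refl , here refl
  from-zip (x ∷ xs) (y ∷ ys) (there p)   = let a , b = from-zip xs ys p in there a , there b
  rotated : ∀ (ω : List ℕ) {b} → b ∈ drop 1 ω ++ take 1 ω → b ∈ ω
  rotated (x ∷ ω) b∈ = back ω b∈
    where
    back : ∀ l {b} → b ∈ l ++ [ x ] → b ∈ x ∷ l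
    back []      (here p)  = here p
    back (y ∷ l) (here p)  = there (here p)
    back (y ∷ l) (there p) with back l p
    ... | here q  = here q
    ... | there q = there (there q)

-- Queues may turn entries of row `n` into smaller letters but never create the letter `n`, so all
-- departures lie at entries of the last row and `select` loses none.
data Origin (n : ℕ) : List ℕ → List ℕ → Set where
  []  : Origin n [] []
  _∷_ : ∀ {x y u v} → (y ≡ n → x ≡ n) → Origin n u v → Origin n (x ∷ u) (y ∷ v)

origin-relabel : ∀ {n k s} → k ≢ n → ∀ q w → Origin n w (relabel k s q w)
origin-relabel k≢n q [] = []
origin-relabel {n} {k} {s} k≢n q (x ∷ w) = source ∷ origin-relabel k≢n _ w
  where
  source : emit k s q x ≡ n → x ≡ n
  source eq with (x ≡ᵇ s) ∧ not (positive q)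
  ... | true  = ⊥-elim (k≢n eq)
  ... | false = eq

origin-trans : ∀ {n u v w} → Origin n u v → Origin n v w → Origin n u w
origin-trans [] [] = []
origin-trans (p ∷ ps) (q ∷ qs) = (p ∘ q) ∷ origin-trans ps qs

origin-refl : ∀ {n} w → Origin n w w
origin-refl []      = []
origin-refl (x ∷ w) = (λ p → p) ∷ origin-refl w

origin-descend : ∀ {n} d k w → k + d ≤ n → Origin n w (descend d k w)
origin-descend zero    k w le = origin-refl w
origin-descend {n} (suc d) k w le = origin-trans (origin-relabel (<⇒≢ (≤-trans (s≤s (m≤m+n k d)) le′)) _ w)
  (origin-descend d (suc k) (swap k w) le′)
  where
  le′ : suc k + d ≤ n
  le′ = subst (_≤ n) (+-suc k d) le

select-origin : ∀ {n u v} → Origin n u v → trues (select (mask n u) (mask n v)) ≡ trues (mask n v)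
select-origin [] = refl
select-origin {n} (_∷_ {x} {y} p ps) with y ≡ᵇ n in eqy | x ≡ᵇ n in eqx
... | true  | true  = cong suc (select-origin ps)
... | false | true  = select-origin ps
... | false | false = select-origin ps
... | true  | false with trans (sym eqx) (trans (cong (_≡ᵇ n) (p (≡ᵇ-true⇒≡ y n eqy))) (≡ᵇ-refl n))
...   | ()

module _ {w : List ℕ} {n₀ : ℕ} (content : ∀ m → 1 ≤ m → m ≤ suc n₀ → countOcc m w ≡ m) where

  private
    n = suc n₀
    ω = projWord n w

  count-descend : ∀ d k v → k + d ≤ n → Agree (suc k) w v → countOcc k v ≤ k → countOcc (k + d) (descend d k v) ≡ countOcc k v
  count-descend zero    k v le ag lt = cong (λ m → countOcc m v) (+-identityʳ k)
  count-descend (suc d) k v le ag lt rewrite +-suc k d = trans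
    (count-descend d (suc k) (swap k v) le (agree-trans (agree-weaken ag) (relabel-agree _ v ≤-refl))
      (≤-trans (≤-reflexive served≡) (m≤n⇒m≤1+n lt))) served≡
    where
    v-lt : countOcc k v < countOcc (suc k) v
    v-lt = subst (countOcc k v <_) (trans (sym (content (suc k) (s≤s z≤n) (≤-trans (s≤s (m≤m+n k d)) le))) (agree-count ≤-refl ag)) (s≤s lt)
    served≡ : countOcc (suc k) (swap k v) ≡ countOcc k v
    served≡ = count-relabel-srv k≢1+k _ v (swap-stationary v v-lt)

  labels-at-most : ∀ j → 1 ≤ j → j < n → ∑ ω (λ a → 𝟙 (a ≤ᵇ j)) ≡ j
  labels-at-most j 1≤j j<n = begin
    ∑ ω (λ a → 𝟙 (a ≤ᵇ j))                                  ≡⟨ ∑-trues (_≤ᵇ j) ω ⟩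
    trues (map (_≤ᵇ j) ω)                                    ≡⟨ cong trues (projWord-departures {w} {n₀} content j 1≤j j<n) ⟩
    trues (select (mask n w) (mask n (descend (n ∸ j) j w))) ≡⟨ select-origin (origin-descend (n ∸ j) j w (≤-reflexive j+)) ⟩
    trues (mask n (descend (n ∸ j) j w))                     ≡⟨ sym (count-mask n (descend (n ∸ j) j w)) ⟩
    countOcc n (descend (n ∸ j) j w)                         ≡⟨ cong (λ m → countOcc m (descend (n ∸ j) j w)) (sym j+) ⟩
    countOcc (j + (n ∸ j)) (descend (n ∸ j) j w)             ≡⟨ count-descend (n ∸ j) j w (≤-reflexive j+) (agree-refl w) (≤-reflexive cj) ⟩
    countOcc j w                                             ≡⟨ cj ⟩
    j                                                        ∎
    where
    open ≡-Reasoning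
    j+ : j + (n ∸ j) ≡ n
    j+ = m+[n∸m]≡n (<⇒≤ j<n)
    cj : countOcc j w ≡ j
    cj = content j 1≤j (<⇒≤ j<n)

  label-once : ∀ i → suc i < n → ∑ ω (λ a → 𝟙 (a ≡ᵇ suc i)) ≤ 1
  label-once i i<n = at i i<n
    where
    split : ∀ i → suc i < n → ∑ ω (λ a → 𝟙 (a ≡ᵇ suc i)) + ∑ ω (λ a → 𝟙 (a ≤ᵇ i)) ≡ suc i
    split i i<n = trans (sym (∑-+ ω _ _)) (trans (∑-cong ω (λ a _ → occurrence i a)) (labels-at-most (suc i) (s≤s z≤n) i<n))
    at : ∀ i → suc i < n → ∑ ω (λ a → 𝟙 (a ≡ᵇ suc i)) ≤ 1
    at zero    i<n = ≤-trans (m≤m+n _ _) (≤-reflexive (split 0 i<n))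
    at (suc i) i<n = ≤-reflexive (+-cancelʳ-≡ (suc i) _ _
      (trans (cong (∑ ω (λ a → 𝟙 (a ≡ᵇ suc (suc i))) +_) (sym (labels-at-most (suc i) (s≤s z≤n) (<-trans (n<1+n (suc i)) i<n)))) (split (suc i) i<n)))

  crossings-classes : ∀ i j → 1 ≤ i → i < n → 1 ≤ j → j < n →
    crossings i j ω ≡ classes (mask n w) (mask n (descend (n ∸ i) i w)) (mask n (descend (n ∸ j) j w))
  crossings-classes i j 1≤i i<n 1≤j j<n = cong cyclicAdjacent (trans (pairing ω)
    (cong₂ zip (projWord-departures {w} {n₀} content i 1≤i i<n) (projWord-departures {w} {n₀} content j 1≤j j<n)))
    where
    pairing : ∀ ω → map (λ l → (l ≤ᵇ i) , (l ≤ᵇ j)) ω ≡ zip (map (_≤ᵇ i) ω) (map (_≤ᵇ j) ω)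
    pairing []      = refl
    pairing (l ∷ ω) = cong (_ ∷_) (pairing ω)

  crossings-zero : ∀ j → crossings 0 j ω ≡ 0
  crossings-zero j = crossings-none 0 j ω (λ a a∈ b _ → cong (_∧ not (b ≤ᵇ j)) (≤ᵇ-false (proj₁ (All.lookup (projWord-range {w} {n₀} content) a∈))))

  crossings-top : ∀ i → crossings i n ω ≡ 0
  crossings-top i = crossings-none i n ω (λ a _ b b∈ →
    trans (cong (λ c → (a ≤ᵇ i) ∧ not c) (≤ᵇ-true (proj₂ (All.lookup (projWord-range {w} {n₀} content) b∈)))) (∧-zeroʳ (a ≤ᵇ i)))

-- An explicit multiline queue, which shows that the denominator of the probability is not 0.
staircase : ℕ → List ℕ
staircase zero    = []
staircase (suc n) = replicate (suc n) (suc n) ++ staircase n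

count-++ : ∀ r u v → countOcc r (u ++ v) ≡ countOcc r u + countOcc r v
count-++ r []      v = refl
count-++ r (x ∷ u) v with x ≡ᵇ r
... | true  = cong suc (count-++ r u v)
... | false = count-++ r u v

count-replicate : ∀ r k → countOcc r (replicate k r) ≡ k
count-replicate r zero = refl
count-replicate r (suc k) rewrite ≡ᵇ-refl r = cong suc (count-replicate r k)

count-replicate-other : ∀ {r x} k → x ≢ r → countOcc r (replicate k x) ≡ 0
count-replicate-other zero x≢r = refl
count-replicate-other (suc k) x≢r rewrite ≢⇒≡ᵇ-false x≢r = count-replicate-other k x≢r

staircase-above : ∀ n r → n < r → countOcc r (staircase n) ≡ 0
staircase-above zero    r lt = refl
staircase-above (suc n) r lt = trans (count-++ r (replicate (suc n) (suc n)) (staircase n))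
  (cong₂ _+_ (count-replicate-other (suc n) (<⇒≢ lt)) (staircase-above n r (<-trans (n<1+n n) lt)))

staircase-word : ∀ n → Word n (tri n) (λ r → r) (staircase n)
staircase-word n = word (lengths n) (letters′ n) (contents n)
  where
  lengths : ∀ n → length (staircase n) ≡ tri n
  lengths zero    = refl
  lengths (suc n) = trans (length-++ (replicate (suc n) (suc n))) (cong₂ _+_ (length-replicate (suc n)) (lengths n))
  letters′ : ∀ n → All (λ x → 1 ≤ x × x ≤ n) (staircase n)
  letters′ zero    = []
  letters′ (suc n) = All.++⁺ (All.replicate⁺ (suc n) (s≤s z≤n , ≤-refl)) (All.map (λ (p , q) → p , m≤n⇒m≤1+n q) (letters′ n))
  contents : ∀ n r → 1 ≤ r → r ≤ n → countOcc r (staircase n) ≡ r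
  contents zero    r 1≤r r≤n = ⊥-elim (<⇒≱ 1≤r r≤n)
  contents (suc n) r 1≤r r≤n with r ≟ suc n
  ... | yes refl = trans (count-++ r (replicate r r) (staircase n))
                     (trans (cong₂ _+_ (count-replicate r r) (staircase-above n r ≤-refl)) (+-identityʳ r))
  ... | no r≢n   = trans (count-++ r (replicate (suc n) (suc n)) (staircase n))
                     (cong₂ _+_ (count-replicate-other (suc n) (≢-sym r≢n)) (contents n r 1≤r (s≤s⁻¹ (≤∧≢⇒< r≤n r≢n))))

-- Fractions and the final computation

frac-cong : ∀ a {b} c {d} → b ≢ 0 → d ≢ 0 → a * d ≡ c * b → frac a b ≡ frac c d
frac-cong a {zero}  c {d}     b≢0 d≢0 eq = ⊥-elim (b≢0 refl)
frac-cong a {suc b} c {zero}  b≢0 d≢0 eq = ⊥-elim (d≢0 refl)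
frac-cong a {suc b} c {suc d} b≢0 d≢0 eq = fromℚᵘ-cong {mkℚᵘ (ℤ.+ a) b} {mkℚᵘ (ℤ.+ c) d}
  (*≡* (trans (sym (ℤ.pos-* a (suc d))) (trans (cong ℤ.+_ eq) (ℤ.pos-* c (suc b)))))

frac-+ : ∀ a {b} c {d} → b ≢ 0 → d ≢ 0 → frac a b +ℚ frac c d ≡ frac (a * d + c * b) (b * d)
frac-+ a {zero}  c {d}     b≢0 d≢0 = ⊥-elim (b≢0 refl)
frac-+ a {suc b} c {zero}  b≢0 d≢0 = ⊥-elim (d≢0 refl)
frac-+ a {suc b} c {suc d} b≢0 d≢0 = toℚᵘ-injective (begin
  toℚᵘ (fromℚᵘ p +ℚ fromℚᵘ q)          ≈⟨ toℚᵘ-homo-+ (fromℚᵘ p) (fromℚᵘ q) ⟩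
  toℚᵘ (fromℚᵘ p) +ᵘ toℚᵘ (fromℚᵘ q)   ≈⟨ ℚᵘ.+-cong (toℚᵘ-fromℚᵘ p) (toℚᵘ-fromℚᵘ q) ⟩
  p +ᵘ q                               ≡⟨ cong (λ k → mkℚᵘ k (d + b * suc d)) numerators ⟩
  r                                    ≈⟨ ℚᵘ.≃-sym (toℚᵘ-fromℚᵘ r) ⟩
  toℚᵘ (fromℚᵘ r)                      ∎)
  where
  open import Relation.Binary.Reasoning.Setoid ℚᵘ.≃-setoid
  p = mkℚᵘ (ℤ.+ a) b
  q = mkℚᵘ (ℤ.+ c) d
  r = mkℚᵘ (ℤ.+ (a * suc d + c * suc b)) (d + b * suc d)
  numerators : (ℤ.+ a) ℤ.* (ℤ.+ suc d) ℤ.+ (ℤ.+ c) ℤ.* (ℤ.+ suc b) ≡ ℤ.+ (a * suc d + c * suc b)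
  numerators = trans (cong₂ ℤ._+_ (sym (ℤ.pos-* a (suc d))) (sym (ℤ.pos-* c (suc b)))) (sym (ℤ.pos-+ (a * suc d) (c * suc b)))

double-C : ∀ m → 2 * (suc m C 2) ≡ suc m * m
double-C zero    = refl
double-C (suc m) = begin
  2 * (suc (suc m) C 2)              ≡⟨ cong (2 *_) (sym (nCk+nC[k+1]≡[n+1]C[k+1] (suc m) 1)) ⟩
  2 * (suc m C 1 + suc m C 2)        ≡⟨ *-distribˡ-+ 2 (suc m C 1) (suc m C 2) ⟩
  2 * (suc m C 1) + 2 * (suc m C 2)  ≡⟨ cong₂ (λ a b → 2 * a + b) (nC1≡n (suc m)) (double-C m) ⟩
  2 * suc m + suc m * m              ≡⟨ solve 1 (λ m → con 2 :* (con 1 :+ m) :+ (con 1 :+ m) :* m := (con 2 :+ m) :* (con 1 :+ m)) refl m ⟩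
  suc (suc m) * suc m                ∎
  where
  open ≡-Reasoning
  open +-*-Solver

C≢0 : ∀ m → 1 ≤ m → suc m C 2 ≢ 0
C≢0 (suc m) _ eq = 1+n≢0 (trans (sym (double-C (suc m))) (cong (2 *_) eq))

∑crossings : ℕ → ℕ → ℕ → ℕ
∑crossings n i j = ∑ (MLQs n) (λ w → crossings i j (projWord n w))

queues : ℕ → ℕ
queues n = number n (tri n) (λ r → r)

queue-content : ∀ {n w} → w ∈ MLQs n → ∀ m → 1 ≤ m → m ≤ n → countOcc m w ≡ m
queue-content {n} w∈ = Word.content (∈-wordsOf⁻ {n} {tri n} {λ r → r} w∈)

queues≢0 : ∀ n → queues n ≢ 0
queues≢0 n eq = ⊥-elim (empty (MLQs n) eq (∈-wordsOf⁺ (staircase-word n)))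
  where
  empty : ∀ {w} (ws : List (List ℕ)) → ∑ ws (λ _ → 1) ≡ 0 → w ∈ ws → ⊥
  empty (w ∷ ws) () w∈

∑crossings-zero : ∀ n₀ j → ∑crossings (suc n₀) 0 j ≡ 0
∑crossings-zero n₀ j = trans (∑-cong (MLQs (suc n₀)) (λ w w∈ → crossings-zero {w} {n₀} (queue-content w∈) j)) (∑-zero (MLQs (suc n₀)))

∑crossings-top : ∀ n₀ i → ∑crossings (suc n₀) i (suc n₀) ≡ 0
∑crossings-top n₀ i = trans (∑-cong (MLQs (suc n₀)) (λ w w∈ → crossings-top {w} {n₀} (queue-content w∈) i)) (∑-zero (MLQs (suc n₀)))

∑crossings-interior : ∀ i t u → 1 ≤ i →
  let j = suc (i + t); n = suc j + u in (n + j) * ∑crossings n i j ≡ i * suc u * queues n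
∑crossings-interior i t u 1≤i = trans (cong ((n + j) *_) (∑-cong (MLQs n) pointwise)) (total-distinct (tri n) i t u 1≤i)
  where
  j = suc (i + t)
  n = suc j + u
  i<n : i < n
  i<n = s≤s (≤-trans (m≤m+n i t) (≤-trans (n≤1+n (i + t)) (m≤m+n (suc (i + t)) u)))
  j<n : j < n
  j<n = s≤s (m≤m+n j u)
  n∸i : n ∸ i ≡ t + suc (suc u)
  n∸i = trans (cong (_∸ i) (solve 3 (λ i t u → con 2 :+ (i :+ t :+ u) := i :+ (t :+ (con 2 :+ u))) refl i t u)) (m+n∸m≡n i (t + suc (suc u)))
    where open +-*-Solver
  n∸j : n ∸ j ≡ suc u
  n∸j = trans (cong (_∸ j) (sym (+-suc j u))) (m+n∸m≡n j (suc u))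
  pointwise : ∀ w → w ∈ MLQs n → crossings i j (projWord n w)
    ≡ classes (mask n w) (mask n (descend (t + suc (suc u)) i w)) (mask n (descend (suc u) j w))
  pointwise w w∈ = trans (crossings-classes {w} {j + u} (queue-content w∈) i j 1≤i i<n (s≤s z≤n) j<n)
    (cong₂ (λ d d′ → classes (mask n w) (mask n (descend d i w)) (mask n (descend d′ j w))) n∸i n∸j)

-- The borders `i = 0` and `j = n`, where both sides vanish, are included so that the four-term sum
-- has no exceptions.
∑crossings-distinct : ∀ {n i j} → i < j → j ≤ n → (n + j) * ∑crossings n i j ≡ i * (n ∸ j) * queues n
∑crossings-distinct {suc n₀} {zero} {j} i<j j≤n = trans (cong ((suc n₀ + j) *_) (∑crossings-zero n₀ j)) (*-zeroʳ (suc n₀ + j))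
∑crossings-distinct {zero} {suc i} {suc j} i<j ()
∑crossings-distinct {suc n₀} {suc i} {j} i<j j≤n with m≤n⇒m<n∨m≡n j≤n
... | inj₂ refl = trans (cong ((suc n₀ + suc n₀) *_) (∑crossings-top n₀ (suc i)))
  (trans (*-zeroʳ (suc n₀ + suc n₀)) (sym (trans (cong (λ d → suc i * d * queues (suc n₀)) (n∸n≡0 n₀)) (cong (_* queues (suc n₀)) (*-zeroʳ (suc i))))))
... | inj₁ j<n with m≤n⇒∃[o]m+o≡n i<j
...   | t , refl with m≤n⇒∃[o]m+o≡n j<n
...     | u , refl = trans (∑crossings-interior (suc i) t u (s≤s z≤n))
  (cong (λ d → suc i * d * queues (suc (suc (suc (i + t)) + u))) (sym (trans (cong (_∸ suc (suc (i + t))) (sym (+-suc (suc (suc (i + t))) u)))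
    (m+n∸m≡n (suc (suc (i + t))) (suc u)))))

∑crossings-equal : ∀ y u → let j = suc y; n = suc (j + u) in
  (n + y) * ∑crossings n j j ≡ j * suc (suc u) * queues n
∑crossings-equal y u = trans (cong ((n + y) *_) (∑-cong (MLQs n) pointwise)) (total-equal (tri n) y u)
  where
  j = suc y
  n = suc (j + u)
  j<n : j < n
  j<n = s≤s (m≤m+n j u)
  n∸j : n ∸ j ≡ u + 1
  n∸j = trans (cong (_∸ j) (trans (sym (+-suc j u)) (cong (j +_) (+-comm 1 u)))) (m+n∸m≡n j (u + 1))
  pointwise : ∀ w → w ∈ MLQs n → crossings j j (projWord n w)
    ≡ classes (mask n w) (mask n (descend (u + 1) j w)) (mask n (descend (u + 1) j w))
  pointwise w w∈ = trans (crossings-classes {w} {j + u} (queue-content w∈) j j (s≤s z≤n) j<n (s≤s z≤n) j<n)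
    (cong (λ d → classes (mask n w) (mask n (descend d j w)) (mask n (descend d j w))) n∸j)

adjacencies : ℕ → ℕ → ℕ → ℕ
adjacencies n i j = length (bfilter (λ w → cycAdj i j (projWord n w)) (MLQs n))

length-∑ : {A : Set} (xs : List A) → length xs ≡ ∑ xs (λ _ → 1)
length-∑ []       = refl
length-∑ (x ∷ xs) = cong suc (length-∑ xs)

adjacencies-crossings : ∀ n i j → suc i < n →
  adjacencies n (suc i) (suc j) + ∑crossings n i j + ∑crossings n (suc i) (suc j)
  ≡ ∑crossings n (suc i) j + ∑crossings n i (suc j)
adjacencies-crossings n@(suc n₀) i j i<n = begin
  adjacencies n (suc i) (suc j) + ∑crossings n i j + ∑crossings n (suc i) (suc j)
    ≡⟨ cong (λ s → s + ∑crossings n i j + ∑crossings n (suc i) (suc j)) (trans (length-∑ (bfilter p (MLQs n))) (trans (∑-bfilter p (MLQs n) (λ _ → 1))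
         (∑-cong (MLQs n) (λ w _ → *-identityʳ (𝟙 (p w)))))) ⟩
  ∑ (MLQs n) (𝟙 ∘ p) + ∑crossings n i j + ∑crossings n (suc i) (suc j)
    ≡⟨ sym (trans (∑-+ (MLQs n) _ _) (cong (_+ ∑crossings n (suc i) (suc j)) (∑-+ (MLQs n) _ _))) ⟩
  ∑ (MLQs n) (λ w → 𝟙 (p w) + crossings i j (projWord n w) + crossings (suc i) (suc j) (projWord n w))
    ≡⟨ ∑-cong (MLQs n) (λ w w∈ → cycAdj-crossings i j (projWord n w) (label-once {w} {n₀} (queue-content w∈) i i<n)) ⟩
  ∑ (MLQs n) (λ w → crossings (suc i) j (projWord n w) + crossings i (suc j) (projWord n w))
    ≡⟨ ∑-+ (MLQs n) _ _ ⟩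
  ∑crossings n (suc i) j + ∑crossings n i (suc j) ∎
  where
  open ≡-Reasoning
  p : List ℕ → Bool
  p w = cycAdj (suc i) (suc j) (projWord n w)

-- All four terms lie off the diagonal. After clearing the denominators `n + j` and `n + suc j` and
-- adding the subtracted terms to both sides, a polynomial identity in `i`, `j` and `u` remains.
adjacencies-far : ∀ n i j → suc i < j → suc j ≤ n →
  (n + suc j) * (n + j) * adjacencies n (suc i) (suc j) ≡ 2 * n * queues n
adjacencies-far n i j i<j j<n with m≤n⇒∃[o]m+o≡n j<n
... | u , refl = +-cancelʳ-≡ (D * (i * suc u * Q) + D′ * (suc i * u * Q)) _ _ (begin
  D * D′ * m + (D * (i * suc u * Q) + D′ * (suc i * u * Q))
    ≡⟨ cong (λ s → D * D′ * m + s) (cong₂ (λ a b → D * a + D′ * b) (sym (at j i (<-trans (n<1+n i) i<j) (<⇒≤ j<n) (suc u) n∸j)) (sym (at (suc j) (suc i) (m≤n⇒m≤1+n i<j) j<n u n∸j′))) ⟩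
  D * D′ * m + (D * (D′ * a) + D′ * (D * b))
    ≡⟨ solve 5 (λ D D′ a b m → D :* D′ :* m :+ (D :* (D′ :* a) :+ D′ :* (D :* b)) := D :* D′ :* (m :+ a :+ b)) refl D D′ a b m ⟩
  D * D′ * (m + a + b)
    ≡⟨ cong (D * D′ *_) (adjacencies-crossings n i j (<-trans i<j j<n)) ⟩
  D * D′ * (d + e)
    ≡⟨ solve 4 (λ D D′ d e → D :* D′ :* (d :+ e) := D :* (D′ :* d) :+ D′ :* (D :* e)) refl D D′ d e ⟩
  D * (D′ * d) + D′ * (D * e)
    ≡⟨ cong₂ (λ a b → D * a + D′ * b) (at j (suc i) i<j (<⇒≤ j<n) (suc u) n∸j) (at (suc j) i (<-trans (n<1+n i) (m≤n⇒m≤1+n i<j)) j<n u n∸j′) ⟩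
  D * (suc i * suc u * Q) + D′ * (i * u * Q)
    ≡⟨ solve 4 (λ i j u q →
         (con 1 :+ j :+ u :+ (con 1 :+ j)) :* ((con 1 :+ i) :* (con 1 :+ u) :* q) :+ (con 1 :+ j :+ u :+ j) :* (i :* u :* q)
         := con 2 :* (con 1 :+ j :+ u) :* q
            :+ ((con 1 :+ j :+ u :+ (con 1 :+ j)) :* (i :* (con 1 :+ u) :* q) :+ (con 1 :+ j :+ u :+ j) :* ((con 1 :+ i) :* u :* q))) refl i j u Q ⟩
  2 * n * Q + (D * (i * suc u * Q) + D′ * (suc i * u * Q)) ∎)
  where
  open ≡-Reasoning
  open +-*-Solver
  D = n + suc j
  D′ = n + j
  Q = queues n
  a = ∑crossings n i j
  b = ∑crossings n (suc i) (suc j)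
  m = adjacencies n (suc i) (suc j)
  d = ∑crossings n (suc i) j
  e = ∑crossings n i (suc j)
  n∸j : n ∸ j ≡ suc u
  n∸j = trans (cong (_∸ j) (sym (+-suc j u))) (m+n∸m≡n j (suc u))
  n∸j′ : n ∸ suc j ≡ u
  n∸j′ = m+n∸m≡n j u
  at : ∀ j i → i < j → j ≤ n → ∀ v → n ∸ j ≡ v → (n + j) * ∑crossings n i j ≡ i * v * Q
  at j i i<j j≤n v refl = ∑crossings-distinct i<j j≤n

-- One of the four terms is now on the diagonal and has the denominator `n + i`. This is the origin
-- of the second summand in the theorem.
adjacencies-next : ∀ n i → suc (suc i) ≤ n →
  let D = n + suc (suc i); D′ = n + suc i; D″ = n + i in
  D * D′ * D″ * adjacencies n (suc i) (suc (suc i)) ≡ (2 * n * D″ + 2 * (n * suc i) * D) * queues n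
adjacencies-next n i i<n with m≤n⇒∃[o]m+o≡n i<n
... | u , refl = +-cancelʳ-≡ (D * D″ * (i * suc u * Q) + D′ * D″ * (suc i * u * Q)) _ _ (begin
  D * D′ * D″ * m + (D * D″ * (i * suc u * Q) + D′ * D″ * (suc i * u * Q))
    ≡⟨ cong (λ s → D * D′ * D″ * m + s) (cong₂ (λ a b → D * D″ * a + D′ * D″ * b) (sym (at (suc i) i ≤-refl (<⇒≤ i<n) (suc u) n∸i)) (sym (at (suc (suc i)) (suc i) ≤-refl i<n u n∸i′))) ⟩
  D * D′ * D″ * m + (D * D″ * (D′ * a) + D′ * D″ * (D * b))
    ≡⟨ solve 6 (λ D D′ D″ a b m → D :* D′ :* D″ :* m :+ (D :* D″ :* (D′ :* a) :+ D′ :* D″ :* (D :* b)) := D :* D′ :* D″ :* (m :+ a :+ b)) refl D D′ D″ a b m ⟩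
  D * D′ * D″ * (m + a + b)
    ≡⟨ cong (D * D′ * D″ *_) (adjacencies-crossings n i (suc i) i<n) ⟩
  D * D′ * D″ * (d + e)
    ≡⟨ solve 5 (λ D D′ D″ d e → D :* D′ :* D″ :* (d :+ e) := D :* D′ :* (D″ :* d) :+ D′ :* D″ :* (D :* e)) refl D D′ D″ d e ⟩
  D * D′ * (D″ * d) + D′ * D″ * (D * e)
    ≡⟨ cong₂ (λ a b → D * D′ * a + D′ * D″ * b) (∑crossings-equal i u) (at (suc (suc i)) i (n≤1+n (suc i)) i<n u n∸i′) ⟩
  D * D′ * (suc i * suc (suc u) * Q) + D′ * D″ * (i * u * Q)
    ≡⟨ solve 3 (λ i u q → let n = con 2 :+ (i :+ u); D = n :+ (con 2 :+ i); D′ = n :+ (con 1 :+ i); D″ = n :+ i in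
         D :* D′ :* ((con 1 :+ i) :* (con 2 :+ u) :* q) :+ D′ :* D″ :* (i :* u :* q)
         := (con 2 :* n :* D″ :+ con 2 :* (n :* (con 1 :+ i)) :* D) :* q
            :+ (D :* D″ :* (i :* (con 1 :+ u) :* q) :+ D′ :* D″ :* ((con 1 :+ i) :* u :* q))) refl i u Q ⟩
  (2 * n * D″ + 2 * (n * suc i) * D) * Q + (D * D″ * (i * suc u * Q) + D′ * D″ * (suc i * u * Q)) ∎)
  where
  open ≡-Reasoning
  open +-*-Solver
  D = n + suc (suc i)
  D′ = n + suc i
  D″ = n + i
  Q = queues n
  a = ∑crossings n i (suc i)
  b = ∑crossings n (suc i) (suc (suc i))
  m = adjacencies n (suc i) (suc (suc i))
  d = ∑crossings n (suc i) (suc i)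
  e = ∑crossings n i (suc (suc i))
  n∸i : n ∸ suc i ≡ suc u
  n∸i = trans (cong (_∸ i) (sym (+-suc i u))) (m+n∸m≡n i (suc u))
  n∸i′ : n ∸ suc (suc i) ≡ u
  n∸i′ = m+n∸m≡n i u
  at : ∀ j i → i < j → j ≤ n → ∀ v → n ∸ j ≡ v → (n + j) * ∑crossings n i j ≡ i * v * Q
  at j i i<j j≤n v refl = ∑crossings-distinct i<j j≤n

c-frac : ∀ i j n → c i j n ≡ frac (adjacencies n i j) (queues n)
c-frac i j n = cong (frac (adjacencies n i j)) (length-∑ (MLQs n))

theorem1p2 : (n i j : ℕ) → 2 ≤ n → 1 ≤ i → i < j → j ≤ n →
    (suc i < j → c i j n ≡ frac n ((n + j) C 2))
    × (suc i ≡ j → c i j n ≡ frac n ((n + j) C 2) +ℚ frac (n * i) ((n + i) C 2))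
theorem1p2 n (suc i) (suc j) 2≤n 1≤i i<j j≤n = far , next-to
  where
  open ≡-Reasoning
  open +-*-Solver
  Q = queues n
  1≤n : 1 ≤ n
  1≤n = ≤-trans (s≤s z≤n) 2≤n
  double : ∀ j → 2 * ((n + suc j) C 2) ≡ (n + suc j) * (n + j)
  double j rewrite +-suc n j = double-C (n + j)
  nonzero : ∀ j → (n + suc j) C 2 ≢ 0
  nonzero j rewrite +-suc n j = C≢0 (n + j) (≤-trans 1≤n (m≤m+n n j))
  far : suc (suc i) < suc j → c (suc i) (suc j) n ≡ frac n ((n + suc j) C 2)
  far i+1<j = trans (c-frac (suc i) (suc j) n) (frac-cong A n (queues≢0 n) (nonzero j) (*-cancelˡ-≡ _ _ 2 (begin
    2 * (A * B)                     ≡⟨ solve 2 (λ a b → con 2 :* (a :* b) := (con 2 :* b) :* a) refl A B ⟩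
    2 * B * A                       ≡⟨ cong (_* A) (double j) ⟩
    (n + suc j) * (n + j) * A       ≡⟨ adjacencies-far n i j (s≤s⁻¹ i+1<j) j≤n ⟩
    2 * n * Q                       ≡⟨ *-assoc 2 n Q ⟩
    2 * (n * Q)                     ∎)))
    where
    A = adjacencies n (suc i) (suc j)
    B = (n + suc j) C 2
  next-to : suc (suc i) ≡ suc j → c (suc i) (suc j) n ≡ frac n ((n + suc j) C 2) +ℚ frac (n * suc i) ((n + suc i) C 2)
  next-to refl = trans (c-frac (suc i) (suc j) n) (sym (trans (frac-+ n (n * suc i) (nonzero j) (nonzero i))
    -- Each of the two binomial coefficients becomes a product when doubled, hence the factor 4.
    (frac-cong (n * B₂ + n * suc i * B₁) A (product≢0 (nonzero j) (nonzero i)) (queues≢0 n) (*-cancelˡ-≡ _ _ 4 (begin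
    4 * ((n * B₂ + n * suc i * B₁) * Q)
      ≡⟨ solve 5 (λ n m b₁ b₂ q → con 4 :* ((n :* b₂ :+ m :* b₁) :* q) := (con 2 :* n :* (con 2 :* b₂) :+ con 2 :* m :* (con 2 :* b₁)) :* q) refl n (n * suc i) B₁ B₂ Q ⟩
    (2 * n * (2 * B₂) + 2 * (n * suc i) * (2 * B₁)) * Q
      ≡⟨ cong₂ (λ x y → (2 * n * x + 2 * (n * suc i) * y) * Q) (double i) (double (suc i)) ⟩
    (2 * n * (D′ * D″) + 2 * (n * suc i) * (D * D′)) * Q
      ≡⟨ solve 6 (λ n m d d′ d″ q → (con 2 :* n :* (d′ :* d″) :+ con 2 :* m :* (d :* d′)) :* q
           := d′ :* ((con 2 :* n :* d″ :+ con 2 :* m :* d) :* q)) refl n (n * suc i) D D′ D″ Q ⟩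
    D′ * ((2 * n * D″ + 2 * (n * suc i) * D) * Q)
      ≡⟨ cong (D′ *_) (sym (adjacencies-next n i j≤n)) ⟩
    D′ * (D * D′ * D″ * A)
      ≡⟨ solve 4 (λ d d′ d″ a → d′ :* (d :* d′ :* d″ :* a) := a :* ((d :* d′) :* (d′ :* d″))) refl D D′ D″ A ⟩
    A * ((D * D′) * (D′ * D″))
      ≡⟨ cong₂ (λ x y → A * (x * y)) (sym (double (suc i))) (sym (double i)) ⟩
    A * ((2 * B₁) * (2 * B₂))
      ≡⟨ solve 3 (λ a b c → a :* ((con 2 :* b) :* (con 2 :* c)) := con 4 :* (a :* (b :* c))) refl A B₁ B₂ ⟩
    4 * (A * (B₁ * B₂)) ∎)))))
    where
    A = adjacencies n (suc i) (suc (suc i))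
    B₁ = (n + suc (suc i)) C 2
    B₂ = (n + suc i) C 2
    D = n + suc (suc i)
    D′ = n + suc i
    D″ = n + i
    product≢0 : ∀ {a b} → a ≢ 0 → b ≢ 0 → a * b ≢ 0
    product≢0 {a} {b} p q z with m*n≡0⇒m≡0∨n≡0 a z
    ... | inj₁ x = p x
    ... | inj₂ y = q y
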